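{- Let $\mathcal{D}=(\mathcal{P},\mathcal{B})$ be a nontrivial Steiner $3$-design and let $G\leq \mathrm{Aut}(\mathcal{D})$ act transitively on the set of blocks $\mathcal{B}$ and primitively on the set of points $\mathcal{P}$. Then, in the O'Nan–Scott classification of finite primitive permutation groups, $G$ is of affine type or of almost simple type.
   Context: A $t$-$(v,k,\lambda)$ design $\mathcal{D}=(\mathcal{P},\mathcal{B})$ consists of a finite set $\mathcal{P}$ of $v$ points and a set $\mathcal{B}$ of $k$-element subsets of $\mathcal{P}$ (blocks) such that any $t$ distinct points lie in exactly $\lambda$ blocks. It is nontrivial if $t<k<v-t$. A Steiner $3$-design is a $3$-$(v,k,1)$ design. An automorphism is a permutation of $\mathcal{P}$ mapping blocks to blocks; $\mathrm{Aut}(\mathcal{D})$ is the group of all automorphisms. The O'Nan–Scott theorem states that a finite primitive permutation group is permutation isomorphic to a group of exactly one of the types: affine, almost simple, simple diagonal, product, twisted wreath. -}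

module Defs where

open import Data.Nat using (ℕ; zero; suc)
open import Data.Nat.Primality using (Prime)
open import Data.Fin using (Fin)
open import Data.Fin.Subset using (Subset; _∈_; ∣_∣)
open import Data.Fin.Permutation using (Permutation′; _⟨$⟩ʳ_; _⟨$⟩ˡ_; _≈_; id; flip; _∘ₚ_)
open import Data.Vec using (tabulate; lookup)
open import Data.Product using (Σ; ∃; _×_; _,_)
open import Data.Sum using (_⊎_)
open import Relation.Binary.PropositionalEquality using (_≡_; _≢_)
open import Relation.Binary.Structures using (IsEquivalence)
open import Relation.Nullary using (¬_)

PermSet : ℕ → Set₁
PermSet v = Permutation′ v → Set

record IsSubgroup {v : ℕ} (H : PermSet v) : Set where
  field
    resp  : ∀ {π σ} → π ≈ σ → H π → H σ
    id∈   : H id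
    ∘∈    : ∀ {π σ} → H π → H σ → H (π ∘ₚ σ)
    inv∈  : ∀ {π} → H π → H (flip π)

_≤G_ : {v : ℕ} → PermSet v → PermSet v → Set
_≤G_ {v} N H = IsSubgroup N × (∀ {π} → N π → H π)

_⊴_ : {v : ℕ} → PermSet v → PermSet v → Set
N ⊴ H = (N ≤G H) × (∀ {h n} → H h → N n → N (flip h ∘ₚ n ∘ₚ h))

IsTrivial : {v : ℕ} → PermSet v → Set
IsTrivial N = ∀ {n} → N n → n ≈ id

Abelian : {v : ℕ} → PermSet v → Set
Abelian N = ∀ {a b} → N a → N b → (a ∘ₚ b) ≈ (b ∘ₚ a)

_^ₚ_ : {v : ℕ} → Permutation′ v → ℕ → Permutation′ v
π ^ₚ zero  = id
π ^ₚ suc k = π ∘ₚ (π ^ₚ k)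

ElementaryAbelian : {v : ℕ} → PermSet v → Set
ElementaryAbelian N = Abelian N × Σ ℕ (λ p → Prime p × (∀ {n} → N n → (n ^ₚ p) ≈ id))

Simple : {v : ℕ} → PermSet v → Set₁
Simple T = (¬ IsTrivial T)
         × (∀ (N : PermSet _) → N ⊴ T → IsTrivial N ⊎ (∀ {t} → T t → N t))

TrivialCentraliser : {v : ℕ} → PermSet v → PermSet v → Set
TrivialCentraliser G T =
  ∀ {g} → G g → (∀ {t} → T t → (g ∘ₚ t) ≈ (t ∘ₚ g)) → g ≈ id

Transitive : {v : ℕ} → PermSet v → Set
Transitive G = ∀ x y → ∃ λ g → G g × (g ⟨$⟩ʳ x ≡ y)

Regular : {v : ℕ} → PermSet v → Set
Regular N = Transitive N × (∀ {n} x → N n → n ⟨$⟩ʳ x ≡ x → n ≈ id)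

Primitive : {v : ℕ} → PermSet v → Set₁
Primitive {v} G = Transitive G
  × (∀ (R : Fin v → Fin v → Set) → IsEquivalence R
       → (∀ {g x y} → G g → R x y → R (g ⟨$⟩ʳ x) (g ⟨$⟩ʳ y))
       → (∀ {x y} → R x y → x ≡ y) ⊎ (∀ x y → R x y))

-- affine type: G has a regular elementary abelian normal subgroup
-- (i.e. G ≤ AGL(d,p) containing the translation group, socle Z_p^d regular)
AffineType : {v : ℕ} → PermSet v → Set₁
AffineType G = Σ (PermSet _) λ N → (N ⊴ G) × ElementaryAbelian N × Regular N

-- almost simple type: T ⊴ G ≤ Aut(T) for a nonabelian simple group T,
-- i.e. G has a nonabelian simple normal subgroup T with C_G(T) = 1
-- (so conjugation embeds G into Aut(T))
AlmostSimpleType : {v : ℕ} → PermSet v → Set₁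
AlmostSimpleType G = Σ (PermSet _) λ T →
  (T ⊴ G) × Simple T × (¬ Abelian T) × TrivialCentraliser G T

image : {v : ℕ} → Permutation′ v → Subset v → Subset v
image π B = tabulate (λ y → lookup B (π ⟨$⟩ˡ y))

record Steiner3Design (v k : ℕ) : Set₁ where
  field
    Block      : Subset v → Set
    block-size : ∀ {B} → Block B → ∣ B ∣ ≡ k
    steiner    : ∀ x y z → x ≢ y → x ≢ z → y ≢ z →
                 Σ (Subset v) λ B → (Block B × x ∈ B × y ∈ B × z ∈ B)
                   × (∀ B′ → Block B′ → x ∈ B′ → y ∈ B′ → z ∈ B′ → B′ ≡ B)

module _ {v k : ℕ} (D : Steiner3Design v k) where
  open Steiner3Design D

  IsAutomorphism : Permutation′ v → Set
  IsAutomorphism π = ∀ B → Block B → Block (image π B)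

  SubgroupOfAut : PermSet v → Set
  SubgroupOfAut G = IsSubgroup G × (∀ {g} → G g → IsAutomorphism g)

  BlockTransitive : PermSet v → Set
  BlockTransitive G = ∀ B B′ → Block B → Block B′ → ∃ λ g → G g × (image g B ≡ B′)

{-# OPTIONS --safe #-}
module Submission where

-- Primitivity is assumed for all invariant equivalence relations, in particular for x ≡ y ⊎ P, so it decides
-- every proposition P and the argument is classical.
--
-- Write b for the number of blocks. Every G-invariant family of ordered triples of distinct points meets all
-- blocks in the same number c of triples, so its size is c b. Let N be a minimal normal subgroup of G; if N is
-- abelian then G is affine, and if N is simple with trivial centraliser then G is almost simple.
--
-- Suppose that M is a normal subgroup of G with commuting subgroups A and K, where K is transitive (so A is
-- semiregular) and the order of M divides a power of the order of A. The length s of the M-orbits on blocks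
-- divides that power and also v (v - 1)(v - 2), which forces s to divide v; this needs 4 ∣ v when A has even
-- order, which holds as N consists of even permutations. For g in A there are then at most two blocks of an
-- M-orbit on x and x g that g does not fix, so for κ in K with g κ fixing x the square of g κ fixes all blocks
-- on x, x g and all blocks on x, x g⁻¹. Only the identity does so, whence g² lies in A ∩ K. This excludes a
-- nontrivial centraliser of N, and subdirect point stabilisers when N is a product of several components.
--
-- Otherwise the points form a grid of dimension m ≥ 2 whose lines are the orbits of the components. A symmetric
-- invariant family of triples whose third point is determined by the first two is too small to be a multiple of
-- b. Such families are (y t⁻¹, y, y t) if the components are semiregular, and the triples (x, y, z) with
-- {x, z} an orbit of the stabiliser of y in a component. Thus stabilisers in a component have orbits of length
-- at least 3 on the rest of a line, and a block with three points on a line has for each of its points two further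
-- points collinear with it: more collinear pairs than the block can contain.

open import Defs
open import Data.Bool using (Bool; true; false)
open import Data.Empty using (⊥; ⊥-elim)
open import Data.Fin using (Fin; zero; suc; toℕ; fromℕ<) renaming (_<_ to _<ᶠ_)
open import Data.Fin.Properties using (toℕ-injective; toℕ-fromℕ<) renaming (<-cmp to <ᶠ-cmp; <-asym to <ᶠ-asym)
open import Data.Fin.Permutation using (Permutation′; _⟨$⟩ʳ_; _≈_; id; flip; _∘ₚ_; inverseˡ; inverseʳ)
open import Data.Fin.Subset using (Subset; _∈_; inside; outside) renaming (⊤ to full; ∣_∣ to card)
open import Data.Fin.Subset.Properties using (⊆-antisym; ∣⊤∣≡n; ∈⊤; drop-there)
open import Data.List as List using (List; []; _∷_; length; allFin; cartesianProduct; cartesianProductWith)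
import Data.List.Membership.Propositional as List
open import Data.List.Membership.Propositional.Properties using (∈-allFin; ∈-cartesianProduct⁺; ∈-cartesianProductWith⁺)
open import Data.List.Relation.Unary.All as All using (All; []; _∷_)
open import Data.List.Relation.Unary.AllPairs using ([]; _∷_)
open import Data.List.Relation.Unary.Any using (here; there)
open import Data.List.Relation.Unary.Unique.Propositional using (Unique)
open import Data.List.Relation.Unary.Unique.Propositional.Properties using (allFin⁺; cartesianProduct⁺; cartesianProductWith⁺)
open import Data.Nat using (ℕ; zero; suc; _+_; _*_; _∸_; _^_; _≤_; _<_; _≤?_; z≤n; s≤s; NonZero; >-nonZero; n>1⇒nonTrivial; ⌊_/2⌋)
open import Data.Nat.Coprimality using (Coprime; coprime-divisor)
open import Data.Nat.Divisibility using (_∣_; _∣?_; divides; _∣0; ∣-refl; ∣-reflexive; ∣-trans; ∣⇒≤; ∣1⇒≡1; ∣m∣n⇒∣m+n; ∣m+n∣m⇒∣n; m∣m*n; ∣m⇒∣m*n; ∣n⇒∣m*n; *-monoˡ-∣; *-monoʳ-∣)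
open import Data.Nat.Primality using (Prime; irreducible⇒prime)
open import Data.Nat.Properties
open import Data.Nat.Tactic.RingSolver using (solve-∀)
open import Data.Product using (Σ; ∃; _×_; _,_; proj₁; proj₂; swap)
open import Data.Sum using (_⊎_; inj₁; inj₂; [_,_]; [_,_]′)
open import Data.Unit using (⊤; tt)
open import Data.Vec using (Vec; tabulate; lookup; []; _∷_) renaming (here to hereᵛ; there to thereᵛ)
open import Data.Vec.Properties using (lookup∘tabulate; lookup⇒[]=; []=⇒lookup; tabulate-cong)
open import Function using (_∘_)
open import Relation.Binary.Definitions using (tri<; tri≈; tri>)
open import Relation.Binary.PropositionalEquality using (_≡_; _≢_; refl; sym; trans; cong; cong₂; subst; subst₂; module ≡-Reasoning)
open import Relation.Binary.Structures using (IsEquivalence)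
open import Relation.Nullary using (¬_; Dec; yes; no; contradiction)
open import Relation.Nullary.Decidable using (decidable-stable)

-- Counting in finite types

-- It decides propositions in `Set` only. Statements quantifying over subgroups live in `Set₁`, so
-- every appeal to it concerns elements rather than all subgroups.
EM : Set₁
EM = (P : Set) → Dec P

record Finite (A : Set) : Set where
  field
    elems    : List A
    complete : ∀ x → x List.∈ elems
    unique   : Unique elems

open Finite ⦃ ... ⦄

instance
  finite-Fin : ∀ {n} → Finite (Fin n)
  finite-Fin {n} = record { elems = allFin n ; complete = ∈-allFin ; unique = allFin⁺ n }

  finite-Bool : Finite Bool
  finite-Bool = record
    { elems    = false ∷ true ∷ []
    ; complete = λ { false → here refl ; true → there (here refl) }
    ; unique   = ((λ ()) ∷ []) ∷ ([] ∷ [])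
    }

  finite-× : ∀ {A B} → ⦃ Finite A ⦄ → ⦃ Finite B ⦄ → Finite (A × B)
  finite-× = record
    { elems    = cartesianProduct elems elems
    ; complete = λ (x , y) → ∈-cartesianProduct⁺ (complete x) (complete y)
    ; unique   = cartesianProduct⁺ unique unique
    }

  finite-Vec : ∀ {A n} → ⦃ Finite A ⦄ → Finite (Vec A n)
  finite-Vec {n = zero}  = record
    { elems = [] ∷ [] ; complete = λ { [] → here refl } ; unique = [] ∷ [] }
  finite-Vec {n = suc n} = record
    { elems    = cartesianProductWith _∷_ elems (elems ⦃ finite-Vec ⦄)
    ; complete = λ { (x ∷ xs) → ∈-cartesianProductWith⁺ _∷_ (complete x) (complete ⦃ finite-Vec ⦄ xs) }
    ; unique   = cartesianProductWith⁺ _∷_ (λ { refl → refl , refl }) unique (unique ⦃ finite-Vec ⦄)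
    }

∑ : {A : Set} → List A → (A → ℕ) → ℕ
∑ []       f = 0
∑ (x ∷ xs) f = f x + ∑ xs f

∑-mono : ∀ {A : Set} (xs : List A) {f g : A → ℕ} → (∀ x → f x ≤ g x) → ∑ xs f ≤ ∑ xs g
∑-mono []       f≤g = z≤n
∑-mono (x ∷ xs) f≤g = +-mono-≤ (f≤g x) (∑-mono xs f≤g)

∑-cong : ∀ {A : Set} (xs : List A) {f g : A → ℕ} → (∀ x → f x ≡ g x) → ∑ xs f ≡ ∑ xs g
∑-cong []       f≡g = refl
∑-cong (x ∷ xs) f≡g = cong₂ _+_ (f≡g x) (∑-cong xs f≡g)

+-interchange : ∀ a b c d → (a + b) + (c + d) ≡ (a + c) + (b + d)
+-interchange a b c d = begin
  (a + b) + (c + d)  ≡⟨ +-assoc a b (c + d) ⟩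
  a + (b + (c + d))  ≡⟨ cong (a +_) (sym (+-assoc b c d)) ⟩
  a + ((b + c) + d)  ≡⟨ cong (λ t → a + (t + d)) (+-comm b c) ⟩
  a + ((c + b) + d)  ≡⟨ cong (a +_) (+-assoc c b d) ⟩
  a + (c + (b + d))  ≡⟨ sym (+-assoc a c (b + d)) ⟩
  (a + c) + (b + d)  ∎
  where open ≡-Reasoning

∑-+ : ∀ {A : Set} (xs : List A) (f g : A → ℕ) → ∑ xs (λ x → f x + g x) ≡ ∑ xs f + ∑ xs g
∑-+ []       f g = refl
∑-+ (x ∷ xs) f g =
  trans (cong ((f x + g x) +_) (∑-+ xs f g)) (+-interchange (f x) (g x) (∑ xs f) (∑ xs g))

∑-* : ∀ {A : Set} (xs : List A) c (f : A → ℕ) → ∑ xs (λ x → c * f x) ≡ c * ∑ xs f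
∑-* []       c f = sym (*-zeroʳ c)
∑-* (x ∷ xs) c f = trans (cong (c * f x +_) (∑-* xs c f)) (sym (*-distribˡ-+ c (f x) (∑ xs f)))

∑-zero : ∀ {A : Set} (xs : List A) → ∑ xs (λ _ → 0) ≡ 0
∑-zero []       = refl
∑-zero (x ∷ xs) = ∑-zero xs

∑-swap : ∀ {A B : Set} (xs : List A) (ys : List B) (f : A → B → ℕ) →
         ∑ xs (λ x → ∑ ys (f x)) ≡ ∑ ys (λ y → ∑ xs (λ x → f x y))
∑-swap []       ys f = sym (∑-zero ys)
∑-swap (x ∷ xs) ys f =
  trans (cong (∑ ys (f x) +_) (∑-swap xs ys f)) (sym (∑-+ ys (f x) (λ y → ∑ xs (λ x → f x y))))

module Counting (em : EM) where

  𝟙 : Set → ℕ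
  𝟙 P with em P
  ... | yes _ = 1
  ... | no  _ = 0

  𝟙-yes : ∀ {P} → P → 𝟙 P ≡ 1
  𝟙-yes {P} p with em P
  ... | yes _ = refl
  ... | no ¬p = contradiction p ¬p

  𝟙-no : ∀ {P} → ¬ P → 𝟙 P ≡ 0
  𝟙-no {P} ¬p with em P
  ... | yes p = contradiction p ¬p
  ... | no  _ = refl

  𝟙-mono : ∀ {P Q} → (P → Q) → 𝟙 P ≤ 𝟙 Q
  𝟙-mono {P} f with em P
  ... | yes p = ≤-reflexive (sym (𝟙-yes (f p)))
  ... | no  _ = z≤n

  opaque

    stable : ∀ {P : Set} → ¬ ¬ P → P
    stable = decidable-stable (em _)

  opaque
    -- Opaque, so that type checking does not unfold a count into a sum over a list.
    #_ : ∀ {A : Set} ⦃ _ : Finite A ⦄ → (A → Set) → ℕ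
    #_ {A} P = ∑ (elems {A}) (λ x → 𝟙 (P x))

    #-unfold : ∀ {A : Set} ⦃ _ : Finite A ⦄ (P : A → Set) → # P ≡ ∑ (elems {A}) (λ x → 𝟙 (P x))
    #-unfold P = refl

  module _ {A : Set} ⦃ _ : Finite A ⦄ where

    opaque

      #-mono : ∀ {P Q : A → Set} → (∀ x → P x → Q x) → # P ≤ # Q
      #-mono {P} {Q} P⊆Q = subst₂ _≤_ (sym (#-unfold P)) (sym (#-unfold Q)) (∑-mono (elems {A}) (λ x → 𝟙-mono (P⊆Q x)))

      #-cong : ∀ {P Q : A → Set} → (∀ x → P x → Q x) → (∀ x → Q x → P x) → # P ≡ # Q
      #-cong P⊆Q Q⊆P = ≤-antisym (#-mono P⊆Q) (#-mono Q⊆P)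

      #-singleton : ∀ a → # (λ (x : A) → x ≡ a) ≡ 1
      #-singleton a = trans (#-unfold _) (go elems unique (complete a))
        where
        absent : ∀ xs → All (a ≢_) xs → ∑ xs (λ x → 𝟙 (x ≡ a)) ≡ 0
        absent []       []       = refl
        absent (x ∷ xs) (p ∷ ps) = cong₂ _+_ (𝟙-no (λ e → p (sym e))) (absent xs ps)

        go : ∀ xs → Unique xs → a List.∈ xs → ∑ xs (λ x → 𝟙 (x ≡ a)) ≡ 1
        go (x ∷ xs) (x∉ ∷ _) (here refl) = cong₂ _+_ (𝟙-yes refl) (absent xs x∉)
        go (x ∷ xs) (x∉ ∷ u) (there a∈)  =
          cong₂ _+_ (𝟙-no (λ { refl → All.lookup x∉ a∈ refl })) (go xs u a∈)

      #-empty : ∀ {P : A → Set} → (∀ x → ¬ P x) → # P ≡ 0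
      #-empty {P} ¬P = trans (#-unfold P) (trans (∑-cong (elems {A}) (λ x → 𝟙-no (¬P x))) (∑-zero (elems {A})))

      #-split : ∀ (P Q : A → Set) → # P ≡ # (λ x → P x × Q x) + # (λ x → P x × ¬ Q x)
      #-split P Q = trans (#-unfold P) (trans (∑-cong (elems {A}) pointwise)
        (trans (∑-+ (elems {A}) _ _) (sym (cong₂ _+_ (#-unfold _) (#-unfold _)))))
        where
        pointwise : ∀ x → 𝟙 (P x) ≡ 𝟙 (P x × Q x) + 𝟙 (P x × ¬ Q x)
        pointwise x with em (P x) | em (Q x)
        ... | yes p | yes q = sym (cong₂ _+_ (𝟙-yes (p , q)) (𝟙-no (λ (_ , ¬q) → ¬q q)))
        ... | yes p | no ¬q = sym (cong₂ _+_ (𝟙-no (λ (_ , q) → ¬q q)) (𝟙-yes (p , ¬q)))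
        ... | no ¬p | _     = sym (cong₂ _+_ (𝟙-no (λ (p , _) → ¬p p)) (𝟙-no (λ (p , _) → ¬p p)))

      #-remove : ∀ {P : A → Set} {a} → P a → # P ≡ suc (# (λ x → P x × x ≢ a))
      #-remove {P} {a} pa = trans (#-split P (_≡ a))
        (cong (_+ # (λ x → P x × x ≢ a))
          (trans (#-cong (λ _ → proj₂) (λ { _ refl → pa , refl })) (#-singleton a)))

      #-pick : ∀ {P : A → Set} → 1 ≤ # P → ∃ P
      #-pick {P} 1≤ with em (∃ P)
      ... | yes e = e
      ... | no ¬e = contradiction (subst (1 ≤_) (#-empty (λ x p → ¬e (x , p))) 1≤) λ ()

      #≥1 : ∀ {P : A → Set} {a} → P a → 1 ≤ # P
      #≥1 pa = subst (1 ≤_) (sym (#-remove pa)) (s≤s z≤n)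

      #≥2 : ∀ {P : A → Set} {a b} → P a → P b → b ≢ a → 2 ≤ # P
      #≥2 pa pb b≢a = subst (2 ≤_) (sym (#-remove pa)) (s≤s (#≥1 (pb , b≢a)))

      #≥3 : ∀ {P : A → Set} {a b c} → P a → P b → P c → b ≢ a → c ≢ a → c ≢ b → 3 ≤ # P
      #≥3 pa pb pc b≢a c≢a c≢b = subst (3 ≤_) (sym (#-remove pa)) (s≤s (#≥2 (pb , b≢a) (pc , c≢a) c≢b))

      #≤1 : ∀ {P : A → Set} → (∀ {a b} → P a → P b → a ≡ b) → # P ≤ 1
      #≤1 {P} eq with em (∃ P)
      ... | yes (a , pa) = subst (# P ≤_) (#-singleton a) (#-mono (λ _ p → eq p pa))
      ... | no ¬e        = subst (_≤ 1) (sym (#-empty (λ x p → ¬e (x , p)))) z≤n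

      #≡1 : ∀ {P : A → Set} {a} → P a → (∀ {a b} → P a → P b → a ≡ b) → # P ≡ 1
      #≡1 pa eq = ≤-antisym (#≤1 eq) (#≥1 pa)

      #-pick₃ : ∀ {P : A → Set} → 3 ≤ # P →
                ∃ λ a → ∃ λ b → ∃ λ c → (P a × P b × P c) × (a ≢ b × a ≢ c × b ≢ c)
      #-pick₃ 3≤ with #-pick (≤-trans (s≤s z≤n) 3≤)
      ... | a , pa with ≤-pred (subst (3 ≤_) (#-remove pa) 3≤)
      ... | 2≤ with #-pick (≤-trans (s≤s z≤n) 2≤)
      ... | b , (pb , b≢a) with #-pick (≤-pred (subst (2 ≤_) (#-remove (pb , b≢a)) 2≤))
      ... | c , ((pc , c≢a) , c≢b) =
        a , b , c , (pa , pb , pc) , ((λ e → b≢a (sym e)) , (λ e → c≢a (sym e)) , (λ e → c≢b (sym e)))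

      #-⊆-eq : ∀ {P Q : A → Set} → (∀ x → P x → Q x) → # Q ≤ # P → ∀ {x} → Q x → P x
      #-⊆-eq {P} {Q} P⊆Q Q≤P {x} qx = stable λ ¬px → 1+n≰n (begin
        suc (# P)                     ≤⟨ s≤s (#-mono (λ y py → P⊆Q y py , λ { refl → ¬px py })) ⟩
        suc (# (λ y → Q y × y ≢ x))   ≡⟨ sym (#-remove qx) ⟩
        # Q                           ≤⟨ Q≤P ⟩
        # P                           ∎)
        where open ≤-Reasoning

      #-∪ : ∀ (P Q : A → Set) → # (λ x → P x ⊎ Q x) ≤ # P + # Q
      #-∪ P Q = ≤-trans (≤-reflexive (#-unfold _)) (≤-trans (∑-mono (elems {A}) pointwise)
        (≤-reflexive (trans (∑-+ (elems {A}) _ _) (sym (cong₂ _+_ (#-unfold P) (#-unfold Q))))))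
        where
        pointwise : ∀ x → 𝟙 (P x ⊎ Q x) ≤ 𝟙 (P x) + 𝟙 (Q x)
        pointwise x with em (P x) | em (Q x)
        ... | yes p | _     = ≤-trans (≤-reflexive (𝟙-yes (inj₁ p))) (m≤m+n 1 _)
        ... | no ¬p | yes q = ≤-reflexive (𝟙-yes (inj₂ q))
        ... | no ¬p | no ¬q = ≤-reflexive (𝟙-no [ ¬p , ¬q ])

  module _ {A B : Set} ⦃ _ : Finite A ⦄ ⦃ _ : Finite B ⦄ where

    opaque

      -- The pairs (x, y) in `R` with `P x` and `Q y` are counted by rows for the lower bound and by
      -- columns for the upper one.
      double-count-≤ : ∀ {P : A → Set} {Q : B → Set} (R : A → B → Set) {a c} →
        (∀ x → P x → a ≤ # (λ y → Q y × R x y)) →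
        (∀ y → Q y → # (λ x → P x × R x y) ≤ c) →
        a * # P ≤ c * # Q
      double-count-≤ {P} {Q} R {a} {c} lower upper = begin
        a * # P                                             ≡⟨ cong (a *_) (#-unfold P) ⟩
        a * ∑ (elems {A}) (λ x → 𝟙 (P x))                   ≡⟨ sym (∑-* (elems {A}) a _) ⟩
        ∑ (elems {A}) (λ x → a * 𝟙 (P x))                   ≤⟨ ∑-mono (elems {A}) rows ⟩
        ∑ (elems {A}) (λ x → ∑ (elems {B}) (λ y → 𝟙 (S x y)))   ≡⟨ ∑-swap (elems {A}) (elems {B}) (λ x y → 𝟙 (S x y)) ⟩
        ∑ (elems {B}) (λ y → ∑ (elems {A}) (λ x → 𝟙 (S x y)))   ≤⟨ ∑-mono (elems {B}) columns ⟩
        ∑ (elems {B}) (λ y → c * 𝟙 (Q y))                   ≡⟨ ∑-* (elems {B}) c _ ⟩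
        c * ∑ (elems {B}) (λ y → 𝟙 (Q y))                   ≡⟨ cong (c *_) (sym (#-unfold Q)) ⟩
        c * # Q                                             ∎
        where
        open ≤-Reasoning
        S : A → B → Set
        S x y = P x × Q y × R x y

        rows : ∀ x → a * 𝟙 (P x) ≤ ∑ (elems {B}) (λ y → 𝟙 (S x y))
        rows x with em (P x)
        ... | yes p = ≤-trans (≤-reflexive (*-identityʳ a)) (≤-trans (lower x p)
          (≤-trans (#-mono (λ y s → p , s)) (≤-reflexive (#-unfold _))))
        ... | no  _ = ≤-trans (≤-reflexive (*-zeroʳ a)) z≤n

        columns : ∀ y → ∑ (elems {A}) (λ x → 𝟙 (S x y)) ≤ c * 𝟙 (Q y)
        columns y with em (Q y)
        ... | yes q = ≤-trans (≤-reflexive (sym (#-unfold (λ x → S x y)))) (≤-trans (#-mono (λ x (p , _ , r) → p , r))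
          (≤-trans (upper y q) (≤-reflexive (sym (*-identityʳ c)))))
        ... | no ¬q = ≤-trans (≤-reflexive (trans (sym (#-unfold (λ x → S x y))) (#-empty (λ x (_ , q , _) → ¬q q)))) z≤n

  module _ {A B : Set} ⦃ _ : Finite A ⦄ ⦃ _ : Finite B ⦄ where

    opaque

      double-count : ∀ {P : A → Set} {Q : B → Set} (R : A → B → Set) {a c} →
        (∀ x → P x → # (λ y → Q y × R x y) ≡ a) →
        (∀ y → Q y → # (λ x → P x × R x y) ≡ c) →
        a * # P ≡ c * # Q
      double-count R rows columns = ≤-antisym
        (double-count-≤ R (λ x p → ≤-reflexive (sym (rows x p))) (λ y q → ≤-reflexive (columns y q)))
        (double-count-≤ (λ y x → R x y) (λ y q → ≤-reflexive (sym (columns y q))) (λ x p → ≤-reflexive (rows x p)))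

      #-injection : ∀ {P : A → Set} {Q : B → Set} (R : A → B → Set) →
        (∀ x → P x → ∃ λ y → Q y × R x y) →
        (∀ {x x′ y} → P x → P x′ → Q y → R x y → R x′ y → x ≡ x′) →
        # P ≤ # Q
      #-injection {P} {Q} R total inj = subst₂ _≤_ (*-identityˡ (# P)) (*-identityˡ (# Q))
        (double-count-≤ R (λ x p → #≥1 (proj₂ (total x p)))
                          (λ y q → #≤1 (λ (p , r) (p′ , r′) → inj p p′ q r r′)))

  opaque

    #-bijection : ∀ {A B : Set} ⦃ _ : Finite A ⦄ ⦃ _ : Finite B ⦄ {P : A → Set} {Q : B → Set}
      (f : A → B) (g : B → A) → (∀ x → P x → Q (f x)) → (∀ y → Q y → P (g y)) →
      (∀ x → P x → g (f x) ≡ x) → (∀ y → Q y → f (g y) ≡ y) → # P ≡ # Q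
    #-bijection f g Pf Qg gf fg = ≤-antisym
      (#-injection (λ x y → f x ≡ y) (λ x p → f x , Pf x p , refl)
        (λ p p′ _ e e′ → trans (sym (gf _ p)) (trans (cong g (trans e (sym e′))) (gf _ p′))))
      (#-injection (λ y x → g y ≡ x) (λ y q → g y , Qg y q , refl)
        (λ q q′ _ e e′ → trans (sym (fg _ q)) (trans (cong f (trans e (sym e′))) (fg _ q′))))

  module _ {A B : Set} ⦃ _ : Finite A ⦄ ⦃ _ : Finite B ⦄ where

    opaque

      pair-fibre : ∀ {P : A → Set} {Q : A → B → Set} x → P x →
        # (λ (p : A × B) → (P (proj₁ p) × Q (proj₁ p) (proj₂ p)) × x ≡ proj₁ p) ≡ # (Q x)
      pair-fibre x px = #-bijection proj₂ (x ,_) (λ { _ ((_ , q) , refl) → q })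
        (λ y q → (px , q) , refl) (λ { _ (_ , refl) → refl }) (λ _ _ → refl)

      #-fibre-≥ : ∀ {P : A → Set} {Q : A → B → Set} {a} → (∀ x → P x → a ≤ # (Q x)) →
        a * # P ≤ # (λ (p : A × B) → P (proj₁ p) × Q (proj₁ p) (proj₂ p))
      #-fibre-≥ fibres = ≤-trans
        (double-count-≤ (λ x p → x ≡ proj₁ p) {c = 1}
          (λ x px → ≤-trans (fibres x px) (≤-reflexive (sym (pair-fibre x px))))
          (λ p _ → #≤1 (λ { (_ , refl) (_ , refl) → refl })))
        (≤-reflexive (*-identityˡ _))

      #-fibre-≤ : ∀ {P : A → Set} {Q : A → B → Set} {a} → (∀ x → P x → # (Q x) ≤ a) →
        # (λ (p : A × B) → P (proj₁ p) × Q (proj₁ p) (proj₂ p)) ≤ a * # P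
      #-fibre-≤ fibres = ≤-trans (≤-reflexive (sym (*-identityˡ _)))
        (double-count-≤ (λ p x → x ≡ proj₁ p) {a = 1}
          (λ (x , _) (px , _) → #≥1 (px , refl))
          (λ x px → ≤-trans (≤-reflexive (pair-fibre x px)) (fibres x px)))

      #-fibre : ∀ {P : A → Set} {Q : A → B → Set} {a} → (∀ x → P x → # (Q x) ≡ a) →
        # (λ (p : A × B) → P (proj₁ p) × Q (proj₁ p) (proj₂ p)) ≡ a * # P
      #-fibre fibres = ≤-antisym (#-fibre-≤ (λ x px → ≤-reflexive (fibres x px)))
                                 (#-fibre-≥ (λ x px → ≤-reflexive (sym (fibres x px))))

  opaque

    -- One class is removed at a time; what is left is still a union of classes of size `s`, and
    -- `fuel` bounds its size.
    classes-divide : ∀ {A : Set} ⦃ _ : Finite A ⦄ (P : A → Set) (_~_ : A → A → Set) s →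
      (∀ {x} → P x → x ~ x) → (∀ {x y} → x ~ y → y ~ x) → (∀ {x y z} → x ~ y → y ~ z → x ~ z) →
      (∀ x → P x → # (λ y → P y × x ~ y) ≡ s) → s ∣ # P
    classes-divide {A} P₀ _~_ s ~refl ~sym ~trans sizes₀ = go _ P₀ (λ p → p) ≤-refl sizes₀
      where
      go : ∀ fuel (P : A → Set) → (∀ {x} → P x → P₀ x) → # P ≤ fuel →
           (∀ x → P x → # (λ y → P y × x ~ y) ≡ s) → s ∣ # P
      go fuel P P⊆ bound sizes with em (∃ P)
      go fuel P P⊆ bound sizes | no ¬e = subst (s ∣_) (sym (#-empty (λ x p → ¬e (x , p)))) (s ∣0)
      go zero P P⊆ bound sizes | yes (x , px) = contradiction (≤-trans (#≥1 px) bound) λ ()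
      go (suc fuel) P P⊆ bound sizes | yes (x , px) =
        subst (s ∣_) (sym total) (∣m∣n⇒∣m+n ∣-refl (go fuel P′ (λ (p , _) → P⊆ p) (≤-pred smaller) sizes′))
        where
        P′ : A → Set
        P′ y = P y × ¬ (x ~ y)

        total : # P ≡ s + # P′
        total = trans (#-split P (x ~_)) (cong (_+ # P′) (sizes x px))

        -- The class of `x` contains `x`, so `s` is at least 1 and the remainder shrinks.
        smaller : suc (# P′) ≤ suc fuel
        smaller = begin
          suc (# P′)   ≤⟨ +-monoˡ-≤ (# P′) (subst (1 ≤_) (sizes x px) (#≥1 (px , ~refl (P⊆ px)))) ⟩
          s + # P′     ≡⟨ sym total ⟩
          # P          ≤⟨ bound ⟩
          suc fuel     ∎
          where open ≤-Reasoning

        sizes′ : ∀ y → P′ y → # (λ z → P′ z × y ~ z) ≡ s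
        sizes′ y (py , x≁y) = trans
          (#-cong (λ z ((pz , _) , y~z) → pz , y~z)
                  (λ z (pz , y~z) → (pz , λ x~z → x≁y (~trans x~z (~sym y~z))) , y~z))
          (sizes y py)

    -- The pairs {x, f x} are the classes of an equivalence relation.
    free-involution-even : ∀ {A : Set} ⦃ _ : Finite A ⦄ (P : A → Set) (f : A → A) →
      (∀ {x} → P x → P (f x)) → (∀ {x} → P x → f (f x) ≡ x) → (∀ {x} → P x → f x ≢ x) → 2 ∣ # P
    free-involution-even {A} P f Pf ff≡ f≢ = classes-divide P _~_ 2
      (λ p → inj₁ refl)
      (λ { (inj₁ e) → inj₁ (sym e) ; (inj₂ (p , q , e)) → inj₂ (q , p , trans (sym (ff≡ p)) (cong f (sym e))) })
      (λ { (inj₁ refl) r → r ; (inj₂ s) (inj₁ refl) → inj₂ s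
         ; (inj₂ (p , q , refl)) (inj₂ (_ , _ , e)) → inj₁ (trans e (ff≡ p)) })
      sizes
      where
      _~_ : A → A → Set
      x ~ y = y ≡ x ⊎ (P x × P y × y ≡ f x)

      sizes : ∀ x → P x → # (λ y → P y × x ~ y) ≡ 2
      sizes x px = trans (#-remove (px , inj₁ refl)) (cong suc
        (trans (#-cong (λ { y ((_ , inj₁ e) , y≢) → contradiction e y≢ ; y ((_ , inj₂ (_ , _ , e)) , _) → e })
                       (λ { y refl → (Pf px , inj₂ (px , Pf px , refl)) , f≢ px }))
               (#-singleton (f x))))

    minimal : ∀ {A : Set} (P : A → Set) (f : A → ℕ) → ∃ P → ∃ λ x → P x × (∀ y → P y → f x ≤ f y)
    minimal {A} P f (x₀ , p₀) = go (f x₀) x₀ p₀ ≤-refl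
      where
      go : ∀ fuel x → P x → f x ≤ fuel → ∃ λ x → P x × (∀ y → P y → f x ≤ f y)
      go fuel x px bound with em (∃ λ y → P y × f y < f x)
      go fuel x px bound | no ¬smaller = x , px , λ y py → ≮⇒≥ (λ lt → ¬smaller (y , py , lt))
      go zero x px bound | yes (y , py , lt) = contradiction (≤-trans lt bound) λ ()
      go (suc fuel) x px bound | yes (y , py , lt) = go fuel y py (≤-pred (≤-trans lt bound))

  module _ {A : Set} ⦃ _ : Finite A ⦄ where

    -- The inequalities are nested in the order in which points are taken out of `P`, so that the
    -- count is a product of successive fibre sizes.
    Distinct : (A → Set) → A × A × A → Set
    Distinct P (x , y , z) = P x × (P y × y ≢ x) × ((P z × z ≢ x) × z ≢ y)

    opaque

      #-distinct : ∀ (P : A → Set) s → # P ≡ suc (suc s) → # Distinct P ≡ s * suc s * suc (suc s)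
      #-distinct P s #P = trans (#-fibre {P = P} second) (cong (s * suc s *_) #P)
        where
        second : ∀ x → P x → # (λ (q : A × A) → (P (proj₁ q) × proj₁ q ≢ x) × ((P (proj₂ q) × proj₂ q ≢ x) × proj₂ q ≢ proj₁ q)) ≡ s * suc s
        second x px = trans (#-fibre {P = λ y → P y × y ≢ x} third) (cong (s *_) #P∖x)
          where
          #P∖x : # (λ y → P y × y ≢ x) ≡ suc s
          #P∖x = suc-injective (trans (sym (#-remove px)) #P)
          third : ∀ y → P y × y ≢ x → # (λ z → (P z × z ≢ x) × z ≢ y) ≡ s
          third y py = suc-injective (trans (sym (#-remove py)) #P∖x)

-- Arithmetic

-- The number of ordered triples of distinct elements of an (s + 2)-set.
_↓₃ : ℕ → ℕ
s ↓₃ = s * suc s * suc (suc s)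

even-or-odd : ∀ n → 2 ∣ n ⊎ 2 ∣ suc n
even-or-odd zero    = inj₁ (2 ∣0)
even-or-odd (suc n) = [ (λ e → inj₂ (∣m∣n⇒∣m+n {2} ∣-refl e)) , inj₁ ]′ (even-or-odd n)

even-↓₃ : ∀ s → 2 ∣ s ↓₃
even-↓₃ s = ∣m⇒∣m*n {m = s * suc s} (suc (suc s)) ([ ∣m⇒∣m*n (suc s) , ∣n⇒∣m*n s ]′ (even-or-odd s))

∣2⇒1∨2 : ∀ {d} → d ∣ 2 → d ≡ 1 ⊎ d ≡ 2
∣2⇒1∨2 {0} (divides q eq) = contradiction (trans eq (*-zeroʳ q)) λ ()
∣2⇒1∨2 {1} _ = inj₁ refl
∣2⇒1∨2 {2} _ = inj₂ refl
∣2⇒1∨2 {suc (suc (suc d))} d∣2 = contradiction (∣⇒≤ d∣2) λ { (s≤s (s≤s ())) }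

coprime-^ : ∀ {n a} j → Coprime n a → Coprime (n ^ j) a
coprime-^ zero    c (d∣1 , _) = ∣1⇒≡1 d∣1
coprime-^ {n} {a} (suc j) c {d} (d∣ , d∣a) = coprime-^ j c (coprime-divisor d⊥n d∣ , d∣a)
  where
  d⊥n : Coprime d n
  d⊥n (e∣d , e∣n) = c (e∣n , ∣-trans e∣d d∣a)

coprime-∣ : ∀ {s m a} → s ∣ m → Coprime m a → Coprime s a
coprime-∣ s∣m c (d∣s , d∣a) = c (∣-trans d∣s s∣m , d∣a)

-- Here n is the order of a semiregular group, s the length of a block orbit and v = u + 2. Since n
-- divides v, it is coprime to v - 1 and its common divisors with v - 2 divide 2. So the factors u
-- and u + 1 on the right, u first halved if n is even, are coprime to s and can be cancelled.
orbit-size-divides : ∀ {s n} j {ν t u} → s ∣ n ^ j → n ∣ 2 + u → (2 ∣ n → 4 ∣ 2 + u) →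
  s * ν * (t ↓₃) ≡ u ↓₃ → s ∣ 2 + u
orbit-size-divides {s} {n} j {ν} {t} {u} s∣ n∣v four count with 2 ∣? n
... | no 2∤n = coprime-divisor (coprime-∣ s∣ (coprime-^ j n⊥v-1))
    (coprime-divisor (coprime-∣ s∣ (coprime-^ j n⊥v-2))
      (subst (s ∣_) (trans count (*-assoc u (suc u) (2 + u))) (∣m⇒∣m*n (t ↓₃) (m∣m*n ν))))
  where
  n⊥v-1 : Coprime n (suc u)
  n⊥v-1 {d} (d∣n , d∣) = ∣1⇒≡1 (∣m+n∣m⇒∣n (subst (d ∣_) (+-comm 1 (suc u)) (∣-trans d∣n n∣v)) d∣)

  n⊥v-2 : Coprime n u
  n⊥v-2 {d} (d∣n , d∣u) with ∣2⇒1∨2 (∣m+n∣m⇒∣n (subst (d ∣_) (+-comm 2 u) (∣-trans d∣n n∣v)) d∣u)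
  ... | inj₁ e    = e
  ... | inj₂ refl = contradiction d∣n 2∤n
-- For even n, u = 2 z and a factor 2 is cancelled on both sides, since `t ↓₃` is even. As 4 divides
-- u + 2, z is odd and hence coprime to n.
... | yes 2∣n with ∣m+n∣m⇒∣n {2} {2} {u} (∣-trans 2∣n n∣v) ∣-refl | even-↓₃ t
... | divides z refl | divides κ′ κ≡ =
  coprime-divisor (coprime-∣ s∣ (coprime-^ j n⊥v-1))
    (coprime-divisor (coprime-∣ s∣ (coprime-^ j n⊥z)) (divides (ν * κ′) halved))
  where
  n⊥v-1 : Coprime n (suc u)
  n⊥v-1 {d} (d∣n , d∣) = ∣1⇒≡1 (∣m+n∣m⇒∣n (subst (d ∣_) (+-comm 1 (suc u)) (∣-trans d∣n n∣v)) d∣)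

  n⊥z : Coprime n z
  n⊥z {d} (d∣n , d∣z) with ∣2⇒1∨2 (∣m+n∣m⇒∣n (subst (d ∣_) (+-comm 2 u) (∣-trans d∣n n∣v)) (∣m⇒∣m*n 2 d∣z))
  ... | inj₁ e    = e
  ... | inj₂ refl = contradiction
    (∣⇒≤ (∣m+n∣m⇒∣n (subst (4 ∣_) (+-comm 2 u) (four 2∣n)) (*-monoˡ-∣ 2 d∣z)))
    λ { (s≤s (s≤s ())) }

  halved : z * (suc u * (2 + u)) ≡ ν * κ′ * s
  halved = *-cancelʳ-≡ _ _ 2 (begin
    z * (suc u * (2 + u)) * 2  ≡⟨ lhs z (suc u) (2 + u) ⟩
    z * 2 * suc u * (2 + u)    ≡⟨ sym count ⟩
    s * ν * (t ↓₃)             ≡⟨ cong (s * ν *_) κ≡ ⟩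
    s * ν * (κ′ * 2)           ≡⟨ rhs s ν κ′ ⟩
    ν * κ′ * s * 2             ∎)
    where
    open ≡-Reasoning
    lhs : ∀ a b c → a * (b * c) * 2 ≡ a * 2 * b * c
    lhs = solve-∀
    rhs : ∀ a b c → a * b * (c * 2) ≡ b * c * a * 2
    rhs = solve-∀

-- Writing δ = e + 1 for the length of a line and m for the number of lines on a point.
square-root-bound : ∀ {e} → 2 ≤ e → ∀ m → 2 ≤ m →
  ∃ λ q → m * e + 2 ≤ 2 * q × q * q ≤ suc e ^ m
square-root-bound 2≤e (suc zero) (s≤s ())
-- For m = 2 take q = δ.
square-root-bound {e} 2≤e (suc (suc zero)) _ =
  suc e , ≤-reflexive (eq₁ e) , ≤-reflexive (eq₂ e)
  where
  eq₁ : ∀ e → 2 * e + 2 ≡ 2 * suc e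
  eq₁ = solve-∀
  eq₂ : ∀ e → suc e * suc e ≡ suc e * (suc e * 1)
  eq₂ = solve-∀
-- For m = 3 take q = δ + ⌊δ/2⌋: then 3 e + 2 = 3 δ - 1 ≤ 2 q, and 4 q² ≤ 9 δ² ≤ 4 δ³ because δ ≥ 3.
square-root-bound {e} 2≤e (suc (suc (suc zero))) _ =
  δ + ⌊ δ /2⌋ , lower , *-cancelˡ-≤ 4 upper
  where
  δ : ℕ
  δ = suc e
  half : δ ≤ suc (2 * ⌊ δ /2⌋)
  half = go δ
    where
    go : ∀ n → n ≤ suc (2 * ⌊ n /2⌋)
    go zero          = z≤n
    go (suc zero)    = ≤-refl
    go (suc (suc n)) = s≤s (≤-trans (s≤s (go n)) (≤-reflexive (eq ⌊ n /2⌋)))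
      where
      eq : ∀ h → suc (suc (2 * h)) ≡ 2 * suc h
      eq = solve-∀
  double : 2 * ⌊ δ /2⌋ ≤ δ
  double = go δ
    where
    go : ∀ n → 2 * ⌊ n /2⌋ ≤ n
    go zero          = z≤n
    go (suc zero)    = z≤n
    go (suc (suc n)) = ≤-trans (≤-reflexive (*-suc 2 ⌊ n /2⌋)) (s≤s (s≤s (go n)))
  lower : 3 * e + 2 ≤ 2 * (δ + ⌊ δ /2⌋)
  lower = ≤-pred (begin
    suc (3 * e + 2)              ≡⟨ eq₁ e ⟩
    2 * δ + δ                    ≤⟨ +-monoʳ-≤ (2 * δ) half ⟩
    2 * δ + suc (2 * ⌊ δ /2⌋)    ≡⟨ eq₂ δ ⌊ δ /2⌋ ⟩
    suc (2 * (δ + ⌊ δ /2⌋))      ∎)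
    where
    open ≤-Reasoning
    eq₁ : ∀ e → suc (3 * e + 2) ≡ 2 * suc e + suc e
    eq₁ = solve-∀
    eq₂ : ∀ d h → 2 * d + suc (2 * h) ≡ suc (2 * (d + h))
    eq₂ = solve-∀
  upper : 4 * ((δ + ⌊ δ /2⌋) * (δ + ⌊ δ /2⌋)) ≤ 4 * (δ * (δ * (δ * 1)))
  upper = begin
    4 * ((δ + ⌊ δ /2⌋) * (δ + ⌊ δ /2⌋))              ≡⟨ eq₁ δ ⌊ δ /2⌋ ⟩
    (2 * δ + 2 * ⌊ δ /2⌋) * (2 * δ + 2 * ⌊ δ /2⌋)    ≤⟨ *-mono-≤ (+-monoʳ-≤ (2 * δ) double) (+-monoʳ-≤ (2 * δ) double) ⟩
    (2 * δ + δ) * (2 * δ + δ)                        ≡⟨ eq₂ δ ⟩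
    δ * δ * 9                                        ≤⟨ *-monoʳ-≤ (δ * δ) (≤-trans (m≤m+n 9 3) (*-monoʳ-≤ 4 (s≤s 2≤e))) ⟩
    δ * δ * (4 * δ)                                  ≡⟨ eq₃ δ ⟩
    4 * (δ * (δ * (δ * 1)))                          ∎
    where
    open ≤-Reasoning
    eq₁ : ∀ d h → 4 * ((d + h) * (d + h)) ≡ (2 * d + 2 * h) * (2 * d + 2 * h)
    eq₁ = solve-∀
    eq₂ : ∀ d → (2 * d + d) * (2 * d + d) ≡ d * d * 9
    eq₂ = solve-∀
    eq₃ : ∀ d → d * d * (4 * d) ≡ 4 * (d * (d * (d * 1)))
    eq₃ = solve-∀
-- Raising m by 2 multiplies q by δ.
square-root-bound {e} 2≤e (suc (suc (suc (suc m)))) _ =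
  step (square-root-bound 2≤e (suc (suc m)) (s≤s (s≤s z≤n)))
  where
  step : (∃ λ q → suc (suc m) * e + 2 ≤ 2 * q × q * q ≤ suc e ^ suc (suc m)) →
         ∃ λ q → suc (suc (suc (suc m))) * e + 2 ≤ 2 * q × q * q ≤ suc e ^ suc (suc (suc (suc m)))
  step (zero , bound , _) = contradiction (≤-trans (m≤n+m 2 (suc (suc m) * e)) bound) λ ()
  step (q@(suc p) , bound , square) = suc e * q , lower , upper
    where
    open ≤-Reasoning
    lower : suc (suc (suc (suc m))) * e + 2 ≤ 2 * (suc e * q)
    lower = begin
      e + (e + suc (suc m) * e) + 2    ≡⟨ eq₁ e (suc (suc m) * e) ⟩
      2 * e + (suc (suc m) * e + 2)    ≤⟨ +-mono-≤ (*-monoʳ-≤ 2 (m≤m*n e q)) bound ⟩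
      2 * (e * q) + 2 * q              ≡⟨ eq₂ e q ⟩
      2 * (suc e * q)                  ∎
      where
      eq₁ : ∀ a b → a + (a + b) + 2 ≡ 2 * a + (b + 2)
      eq₁ = solve-∀
      eq₂ : ∀ a b → 2 * (a * b) + 2 * b ≡ 2 * (suc a * b)
      eq₂ = solve-∀
    upper : suc e * q * (suc e * q) ≤ suc e ^ suc (suc (suc (suc m)))
    upper = begin
      suc e * q * (suc e * q)              ≡⟨ eq (suc e) q ⟩
      suc e * (suc e * (q * q))            ≤⟨ *-monoʳ-≤ (suc e) (*-monoʳ-≤ (suc e) square) ⟩
      suc e ^ suc (suc (suc (suc m)))      ∎
      where
      eq : ∀ a b → a * b * (a * b) ≡ a * (a * (b * b))
      eq = solve-∀

-- Here t = k - 2 and u = v - 2, `fisher` reads (k - 1)(k - 2) ≤ v - 2, and `dq` with `qq` says that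
-- d + 2 is at most twice the square root of v.
module _ {t u d q : ℕ} (2≤t : 2 ≤ t) (fisher : suc t * t ≤ u) (dq : d + 2 ≤ 2 * q) (qq : q * q ≤ 2 + u) where

  private
    open ≤-Reasoning

    halve : ∀ q → d + 2 ≤ 2 * q → q * q ≤ 2 + u → ∃ λ p → d ≤ 2 * p × p * (2 + p) ≤ 1 + u
    halve zero    dq _  = contradiction (≤-trans (m≤n+m 2 d) dq) λ ()
    halve (suc p) dq qq = p ,
      +-cancelʳ-≤ 2 d (2 * p) (≤-trans dq (≤-reflexive (eq₁ p))) ,
      ≤-pred (≤-trans (≤-reflexive (eq₂ p)) qq)
      where
      eq₁ : ∀ p → 2 * suc p ≡ 2 * p + 2
      eq₁ = solve-∀
      eq₂ : ∀ p → suc (p * (2 + p)) ≡ suc p * suc p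
      eq₂ = solve-∀

    below : ∀ {p} t → p < t → p * (2 + t) + 2 ≤ suc t * t
    below (suc t) (s≤s p≤t) = ≤-trans (+-monoˡ-≤ 2 (*-monoˡ-≤ (3 + t) p≤t)) (≤-reflexive (eq t))
      where
      eq : ∀ t → t * (3 + t) + 2 ≡ suc (suc t) * suc t
      eq = solve-∀

  -- With q = p + 1, d ≤ 2 p and p (p + 2) ≤ u + 1. If t ≤ p, the inequality forces u ≤ t (t + 1),
  -- whence t (t + 2) ≤ u + 1 ≤ t (t + 1) + 1, against t ≥ 2. If p < t, `fisher` turns it into u + 1
  -- ≤ p (t + 2), against p (t + 2) + 2 ≤ (t + 1) t ≤ u.
  family-bound : ¬ (2 * (suc u * u) ≤ d * (t ↓₃))
  family-bound le with halve q dq qq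
  ... | p , d≤2p , pp with t ≤? p
  ... | yes t≤p = contradiction (+-cancelˡ-≤ (t + t * t) t 1 (begin
      t + t * t + t      ≡⟨ eq₁ t ⟩
      t * (2 + t)        ≤⟨ ≤-trans (*-mono-≤ t≤p (+-monoʳ-≤ 2 t≤p)) pp ⟩
      1 + u              ≤⟨ s≤s u≤ ⟩
      1 + t * suc t      ≡⟨ eq₂ t ⟩
      t + t * t + 1      ∎)) (<⇒≱ 2≤t)
    where
    eq₁ : ∀ t → t + t * t + t ≡ t * (2 + t)
    eq₁ = solve-∀
    eq₂ : ∀ t → 1 + t * suc t ≡ t + t * t + 1
    eq₂ = solve-∀
    eq₃ : ∀ p t → 2 * p * (t * suc t * suc (suc t)) ≡ 2 * (p * (2 + t) * (t * suc t))
    eq₃ = solve-∀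
    u≤ : u ≤ t * suc t
    u≤ = *-cancelˡ-≤ (suc u) (*-cancelˡ-≤ 2 (begin
      2 * (suc u * u)                    ≤⟨ le ⟩
      d * (t ↓₃)                         ≤⟨ *-monoˡ-≤ (t ↓₃) d≤2p ⟩
      2 * p * (t ↓₃)                     ≡⟨ eq₃ p t ⟩
      2 * (p * (2 + t) * (t * suc t))    ≤⟨ *-monoʳ-≤ 2 (*-monoˡ-≤ (t * suc t) (≤-trans (*-monoʳ-≤ p (+-monoʳ-≤ 2 t≤p)) pp)) ⟩
      2 * (suc u * (t * suc t))          ∎))
  ... | no t≰p = contradiction (≤-trans (≤-trans (m≤m+n (suc u) 1) (≤-trans (+-monoˡ-≤ 1 u<)
      (+-monoʳ-≤ _ (s≤s z≤n)))) (≤-trans (below t (≰⇒> t≰p)) fisher)) 1+n≰n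
    where
    eq₃ : ∀ p t → 2 * p * (t * suc t * suc (suc t)) ≡ 2 * (p * (2 + t) * (suc t * t))
    eq₃ = solve-∀
    u< : suc u ≤ p * (2 + t)
    u< = *-cancelʳ-≤ (suc u) (p * (2 + t)) u
      ⦃ >-nonZero (≤-trans (*-mono-≤ (s≤s (z≤n {t})) (≤-trans (s≤s z≤n) 2≤t)) fisher) ⦄
      (*-cancelˡ-≤ 2 (begin
        2 * (suc u * u)                    ≤⟨ le ⟩
        d * (t ↓₃)                         ≤⟨ *-monoˡ-≤ (t ↓₃) d≤2p ⟩
        2 * p * (t ↓₃)                     ≡⟨ eq₃ p t ⟩
        2 * (p * (2 + t) * (suc t * t))    ≤⟨ *-monoʳ-≤ 2 (*-monoʳ-≤ (p * (2 + t)) fisher) ⟩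
        2 * (p * (2 + t) * u)              ∎))

  -- The inequality yields u + 1 ≤ p (t + 1). For t ≤ p the right side is less than p (p + 2) ≤ u +
  -- 1, and for p < t it is less than (t + 1) t ≤ u.
  collinear-bound : ¬ (2 * suc u ≤ d * suc t)
  collinear-bound le with halve q dq qq
  ... | p , d≤2p , pp with *-cancelˡ-≤ 2 (≤-trans le (≤-trans (*-monoˡ-≤ (suc t) d≤2p) (≤-reflexive (*-assoc 2 p (suc t)))))
  ... | u≤ with t ≤? p
  ... | yes t≤p = contradiction (begin
      suc (p * suc t)      ≤⟨ +-monoˡ-≤ (p * suc t) (≤-trans (s≤s z≤n) (≤-trans 2≤t t≤p)) ⟩
      p + p * suc t        ≡⟨ sym (*-suc p (suc t)) ⟩
      p * (2 + t)          ≤⟨ *-monoʳ-≤ p (+-monoʳ-≤ 2 t≤p) ⟩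
      p * (2 + p)          ≤⟨ pp ⟩
      1 + u                ≤⟨ u≤ ⟩
      p * suc t            ∎) 1+n≰n
  ... | no t≰p = contradiction (begin
      suc u                ≤⟨ u≤ ⟩
      p * suc t            ≤⟨ *-monoʳ-≤ p (n≤1+n (suc t)) ⟩
      p * (2 + t)          ≤⟨ m≤m+n _ 2 ⟩
      p * (2 + t) + 2      ≤⟨ below t (≰⇒> t≰p) ⟩
      suc t * t            ≤⟨ fisher ⟩
      u                    ∎) 1+n≰n

-- Permutations and orders of permutation groups

Perm : ℕ → Set
Perm = Permutation′

infixl 8 _·_

-- Actions are on the right, matching `∘ₚ`, which applies its left factor first: `x · (g ∘ₚ h)`
-- reduces to `x · g · h`.
_·_ : ∀ {v} → Fin v → Perm v → Fin v
x · g = g ⟨$⟩ʳ x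

module _ {v : ℕ} where

  ·-flip : ∀ (g : Perm v) {x} → x · g · flip g ≡ x
  ·-flip g = inverseˡ g

  flip-· : ∀ (g : Perm v) {x} → x · flip g · g ≡ x
  flip-· g = inverseʳ g

  ·-injective : ∀ (g : Perm v) {x y} → x · g ≡ y · g → x ≡ y
  ·-injective g e = trans (sym (·-flip g)) (trans (cong (_· flip g) e) (·-flip g))

  ·-flip-≡ : ∀ (g : Perm v) {x y} → x · g ≡ y → x ≡ y · flip g
  ·-flip-≡ g refl = sym (·-flip g)

  ·-flip-fixed : ∀ (g : Perm v) {x} → x · g ≡ x → x · flip g ≡ x
  ·-flip-fixed g e = sym (·-flip-≡ g e)

  flip-cong : ∀ {π σ : Perm v} → π ≈ σ → flip π ≈ flip σ
  flip-cong {π} {σ} eq i = ·-injective σ (trans (sym (eq (i · flip π))) (trans (flip-· π) (sym (flip-· σ))))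

  _^^_ : Perm v → Perm v → Perm v
  a ^^ h = flip h ∘ₚ a ∘ₚ h

  ^^-action : ∀ (a h : Perm v) x → x · h · (a ^^ h) ≡ x · a · h
  ^^-action a h x = cong (λ z → z · a · h) (·-flip h)

  Commute : Perm v → Perm v → Set
  Commute g h = (g ∘ₚ h) ≈ (h ∘ₚ g)

  commute-flip : ∀ {g h} → Commute g h → Commute (flip g) h
  commute-flip {g} {h} c i = ·-flip-≡ g (trans (sym (c (i · flip g))) (cong (_· h) (flip-· g)))

  ∈-image : ∀ (g : Perm v) {B x} → x ∈ B → x · g ∈ image g B
  ∈-image g {B} {x} x∈ = lookup⇒[]= (x · g) (image g B)
    (trans (lookup∘tabulate _ (x · g)) (trans (cong (lookup B) (inverseˡ g)) ([]=⇒lookup x∈)))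

  image-∈ : ∀ (g : Perm v) {B x} → x ∈ image g B → x · flip g ∈ B
  image-∈ g {B} {x} x∈ = lookup⇒[]= (x · flip g) B
    (trans (sym (lookup∘tabulate _ x)) ([]=⇒lookup x∈))

  ∈-image′ : ∀ (g : Perm v) {B x} → x · flip g ∈ B → x ∈ image g B
  ∈-image′ g {B} x∈ = subst (_∈ image g B) (flip-· g) (∈-image g x∈)

  image-cong : ∀ {g h : Perm v} → g ≈ h → ∀ B → image g B ≡ image h B
  image-cong {g} {h} eq B = ⊆-antisym
    (λ x∈ → ∈-image′ h (subst (_∈ B) (flip-cong {g} {h} eq _) (image-∈ g x∈)))
    (λ x∈ → ∈-image′ g (subst (_∈ B) (sym (flip-cong {g} {h} eq _)) (image-∈ h x∈)))

  image-∘ : ∀ (g h : Perm v) B → image (g ∘ₚ h) B ≡ image h (image g B)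
  image-∘ g h B = ⊆-antisym
    (λ x∈ → ∈-image′ h (∈-image′ g {B} (image-∈ (g ∘ₚ h) {B} x∈)))
    (λ x∈ → ∈-image′ (g ∘ₚ h) {B} (image-∈ g {B} (image-∈ h x∈)))

  image-id : ∀ (B : Subset v) → image id B ≡ B
  image-id B = ⊆-antisym (λ x∈ → image-∈ id x∈) (λ x∈ → ∈-image′ id x∈)

  image-flip : ∀ (g : Perm v) {B C} → image g B ≡ C → image (flip g) C ≡ B
  image-flip g {B} refl = trans (sym (image-∘ g (flip g) B))
    (trans (image-cong {g ∘ₚ flip g} {id} (λ _ → ·-flip g) B) (image-id B))

  image-injective : ∀ (g : Perm v) {B C} → image g B ≡ image g C → B ≡ C
  image-injective g e = trans (sym (image-flip g refl)) (image-flip g (sym e))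

  -- Permutations are compared up to `≈`, so sets of them are counted through value tables, on which
  -- `≈` becomes equality.
  code : Perm v → Vec (Fin v) v
  code π = tabulate (π ⟨$⟩ʳ_)

  code-≈ : ∀ {π σ : Perm v} → code π ≡ code σ → π ≈ σ
  code-≈ {π} {σ} e i = trans (sym (lookup∘tabulate _ i)) (trans (cong (λ c → lookup c i) e) (lookup∘tabulate _ i))

  ≈-code : ∀ {π σ : Perm v} → π ≈ σ → code π ≡ code σ
  ≈-code e = tabulate-cong e

module Orders (em : EM) where

  open Counting em

  #-Fin-suc : ∀ {n} (P : Fin (suc n) → Set) → # P ≡ 𝟙 (P zero) + # (P ∘ suc)
  #-Fin-suc {n} P = trans (#-unfold P) (cong (𝟙 (P zero) +_)
    (trans (shift n suc (λ i → i)) (sym (#-unfold (P ∘ suc)))))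
    where
    shift : ∀ k (h : Fin n → Fin (suc n)) (g : Fin k → Fin n) →
      ∑ (List.tabulate (h ∘ g)) (𝟙 ∘ P) ≡ ∑ (List.tabulate g) (𝟙 ∘ P ∘ h)
    shift zero    h g = refl
    shift (suc k) h g = cong (𝟙 (P (h (g zero))) +_) (shift k h (g ∘ suc))

  card≡# : ∀ {n} (B : Subset n) → card B ≡ # (_∈ B)
  card≡# []            = sym (#-empty {A = Fin 0} λ ())
  card≡# (inside ∷ B)  = sym (trans (#-Fin-suc (_∈ inside ∷ B))
    (cong₂ _+_ (𝟙-yes hereᵛ) (trans (#-cong (λ _ → drop-there) (λ _ → thereᵛ)) (sym (card≡# B)))))
  card≡# (outside ∷ B) = sym (trans (#-Fin-suc (_∈ outside ∷ B))
    (cong₂ _+_ (𝟙-no λ ()) (trans (#-cong (λ _ → drop-there) (λ _ → thereᵛ)) (sym (card≡# B)))))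

  #-Fin : ∀ {n} → # (λ (_ : Fin n) → ⊤) ≡ n
  #-Fin {n} = trans (#-cong (λ _ _ → ∈⊤) (λ _ _ → tt)) (trans (sym (card≡# full)) (∣⊤∣≡n n))

  module _ {v : ℕ} where

    Code : PermSet v → Vec (Fin v) v → Set
    Code N c = ∃ λ π → N π × code π ≡ c

    order : PermSet v → ℕ
    order N = # (Code N)

    order-⊆-eq : ∀ {M N : PermSet v} → (∀ {π σ} → π ≈ σ → M π → M σ) → (∀ {π} → M π → N π) →
      order N ≤ order M → ∀ {π} → N π → M π
    order-⊆-eq {M} {N} resp M⊆N le {π} Nπ
      with #-⊆-eq {P = Code M} {Q = Code N} (λ c (σ , Mσ , e) → σ , M⊆N Mσ , e) le (π , Nπ , refl)
    ... | σ , Mσ , e = resp (code-≈ {π = σ} {σ = π} e) Mσ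

    order-injection : ∀ {M N : PermSet v} (φ : Perm v → Perm v) →
      (∀ {π} → M π → N (φ π)) → (∀ {π σ} → φ π ≈ φ σ → π ≈ σ) → order M ≤ order N
    order-injection φ maps inj = #-injection (λ c c′ → ∃ λ π → code π ≡ c × code (φ π) ≡ c′)
      (λ { _ (π , Mπ , refl) → code (φ π) , (φ π , maps Mπ , refl) , (π , refl , refl) })
      (λ { _ _ _ (π , refl , e) (σ , refl , e′) → ≈-code {π = π} {σ = σ} (inj (code-≈ {π = φ π} {σ = φ σ} (trans e (sym e′)))) })

    -- Orbit and stabiliser, with f π standing for the image of a base point under π. Right
    -- multiplication by ρ carries the stabiliser `Fibre (f id)` onto the fibre over f ρ.
    orbit-divides-order : ∀ {B : Set} ⦃ _ : Finite B ⦄ {N : PermSet v} → IsSubgroup N →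
      (f : Perm v → B) → (∀ {π σ} → π ≈ σ → f π ≡ f σ) →
      (∀ {π σ} τ → f π ≡ f σ → f (π ∘ₚ τ) ≡ f (σ ∘ₚ τ)) →
      # (λ b → ∃ λ π → N π × f π ≡ b) ∣ order N
    orbit-divides-order {B} {N} sub f f-cong f-equivariant = divides stabiliser
      (trans (sym (*-identityˡ (order N))) (double-count {P = Code N} {Q = Orbit} R {1} {stabiliser} rows columns))
      where
      open IsSubgroup sub
      Orbit : B → Set
      Orbit b = ∃ λ π → N π × f π ≡ b
      Fibre : B → PermSet v
      Fibre b π = N π × f π ≡ b
      R : Vec (Fin v) v → B → Set
      R c b = ∃ λ π → Fibre b π × code π ≡ c
      stabiliser : ℕ
      stabiliser = order (Fibre (f id))

      rows : ∀ c → Code N c → # (λ b → Orbit b × R c b) ≡ 1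
      rows c (π , Nπ , e) = #≡1 ((π , Nπ , refl) , π , (Nπ , refl) , e)
        (λ { (_ , σ , (_ , refl) , e₁) (_ , τ , (_ , refl) , e₂) →
             f-cong (code-≈ {π = σ} {σ = τ} (trans e₁ (sym e₂))) })

      columns : ∀ b → Orbit b → # (λ c → Code N c × R c b) ≡ stabiliser
      columns b (ρ , Nρ , refl) = trans
        (#-cong (λ c (_ , r) → r) (λ { c (π , (Nπ , e) , e′) → (π , Nπ , e′) , (π , (Nπ , e) , e′) }))
        (≤-antisym
          (order-injection (_∘ₚ flip ρ)
            (λ {π} (Nπ , e) → ∘∈ Nπ (inv∈ Nρ) ,
              trans (f-equivariant {π} {ρ} (flip ρ) e) (f-cong {ρ ∘ₚ flip ρ} {id} (λ _ → ·-flip ρ)))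
            (λ eq i → ·-injective (flip ρ) (eq i)))
          (order-injection (_∘ₚ ρ)
            (λ {π} (Nπ , e) → ∘∈ Nπ Nρ , trans (f-equivariant {π} {id} ρ e) (f-cong {id ∘ₚ ρ} {ρ} (λ _ → refl)))
            (λ eq i → ·-injective ρ (eq i))))

    _∙_ : PermSet v → PermSet v → PermSet v
    (A ∙ P) n = ∃ λ a → ∃ λ p → A a × P p × n ≈ (a ∘ₚ p)

    -- Multiplication maps the pairs onto the product set, with all fibres as large as the one over
    -- the identity.
    order-∙ : ∀ {A P : PermSet v} → IsSubgroup A → IsSubgroup P → order (A ∙ P) ∣ order A * order P
    order-∙ {A} {P} subA subP = divides fibre (trans (sym pairs)
      (trans (sym (*-identityˡ _)) (double-count {P = Pairs} {Q = Code (A ∙ P)} R {1} {fibre} rows columns)))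
      where
      module A = IsSubgroup subA
      module P = IsSubgroup subP
      Codes : Set
      Codes = Vec (Fin v) v × Vec (Fin v) v
      Pairs : Codes → Set
      Pairs (c , d) = Code A c × Code P d
      Factors : Perm v → Codes → Set
      Factors n (c , d) = ∃ λ a → ∃ λ p → (A a × P p) × (code a ≡ c × code p ≡ d) × n ≈ (a ∘ₚ p)
      R : Codes → Vec (Fin v) v → Set
      R cd e = ∃ λ n → Factors n cd × code n ≡ e
      fibre : ℕ
      fibre = # (Factors id)

      pairs : # Pairs ≡ order A * order P
      pairs = trans (#-fibre {P = Code A} {Q = λ _ → Code P} (λ _ _ → refl)) (*-comm (order P) (order A))

      rows : ∀ cd → Pairs cd → # (λ e → Code (A ∙ P) e × R cd e) ≡ 1
      rows (c , d) ((a , Aa , ea) , (p , Pp , ep)) = #≡1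
        ((a ∘ₚ p , (a , p , Aa , Pp , λ _ → refl) , refl) , a ∘ₚ p , (a , p , (Aa , Pp) , (ea , ep) , λ _ → refl) , refl)
        (λ { (_ , n , (a₁ , p₁ , _ , (e₁ , e₂) , e₃) , refl) (_ , m , (a₂ , p₂ , _ , (e₄ , e₅) , e₆) , refl) →
          ≈-code {π = n} {σ = m} (λ i → trans (e₃ i) (trans
            (trans (cong (_· p₁) (code-≈ {π = a₁} {σ = a₂} (trans e₁ (sym e₄)) i))
                   (code-≈ {π = p₁} {σ = p₂} (trans e₂ (sym e₅)) (i · a₂)))
            (sym (e₆ i)))) })

      -- Multiply by a₀⁻¹ on the left and by p₀⁻¹ on the right.
      columns : ∀ e → Code (A ∙ P) e → # (λ cd → Pairs cd × R cd e) ≡ fibre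
      columns e (n₀ , (a₀ , p₀ , Aa₀ , Pp₀ , n₀≈) , refl) = trans
        (#-cong (λ { cd (_ , n , (a , p , m , e , n≈) , e′) →
                     a , p , m , e , λ i → trans (sym (code-≈ {π = n} {σ = n₀} e′ i)) (n≈ i) })
                (λ { cd (a , p , (Aa , Pp) , (e₁ , e₂) , n≈) →
                     ((a , Aa , e₁) , (p , Pp , e₂)) , n₀ , (a , p , (Aa , Pp) , (e₁ , e₂) , n≈) , refl }))
        (≤-antisym
          (shift a₀ p₀ n₀ id Aa₀ Pp₀ back)
          (shift (flip a₀) (flip p₀) id n₀ (A.inv∈ Aa₀) (P.inv∈ Pp₀)
            (λ i → sym (n₀≈ i))))
        where
        back : ∀ i → i · flip a₀ · n₀ · flip p₀ ≡ i
        back i = trans (cong (_· flip p₀) (n₀≈ (i · flip a₀))) (trans (·-flip p₀) (flip-· a₀))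

        shift : ∀ a p n m → A a → P p → (∀ i → i · flip a · n · flip p ≡ i · m) →
          # (Factors n) ≤ # (Factors m)
        shift a p n m Aa Pp eq = #-injection
          (λ (c , d) (c′ , d′) → ∃ λ b → ∃ λ q → (code b ≡ c × code q ≡ d) ×
            (code (flip a ∘ₚ b) ≡ c′ × code (q ∘ₚ flip p) ≡ d′))
          (λ { _ (b , q , (Ab , Pq) , (refl , refl) , n≈) →
            (code (flip a ∘ₚ b) , code (q ∘ₚ flip p)) ,
            (flip a ∘ₚ b , q ∘ₚ flip p , (A.∘∈ (A.inv∈ Aa) Ab , P.∘∈ Pq (P.inv∈ Pp)) , (refl , refl) ,
              λ i → trans (sym (eq i)) (cong (_· flip p) (n≈ (i · flip a)))) ,
            b , q , (refl , refl) , (refl , refl) })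
          (λ { {x′ = _} _ _ _ (b , q , (refl , refl) , (e₁ , e₂)) (b′ , q′ , (refl , refl) , (e₃ , e₄)) →
            cong₂ _,_
              (≈-code {π = b} {σ = b′} (λ i → trans (cong (_· b) (sym (·-flip a)))
                (trans (code-≈ {π = flip a ∘ₚ b} {σ = flip a ∘ₚ b′} (trans e₁ (sym e₃)) (i · a))
                  (cong (_· b′) (·-flip a)))))
              (≈-code {π = q} {σ = q′} (λ i → ·-injective (flip p)
                (code-≈ {π = q ∘ₚ flip p} {σ = q′ ∘ₚ flip p} (trans e₂ (sym e₄)) i))) })

-- Steiner 3-designs

-- Points and block size enter as u + 2 and t + 2, so that u and t count what remains once two
-- points are chosen, without subtraction.
module Design (em : EM) {v k u t : ℕ} (D : Steiner3Design v k)
  (v≡ : v ≡ suc (suc u)) (k≡ : k ≡ suc (suc t)) (2≤t : 2 ≤ t) (t<u : t < u) where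

  open Counting em
  open Orders em
  open Steiner3Design D

  Point : Set
  Point = Fin v

  Aut : Perm v → Set
  Aut = IsAutomorphism D

  #-block : ∀ {B} → Block B → # (_∈ B) ≡ suc (suc t)
  #-block {B} b = trans (sym (card≡# B)) (trans (block-size b) k≡)

  same-block : ∀ {B C x y z} → Block B → Block C → x ≢ y → x ≢ z → y ≢ z →
    x ∈ B → y ∈ B → z ∈ B → x ∈ C → y ∈ C → z ∈ C → B ≡ C
  same-block {x = x} {y} {z} bB bC x≢y x≢z y≢z x∈B y∈B z∈B x∈C y∈C z∈C
    with steiner x y z x≢y x≢z y≢z
  ... | _ , _ , unique-block = trans (unique-block _ bB x∈B y∈B z∈B) (sym (unique-block _ bC x∈C y∈C z∈C))

  block-through : ∀ {x y z} → x ≢ y → x ≢ z → y ≢ z → ∃ λ B → Block B × x ∈ B × y ∈ B × z ∈ B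
  block-through x≢y x≢z y≢z with steiner _ _ _ x≢y x≢z y≢z
  ... | B , inB , _ = B , inB

  -- `B` and its image share the images of x, y and z.
  aut-fixes : ∀ h → Aut h → ∀ {B x y z} → Block B → x ≢ y → x ≢ z → y ≢ z →
    x ∈ B → y ∈ B → z ∈ B → x · h ∈ B → y · h ∈ B → z · h ∈ B → image h B ≡ B
  aut-fixes h aut bB x≢y x≢z y≢z x∈ y∈ z∈ xh∈ yh∈ zh∈ =
    same-block (aut _ bB) bB (λ e → x≢y (·-injective h e)) (λ e → x≢z (·-injective h e)) (λ e → y≢z (·-injective h e))
      (∈-image h x∈) (∈-image h y∈) (∈-image h z∈) xh∈ yh∈ zh∈

  aut-fixes′ : ∀ h → Aut h → ∀ {B x y z} → Block B → x ≢ y → x ≢ z → y ≢ z →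
    x ∈ B → y ∈ B → z ∈ B → x · h ≡ x → y · h ≡ y → z · h ≡ z → image h B ≡ B
  aut-fixes′ h aut {B} bB x≢y x≢z y≢z x∈ y∈ z∈ ex ey ez = aut-fixes h aut bB x≢y x≢z y≢z x∈ y∈ z∈
    (subst (_∈ B) (sym ex) x∈) (subst (_∈ B) (sym ey) y∈) (subst (_∈ B) (sym ez) z∈)

  #-point : # (λ (_ : Point) → ⊤) ≡ suc (suc u)
  #-point = trans #-Fin v≡

  outside-block : ∀ {B} → Block B → ∃ λ p → ¬ p ∈ B
  outside-block {B} bB = stable λ none → 1+n≰n (≤-trans (s≤s (s≤s t<u)) (begin
    suc (suc u)               ≡⟨ sym #-point ⟩
    # (λ (_ : Point) → ⊤)     ≤⟨ #-mono (λ p _ → stable λ p∉ → none (p , p∉)) ⟩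
    # (_∈ B)                  ≡⟨ #-block bB ⟩
    suc (suc t)               ∎))
    where open ≤-Reasoning

  three-points : ∃ λ (x : Point) → ∃ λ y → ∃ λ z → x ≢ y × x ≢ z × y ≢ z
  three-points with #-pick₃ {P = λ (_ : Point) → ⊤} (subst (3 ≤_) (sym #-point) (s≤s (s≤s (≤-trans (≤-trans (s≤s z≤n) 2≤t) (<⇒≤ t<u)))))
  ... | x , y , z , _ , distinct = x , y , z , distinct

  some-block : ∃ Block
  some-block with three-points
  ... | x , y , z , x≢y , x≢z , y≢z with block-through x≢y x≢z y≢z
  ... | B , bB , _ = B , bB

  -- The blocks through x, p and a further point of B are disjoint outside {x , p}.
  fisher : suc t * t ≤ u
  fisher with some-block
  ... | B , bB with outside-block bB | #-pick (subst (1 ≤_) (sym (#-block bB)) (s≤s z≤n))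
  ... | p , p∉B | x , x∈B = begin
    suc t * t        ≡⟨ *-comm (suc t) t ⟩
    t * suc t        ≡⟨ cong (t *_) (sym #B∖x) ⟩
    t * # B∖x        ≤⟨ double-count-≤ R rows columns ⟩
    1 * # others     ≡⟨ *-identityˡ (# others) ⟩
    # others         ≡⟨ #others ⟩
    u                ∎
    where
    open ≤-Reasoning
    p≢ : ∀ {y} → y ∈ B → p ≢ y
    p≢ y∈ refl = p∉B y∈
    B∖x others : Point → Set
    B∖x y = y ∈ B × y ≢ x
    others z = (⊤ × z ≢ x) × z ≢ p
    R : Point → Point → Set
    R y z = ∃ λ C → Block C × x ∈ C × p ∈ C × y ∈ C × z ∈ C
    #B∖x : # B∖x ≡ suc t
    #B∖x = suc-injective (trans (sym (#-remove x∈B)) (#-block bB))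
    #others : # others ≡ u
    #others = suc-injective (trans (sym (#-remove (tt , p≢ x∈B))) (suc-injective (trans (sym (#-remove tt)) #-point)))
    rows : ∀ y → B∖x y → t ≤ # (λ z → others z × R y z)
    rows y (y∈B , y≢x) with block-through (λ e → p≢ x∈B (sym e)) (λ e → y≢x (sym e)) (p≢ y∈B)
    ... | C , bC , x∈C , p∈C , y∈C = ≤-trans
      (≤-reflexive (sym (suc-injective (trans (sym (#-remove (p∈C , p≢ x∈B))) (suc-injective (trans (sym (#-remove x∈C)) (#-block bC)))))))
      (#-mono λ z ((z∈C , z≢x) , z≢p) → ((tt , z≢x) , z≢p) , C , bC , x∈C , p∈C , y∈C , z∈C)
    columns : ∀ z → others z → # (λ y → B∖x y × R y z) ≤ 1
    columns z ((_ , z≢x) , z≢p) = #≤1 λ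
      { {a} {b} ((a∈B , a≢x) , C , bC , x∈C , p∈C , a∈C , z∈C) ((b∈B , b≢x) , C′ , bC′ , x∈C′ , p∈C′ , b∈C′ , z∈C′) →
        stable λ a≢b → p∉B (subst (p ∈_)
          (same-block bC bB (λ e → a≢x (sym e)) (λ e → b≢x (sym e)) a≢b x∈C a∈C
            (subst (b ∈_) (same-block bC′ bC (λ e → p≢ x∈B (sym e)) (λ e → z≢x (sym e)) (λ e → z≢p (sym e)) x∈C′ p∈C′ z∈C′ x∈C p∈C z∈C) b∈C′)
            x∈B a∈B b∈B) p∈C) }

  -- Moved points lie in the block B₀ of x, y, z, since the blocks through x, y, w and through x, z, w
  -- share x, w, w · h; a block on x, w and a point off B₀ then yields the contradiction.
  fixes-two-pencils : ∀ h → Aut h → ∀ {x y z} → x ≢ y → x ≢ z → y ≢ z →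
    x · h ≡ x → y · h ≡ y → z · h ≡ z →
    (∀ {B} → Block B → x ∈ B → y ∈ B → image h B ≡ B) →
    (∀ {B} → Block B → x ∈ B → z ∈ B → image h B ≡ B) → h ≈ id
  fixes-two-pencils h aut {x} {y} {z} x≢y x≢z y≢z hx hy hz pencil₁ pencil₂ w
    with block-through x≢y x≢z y≢z
  ... | B₀ , bB₀ , x∈B₀ , y∈B₀ , z∈B₀ = stable contra
    where
    moved-≢ : ∀ {w a} → a · h ≡ a → w · h ≢ w → w ≢ a × w · h ≢ a
    moved-≢ ha mw = (λ { refl → mw ha }) , λ e → mw (trans e (sym (·-injective h (trans e (sym ha)))))

    closed : ∀ {B w} → image h B ≡ B → w ∈ B → w · h ∈ B
    closed inv w∈ = subst (_ ∈_) inv (∈-image h w∈)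

    moved-∈ : ∀ {w} → w · h ≢ w → w ∈ B₀
    moved-∈ {w} mw with moved-≢ hx mw | moved-≢ hy mw | moved-≢ hz mw
    ... | w≢x , wh≢x | w≢y , _ | w≢z , _
      with block-through x≢y (λ e → w≢x (sym e)) (λ e → w≢y (sym e)) | block-through x≢z (λ e → w≢x (sym e)) (λ e → w≢z (sym e))
    ... | B₁ , b₁ , x∈₁ , y∈₁ , w∈₁ | B₂ , b₂ , x∈₂ , z∈₂ , w∈₂ =
      subst (w ∈_) (same-block b₁ bB₀ x≢y x≢z y≢z x∈₁ y∈₁ z∈₁ x∈B₀ y∈B₀ z∈B₀) w∈₁
      where
      B₂≡B₁ : B₂ ≡ B₁
      B₂≡B₁ = same-block b₂ b₁ (λ e → w≢x (sym e)) (λ e → wh≢x (sym e)) (λ e → mw (sym e))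
        x∈₂ w∈₂ (closed (pencil₂ b₂ x∈₂ z∈₂) w∈₂) x∈₁ w∈₁ (closed (pencil₁ b₁ x∈₁ y∈₁) w∈₁)
      z∈₁ : z ∈ B₁
      z∈₁ = subst (z ∈_) B₂≡B₁ z∈₂

    fixed : ∀ {p} → ¬ p ∈ B₀ → p · h ≡ p
    fixed p∉ = stable λ mp → p∉ (moved-∈ mp)

    fourth : ∀ {B x w c} → Block B → x ∈ B → w ∈ B → c ∈ B → w ≢ x → c ≢ x → c ≢ w →
      1 ≤ # (λ e → ((e ∈ B × e ≢ x) × e ≢ w) × e ≢ c)
    fourth {B} {x} {w} {c} bB x∈B w∈B c∈B w≢x c≢x c≢w = ≤-pred (subst (2 ≤_) (suc-injective (suc-injective (begin
      suc (suc t)                                                      ≡⟨ sym (#-block bB) ⟩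
      # (_∈ B)                                                         ≡⟨ #-remove x∈B ⟩
      suc (# (λ e → e ∈ B × e ≢ x))                                    ≡⟨ cong suc (#-remove (w∈B , w≢x)) ⟩
      suc (suc (# (λ e → (e ∈ B × e ≢ x) × e ≢ w)))                    ≡⟨ cong (λ n → suc (suc n)) (#-remove ((c∈B , c≢x) , c≢w)) ⟩
      suc (suc (suc (# (λ e → ((e ∈ B × e ≢ x) × e ≢ w) × e ≢ c))))    ∎))) 2≤t)
      where open ≡-Reasoning

    -- A moved point w lies in `B₀`. The block `B` on x, w and a point c off `B₀` has a fourth point
    -- e, again off `B₀`, so h fixes x, e, c and therefore `B`. Then `B` and `B₀` share x, w and w
    -- h.
    contra : ¬ (w · h ≢ w)
    contra mw with outside-block bB₀ | moved-≢ hx mw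
    ... | c , c∉B₀ | w≢x , wh≢x with block-through {x} {w} {c} (λ e → w≢x (sym e)) (λ { refl → c∉B₀ x∈B₀ }) (λ { refl → c∉B₀ (moved-∈ mw) })
    ... | B , bB , x∈B , w∈B , c∈B with #-pick (fourth bB x∈B w∈B c∈B w≢x (λ { refl → c∉B₀ x∈B₀ }) (λ { refl → c∉B₀ (moved-∈ mw) }))
    ... | e , ((e∈B , e≢x) , e≢w) , e≢c = B≢B₀ (same-block bB bB₀ (λ e → w≢x (sym e)) (λ e → wh≢x (sym e)) (λ e → mw (sym e))
        x∈B w∈B (closed hB w∈B) x∈B₀ (moved-∈ mw) (closed (pencil₁ bB₀ x∈B₀ y∈B₀) (moved-∈ mw)))
      where
      B≢B₀ : B ≢ B₀
      B≢B₀ eq = c∉B₀ (subst (c ∈_) eq c∈B)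
      e∉B₀ : ¬ e ∈ B₀
      e∉B₀ e∈B₀ = B≢B₀ (same-block bB bB₀ (λ e → w≢x (sym e)) (λ q → e≢x (sym q)) (λ q → e≢w (sym q))
        x∈B w∈B e∈B x∈B₀ (moved-∈ mw) e∈B₀)
      hB : image h B ≡ B
      hB = aut-fixes′ h aut bB (λ q → e≢x (sym q)) (λ { refl → c∉B₀ x∈B₀ }) e≢c x∈B e∈B c∈B hx (fixed e∉B₀) (fixed c∉B₀)

-- Block-transitive groups

module BlockTransitiveGroup (em : EM) {v k u t : ℕ} (D : Steiner3Design v k)
  (v≡ : v ≡ suc (suc u)) (k≡ : k ≡ suc (suc t)) (2≤t : 2 ≤ t) (t<u : t < u)
  (G : PermSet v) (G-aut : SubgroupOfAut D G) (G-trans : BlockTransitive D G) where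

  open Counting em
  open Orders em
  open Steiner3Design D
  open Design em D v≡ k≡ 2≤t t<u

  module G = IsSubgroup (proj₁ G-aut)

  aut : ∀ {g} → G g → Aut g
  aut = proj₂ G-aut

  Triple : Set
  Triple = Point × Point × Point

  _⊂_ : Triple → Subset v → Set
  (x , y , z) ⊂ B = x ∈ B × y ∈ B × z ∈ B

  _∙ₜ_ : Triple → Perm v → Triple
  (x , y , z) ∙ₜ g = x · g , y · g , z · g

  ⊂-image : ∀ g {T B} → T ⊂ B → (T ∙ₜ g) ⊂ image g B
  ⊂-image g (x∈ , y∈ , z∈) = ∈-image g x∈ , ∈-image g y∈ , ∈-image g z∈

  AllDistinct : Triple → Set
  AllDistinct (x , y , z) = x ≢ y × x ≢ z × y ≢ z

  record Family (F : Triple → Set) : Set where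
    field
      distinct  : ∀ {T} → F T → AllDistinct T
      invariant : ∀ {T g} → G g → F T → F (T ∙ₜ g)

  open Family

  -- Incidences of triples with blocks: three distinct points lie in one block, and
  -- block-transitivity puts equally many triples of the family into each block.
  #F : ∀ {F} → Family F → ∀ {B} → Block B → # F ≡ # (λ T → F T × T ⊂ B) * # Block
  #F {F} fam {B₀} b₀ = trans (sym (*-identityˡ (# F))) (double-count _⊂_ rows columns)
    where
    rows : ∀ T → F T → # (λ B → Block B × T ⊂ B) ≡ 1
    rows T f with distinct fam f
    ... | x≢y , x≢z , y≢z with block-through x≢y x≢z y≢z
    ... | B , bB , T⊂B = #≡1 (bB , T⊂B) λ (b , x∈ , y∈ , z∈) (b′ , x∈′ , y∈′ , z∈′) →
      same-block b b′ x≢y x≢z y≢z x∈ y∈ z∈ x∈′ y∈′ z∈′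

    transport : ∀ {B C} → Block B → Block C → # (λ T → F T × T ⊂ B) ≤ # (λ T → F T × T ⊂ C)
    transport {B} {C} bB bC with G-trans B C bB bC
    ... | g , Gg , refl = #-injection (λ T T′ → T ∙ₜ g ≡ T′)
      (λ T (f , s) → T ∙ₜ g , (invariant fam Gg f , ⊂-image g s) , refl)
      (λ { {x , y , z} {x′ , y′ , z′} _ _ _ e e′ → cancel (trans e (sym e′)) })
      where
      cancel : ∀ {T T′} → T ∙ₜ g ≡ T′ ∙ₜ g → T ≡ T′
      cancel e = cong₂ _,_ (·-injective g (cong proj₁ e))
        (cong₂ _,_ (·-injective g (cong (λ T → proj₁ (proj₂ T)) e)) (·-injective g (cong (λ T → proj₂ (proj₂ T)) e)))

    columns : ∀ B → Block B → # (λ T → F T × T ⊂ B) ≡ # (λ T → F T × T ⊂ B₀)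
    columns B bB = ≤-antisym (transport bB b₀) (transport b₀ bB)

  #Block : # Block * (t ↓₃) ≡ u ↓₃
  #Block with some-block
  ... | B , bB = trans (*-comm (# Block) (t ↓₃)) (trans (cong (_* # Block) (sym inB)) (trans (sym (#F fam bB)) all))
    where
    F : Triple → Set
    F = Distinct (λ _ → ⊤)
    fam : Family F
    fam = record
      { distinct  = λ (_ , (_ , y≢x) , (_ , z≢x) , z≢y) → (λ e → y≢x (sym e)) , (λ e → z≢x (sym e)) , (λ e → z≢y (sym e))
      ; invariant = λ {_} {g} _ (_ , (_ , y≢x) , (_ , z≢x) , z≢y) →
          tt , (tt , λ e → y≢x (·-injective g e)) , (tt , λ e → z≢x (·-injective g e)) , λ e → z≢y (·-injective g e)
      }
    all : # F ≡ u ↓₃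
    all = #-distinct (λ _ → ⊤) u #-point
    inB : # (λ T → F T × T ⊂ B) ≡ t ↓₃
    inB = trans (#-cong
      (λ { _ ((_ , (_ , y≢x) , (_ , z≢x) , z≢y) , x∈ , y∈ , z∈) → x∈ , (y∈ , y≢x) , (z∈ , z≢x) , z≢y })
      (λ { _ (x∈ , (y∈ , y≢x) , (z∈ , z≢x) , z≢y) → (tt , (tt , y≢x) , (tt , z≢x) , z≢y) , x∈ , y∈ , z∈ }))
      (#-distinct (_∈ B) t (#-block bB))

  -- The number of blocks is eliminated between `#F` and `#Block`.
  family-count : ∀ {F} → Family F → ∀ {B} → Block B → # F * (t ↓₃) ≡ # (λ T → F T × T ⊂ B) * (u ↓₃)
  family-count {F} fam {B} bB = begin
    # F * (t ↓₃)               ≡⟨ cong (_* (t ↓₃)) (#F fam bB) ⟩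
    c * # Block * (t ↓₃)       ≡⟨ *-assoc c (# Block) (t ↓₃) ⟩
    c * (# Block * (t ↓₃))     ≡⟨ cong (c *_) #Block ⟩
    c * (u ↓₃)                 ∎
    where
    open ≡-Reasoning
    c : ℕ
    c = # (λ T → F T × T ⊂ B)

  -- A symmetric family contributes at least two triples to a block: T and its reversal.
  symmetric-family : ∀ {F} {Γ : Point → Point → Set} {d} → Family F →
    (∀ {x y z} → F (y , x , z) → F (y , z , x)) →
    (∀ {x y z} → F (y , x , z) → Γ y x) →
    (∀ {x y z z′} → F (y , x , z) → F (y , x , z′) → z ≡ z′) →
    (∀ y → # (Γ y) ≤ d) → ∃ F → 2 * (suc u * u) ≤ d * (t ↓₃)
  symmetric-family {F} {Γ} {d} fam F-sym F⊆Γ functional Γ≤d ((y , x , z) , f)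
    with distinct fam f
  ... | y≢x , y≢z , x≢z with block-through y≢x y≢z x≢z
  ... | B , bB , y∈ , x∈ , z∈ = *-cancelʳ-≤ _ _ (suc (suc u)) (begin
    2 * (suc u * u) * suc (suc u)                     ≡⟨ eq₁ u ⟩
    2 * (u * suc u * suc (suc u))           ≤⟨ *-monoˡ-≤ (u ↓₃) (#≥2 (f , y∈ , x∈ , z∈) (F-sym f , y∈ , z∈ , x∈) (λ e → x≢z (sym (cong (λ T → proj₁ (proj₂ T)) e)))) ⟩
    # (λ T → F T × T ⊂ B) * (u ↓₃)          ≡⟨ sym (family-count fam bB) ⟩
    # F * (t ↓₃)                            ≤⟨ *-monoˡ-≤ (t ↓₃) F≤ ⟩
    d * suc (suc u) * (t ↓₃)                ≡⟨ eq₂ d (suc (suc u)) (t ↓₃) ⟩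
    d * (t ↓₃) * suc (suc u)                ∎)
    where
    open ≤-Reasoning
    eq₁ : ∀ u → 2 * (suc u * u) * suc (suc u) ≡ 2 * (u * suc u * suc (suc u))
    eq₁ = solve-∀
    eq₂ : ∀ a b c → a * b * c ≡ a * c * b
    eq₂ = solve-∀
    -- A triple is determined by its first two entries, and these form a pair in Γ.
    F≤ : # F ≤ d * suc (suc u)
    F≤ = begin
      # F                                               ≤⟨ #-injection {P = F} {Q = λ (p : Point × Point) → ⊤ × Γ (proj₁ p) (proj₂ p)}
                                                             (λ (y , x , z) p → (y , x) ≡ p)
                                                             (λ (y , x , z) f → (y , x) , (tt , F⊆Γ f) , refl)
                                                             (λ { {y , x , z} {_ , _ , z′} f f′ _ refl refl → cong (λ w → y , x , w) (functional f f′) }) ⟩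
      # (λ (p : Point × Point) → ⊤ × Γ (proj₁ p) (proj₂ p))   ≤⟨ #-fibre-≤ (λ y _ → Γ≤d y) ⟩
      d * # (λ (_ : Point) → ⊤)                         ≡⟨ cong (d *_) #-point ⟩
      d * suc (suc u)                                   ∎

  -- The family consists of a pair in Γ with any third point: at most v d (v - 2) triples in all,
  -- and at least k 2 (k - 2) inside `B`. The common factors cancel in `family-count`.
  collinear-pairs : ∀ {Γ : Point → Point → Set} {d} → (∀ {x y} → Γ x y → x ≢ y) →
    (∀ {x y g} → G g → Γ x y → Γ (x · g) (y · g)) → (∀ x → # (Γ x) ≤ d) →
    ∀ {B} → Block B → (∀ x → x ∈ B → 2 ≤ # (λ y → y ∈ B × Γ x y)) → 2 * suc u ≤ d * suc t
  collinear-pairs {Γ} {d} Γ-irrefl Γ-inv Γ≤d {B} bB two =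
    *-cancelʳ-≤ _ _ (t * suc (suc t) * (u * suc (suc u))) ⦃ nonZero ⦄ (begin
      2 * suc u * (t * suc (suc t) * (u * suc (suc u)))     ≡⟨ eq₁ u t ⟩
      t * 2 * suc (suc t) * (u ↓₃)                ≤⟨ *-monoˡ-≤ (u ↓₃) inB ⟩
      # (λ T → F T × T ⊂ B) * (u ↓₃)              ≡⟨ sym (family-count fam bB) ⟩
      # F * (t ↓₃)                                ≤⟨ *-monoˡ-≤ (t ↓₃) F≤ ⟩
      u * d * suc (suc u) * (t ↓₃)                          ≡⟨ eq₂ u t d ⟩
      d * suc t * (t * suc (suc t) * (u * suc (suc u)))     ∎)
    where
    open ≤-Reasoning
    nonZero : NonZero (t * suc (suc t) * (u * suc (suc u)))
    nonZero = >-nonZero (*-mono-≤ (*-mono-≤ (≤-trans (s≤s z≤n) 2≤t) (s≤s (z≤n {suc t}))) (*-mono-≤ (≤-trans (s≤s z≤n) t<u) (s≤s (z≤n {suc u}))))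
    eq₁ : ∀ u t → 2 * suc u * (t * suc (suc t) * (u * suc (suc u))) ≡ t * 2 * suc (suc t) * (u * suc u * suc (suc u))
    eq₁ = solve-∀
    eq₂ : ∀ u t d → u * d * suc (suc u) * (t * suc t * suc (suc t)) ≡ d * suc t * (t * suc (suc t) * (u * suc (suc u)))
    eq₂ = solve-∀
    F : Triple → Set
    F (x , y , z) = ⊤ × (Γ x y × ((⊤ × z ≢ x) × z ≢ y))
    fam : Family F
    fam = record
      { distinct  = λ (_ , γ , (_ , z≢x) , z≢y) → Γ-irrefl γ , (λ e → z≢x (sym e)) , (λ e → z≢y (sym e))
      ; invariant = λ {_} {g} Gg (_ , γ , (_ , z≢x) , z≢y) →
          tt , Γ-inv Gg γ , (tt , λ e → z≢x (·-injective g e)) , λ e → z≢y (·-injective g e)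
      }
    F≤ : # F ≤ u * d * suc (suc u)
    F≤ = ≤-trans (#-fibre-≤ {P = λ _ → ⊤} (λ x _ →
        ≤-trans (#-fibre-≤ {P = Γ x} (λ y γ → ≤-reflexive
          (suc-injective (trans (sym (#-remove (tt , λ e → Γ-irrefl γ (sym e)))) (suc-injective (trans (sym (#-remove tt)) #-point))))))
          (*-monoʳ-≤ u (Γ≤d x))))
      (≤-reflexive (cong (u * d *_) #-point))
    inB : t * 2 * suc (suc t) ≤ # (λ T → F T × T ⊂ B)
    inB = begin
      t * 2 * suc (suc t)           ≡⟨ cong (t * 2 *_) (sym (#-block bB)) ⟩
      t * 2 * # (_∈ B)              ≤⟨ #-fibre-≥ {P = _∈ B} (λ x x∈ → ≤-trans (*-monoʳ-≤ t (two x x∈))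
                                          (#-fibre-≥ {P = λ y → y ∈ B × Γ x y} {Q = λ y z → (z ∈ B × z ≢ x) × z ≢ y} (λ y (y∈ , γ) → ≤-reflexive (sym
                                            (suc-injective (trans (sym (#-remove (y∈ , λ e → Γ-irrefl γ (sym e)))) (suc-injective (trans (sym (#-remove x∈)) (#-block bB))))))))) ⟩
      _                             ≤⟨ #-mono (λ { (x , y , z) (x∈ , (y∈ , γ) , (z∈ , z≢x) , z≢y) → (tt , γ , (tt , z≢x) , z≢y) , x∈ , y∈ , z∈ }) ⟩
      # (λ T → F T × T ⊂ B)         ∎

  Orbit : PermSet v → Subset v → Subset v → Set
  Orbit M B C = ∃ λ m → M m × image m B ≡ C

  -- As M is normal and G is transitive on blocks, all M-orbits on blocks have the same length s. It
  -- divides both the number of blocks and the order of M, so `orbit-size-divides` makes it a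
  -- divisor of v.
  block-orbit-≤ : ∀ {M n} j → M ⊴ G → order M ∣ n ^ j → n ∣ v → (2 ∣ n → 4 ∣ v) →
    ∀ {B} → Block B → # (Orbit M B) ≤ v
  block-orbit-≤ {M} {n} j ((M-sub , M⊆G) , M-normal) M∣ n∣v four {B₀} b₀ =
    subst (s ≤_) (sym v≡) (∣⇒≤ (orbit-size-divides {s = s} {n = n} j {ν = ν} {t = t} (∣-trans s∣M M∣)
      (subst (n ∣_) v≡ n∣v) (λ 2∣n → subst (4 ∣_) v≡ (four 2∣n))
      (trans (cong (_* (t ↓₃)) (trans (*-comm s ν) (sym blocks≡))) #Block)))
    where
    module M = IsSubgroup M-sub
    s : ℕ
    s = # (Orbit M B₀)
    s∣M : s ∣ order M
    s∣M = orbit-divides-order M-sub (λ m → image m B₀) (λ {π} {σ} e → image-cong {g = π} {h = σ} e B₀)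
      (λ {π} {σ} τ e → trans (image-∘ π τ B₀) (trans (cong (image τ) e) (sym (image-∘ σ τ B₀))))

    transport : ∀ {B C} → Block B → Block C → # (λ E → Block E × Orbit M B E) ≤ # (λ E → Block E × Orbit M C E)
    transport {B} {C} bB bC with G-trans B C bB bC
    ... | g , Gg , refl = #-injection (λ E E′ → image g E ≡ E′)
      (λ { E (bE , m , Mm , refl) → image g E ,
        (aut Gg E bE , m ^^ g , M-normal Gg Mm ,
          trans (sym (image-∘ g (m ^^ g) B)) (trans (image-cong {g = g ∘ₚ (m ^^ g)} {h = m ∘ₚ g} (λ i → ^^-action m g i) B) (image-∘ m g B))) , refl })
      (λ _ _ _ e e′ → image-injective g (trans e (sym e′)))

    in-block : ∀ {B} → Block B → # (λ E → Block E × Orbit M B E) ≡ # (Orbit M B)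
    in-block bB = #-cong (λ _ → proj₂) (λ { E (m , Mm , refl) → aut (M⊆G Mm) _ bB , m , Mm , refl })

    s∣blocks : s ∣ # Block
    s∣blocks = classes-divide Block (Orbit M) s
      (λ {B} _ → id , M.id∈ , image-id B)
      (λ (m , Mm , e) → flip m , M.inv∈ Mm , image-flip m e)
      (λ { {B} (m , Mm , refl) (m′ , Mm′ , refl) → m ∘ₚ m′ , M.∘∈ Mm Mm′ , image-∘ m m′ B })
      (λ B bB → trans (≤-antisym (transport bB b₀) (transport b₀ bB)) (in-block b₀))

    ν : ℕ
    ν = _∣_.quotient s∣blocks
    blocks≡ : # Block ≡ ν * s
    blocks≡ = _∣_.equality s∣blocks

  module _ {M K : PermSet v} (M-sub : IsSubgroup M) (M⊆G : ∀ {m} → M m → G m)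
    (small : ∀ {B} → Block B → # (Orbit M B) ≤ v) (K⊆M : ∀ {m} → K m → M m) (K-trans : Transitive K) where

    private
      module M = IsSubgroup M-sub

      -- The pairs (y , C) with C in the orbit of B, y and y · g in C and C not fixed by g number at most
      -- 2 v, and K makes every point occur equally often; so at most two such C contain x and x · g.
      pencil-fixed : ∀ g → G g → (∀ {κ} → K κ → Commute g κ) → ∀ h → M h → Commute g h →
        ∀ {x} → x · h ≡ x → x · g ≢ x → x · g · g ≢ x →
        ∀ {B} → Block B → x ∈ B → x · g ∈ B → image (h ∘ₚ h) B ≡ B
      pencil-fixed g Gg g-K h Mh g-h {x} hx xg≢x xgg≢x {B} bB x∈B xg∈B with em (image g B ≡ B)
      -- If g fixes `B`, then x, x g and x g g are three points of `B`, all fixed by h.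
      ... | yes fixed = trans (image-∘ h h B) (trans (cong (image h) hB) hB)
        where
        hxg : x · g · h ≡ x · g
        hxg = trans (g-h x) (cong (_· g) hx)
        hB : image h B ≡ B
        hB = aut-fixes′ h (aut (M⊆G Mh)) bB (λ e → xg≢x (sym e)) (λ e → xgg≢x (sym e))
          (λ e → xg≢x (sym (·-injective g e))) x∈B xg∈B (subst (x · g · g ∈_) fixed (∈-image g xg∈B))
          hx hxg (trans (g-h (x · g)) (cong (_· g) hxg))
      -- Otherwise h maps the set `X` of these blocks into itself. If h h moved `B`, then `B` and
      -- its images under h and h h would be three members of `X`.
      ... | no moved = stable λ hhB≢B → 1+n≰n (≤-trans
          (#≥3 in₀ (step in₀) (step (step in₀))
            (λ e → hhB≢B (trans (image-∘ h h B) (trans (cong (image h) e) e)))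
            (λ e → hhB≢B (trans (image-∘ h h B) e))
            (λ e → hhB≢B (trans (image-∘ h h B) (trans e (image-injective h e)))))
          X≤2)
        where
        R : Point → Subset v → Set
        R y C = (y ∈ C × y · g ∈ C) × image g C ≢ C
        X : Subset v → Set
        X C = Orbit M B C × R x C

        carry : ∀ k → M k → Commute g k → ∀ {y C} → Orbit M B C × R y C → Orbit M B (image k C) × R (y · k) (image k C)
        carry k Mk g-k {y} {C} ((m , Mm , e) , (y∈ , yg∈) , gC≢C) =
          (m ∘ₚ k , M.∘∈ Mm Mk , trans (image-∘ m k B) (cong (image k) e)) ,
          (∈-image k y∈ , subst (_∈ image k C) (g-k y) (∈-image k yg∈)) ,
          λ fixed → gC≢C (image-injective k (trans (sym (image-∘ g k C))
            (trans (image-cong {g = g ∘ₚ k} {h = k ∘ₚ g} g-k C) (trans (image-∘ k g C) fixed))))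

        in₀ : X B
        in₀ = (id , M.id∈ , image-id B) , (x∈B , xg∈B) , moved

        step : ∀ {C} → X C → X (image h C)
        step {C} p = subst (λ y → Orbit M B (image h C) × R y (image h C)) hx (carry h Mh g-h p)

        rows : ∀ y → ⊤ → # X ≤ # (λ C → Orbit M B C × R y C)
        rows y _ with K-trans x y
        ... | k , Kk , refl = #-injection (λ C C′ → image k C ≡ C′)
          (λ C p → image k C , carry k (K⊆M Kk) (g-K Kk) p , refl)
          (λ _ _ _ e e′ → image-injective k (trans e (sym e′)))

        -- If C contained y and y g for three points y, then g would fix C.
        columns : ∀ C → Orbit M B C → # (λ y → ⊤ × R y C) ≤ 2
        columns C (m , Mm , refl) = ≮⇒≥ λ 3≤ → three (#-pick₃ 3≤)
          where
          three : ¬ _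
          three (a , b , c , ((_ , (a∈ , ag∈) , gC≢C) , (_ , (b∈ , bg∈) , _) , (_ , (c∈ , cg∈) , _)) , a≢b , a≢c , b≢c) =
            gC≢C (aut-fixes g (aut Gg) (aut (M⊆G Mm) _ bB) a≢b a≢c b≢c a∈ b∈ c∈ ag∈ bg∈ cg∈)

        X≤2 : # X ≤ 2
        X≤2 = *-cancelʳ-≤ (# X) 2 (suc (suc u)) (begin
          # X * suc (suc u)                  ≡⟨ cong (# X *_) (sym #-point) ⟩
          # X * # (λ (_ : Point) → ⊤)        ≤⟨ double-count-≤ R rows columns ⟩
          2 * # (Orbit M B)                  ≤⟨ *-monoʳ-≤ 2 (small bB) ⟩
          2 * v                              ≡⟨ cong (2 *_) v≡ ⟩
          2 * suc (suc u)                    ∎)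
          where open ≤-Reasoning

    -- Commuting with g, h fixes the distinct points x, x g and x g⁻¹. By `pencil-fixed` for g and
    -- for its inverse, h h fixes all blocks on x, x g and all blocks on x, x g⁻¹.
    commuting-square : ∀ g → G g → (∀ {κ} → K κ → Commute g κ) → ∀ h → M h → Commute g h →
      ∀ {x} → x · h ≡ x → x · g ≢ x → x · g · g ≢ x → (h ∘ₚ h) ≈ id
    commuting-square g Gg g-K h Mh g-h {x} hx xg≢x xgg≢x =
      fixes-two-pencils (h ∘ₚ h) (aut (M⊆G (M.∘∈ Mh Mh)))
        (λ e → xg≢x (sym e)) (λ e → xg⁻≢x (sym e)) (λ e → xgg≢x (trans (cong (_· g) e) (flip-· g)))
        (fix₂ hx) (fix₂ (trans (g-h x) (cong (_· g) hx)))
        (fix₂ (trans (commute-flip {g = g} {h = h} g-h x) (cong (_· flip g) hx)))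
        (pencil-fixed g Gg g-K h Mh g-h hx xg≢x xgg≢x)
        (pencil-fixed (flip g) (G.inv∈ Gg) (λ {κ} Kκ → commute-flip {g = g} {h = κ} (g-K Kκ)) h Mh
          (commute-flip {g = g} {h = h} g-h) hx xg⁻≢x
          (λ e → xgg≢x (trans (cong (λ y → y · g · g) (sym e)) (trans (cong (_· g) (flip-· g)) (flip-· g)))))
      where
      xg⁻≢x : x · flip g ≢ x
      xg⁻≢x e = xg≢x (trans (cong (_· g) (sym e)) (flip-· g))
      fix₂ : ∀ {y} → y · h ≡ y → y · h · h ≡ y
      fix₂ e = trans (cong (_· h) e) e

-- Parity of permutations

module Parity (em : EM) {v : ℕ} where

  open Counting em
  open Orders em

  infix 3 _⊕_

  _⊕_ : Set → Set → Set
  P ⊕ Q = (P × ¬ Q) ⊎ (¬ P × Q)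

  opaque

    #-⊕ : ∀ {A : Set} ⦃ _ : Finite A ⦄ (P Q : A → Set) → # (λ x → P x ⊕ Q x) + 2 * # (λ x → P x × Q x) ≡ # P + # Q
    #-⊕ P Q = begin
      # (λ x → P x ⊕ Q x) + 2 * # (λ x → P x × Q x)
        ≡⟨ cong (_+ 2 * # (λ x → P x × Q x)) (trans (#-split _ P) (cong₂ _+_
             (#-cong (λ { x (inj₁ (p , ¬q) , _) → p , ¬q ; x (inj₂ (¬p , _) , p) → contradiction p ¬p })
                     (λ x (p , ¬q) → inj₁ (p , ¬q) , p))
             (#-cong (λ { x (inj₁ (p , _) , ¬p) → contradiction p ¬p ; x (inj₂ (¬p , q) , _) → q , ¬p })
                     (λ x (q , ¬p) → inj₂ (¬p , q) , ¬p)))) ⟩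
      # (λ x → P x × ¬ Q x) + # (λ x → Q x × ¬ P x) + 2 * # (λ x → P x × Q x)
        ≡⟨ eq (# (λ x → P x × ¬ Q x)) (# (λ x → Q x × ¬ P x)) (# (λ x → P x × Q x)) ⟩
      (# (λ x → P x × Q x) + # (λ x → P x × ¬ Q x)) + (# (λ x → P x × Q x) + # (λ x → Q x × ¬ P x))
        ≡⟨ cong₂ _+_ (sym (#-split P Q)) (cong (_+ # (λ x → Q x × ¬ P x)) (#-cong (λ x → swap) (λ x → swap))) ⟩
      # P + (# (λ x → Q x × P x) + # (λ x → Q x × ¬ P x))
        ≡⟨ cong (# P +_) (sym (#-split Q P)) ⟩
      # P + # Q ∎
      where
      open ≡-Reasoning
      eq : ∀ a b c → a + b + 2 * c ≡ (c + a) + (c + b)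
      eq = solve-∀

  Pair : Set
  Pair = Fin v × Fin v

  -- Ordered pairs are counted, so an even permutation has a number of inverted pairs divisible by 4.
  Inverted : Perm v → Pair → Set
  Inverted π (i , j) = i ≢ j × (i <ᶠ j ⊕ i · π <ᶠ j · π)

  inversions : Perm v → ℕ
  inversions π = # (Inverted π)

  Even : PermSet v
  Even π = 4 ∣ inversions π

  connex : ∀ {i j : Fin v} → i ≢ j → ¬ i <ᶠ j → j <ᶠ i
  connex {i} {j} i≢j i≮j with <ᶠ-cmp i j
  ... | tri< lt _ _ = contradiction lt i≮j
  ... | tri≈ _ e _  = contradiction e i≢j
  ... | tri> _ _ gt = gt

  Inverted-swap : ∀ π {p} → Inverted π p → Inverted π (swap p)
  Inverted-swap π (i≢j , inj₁ (lt , ¬lt)) =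
    (λ e → i≢j (sym e)) , inj₂ (<ᶠ-asym lt , connex (λ e → i≢j (·-injective π e)) ¬lt)
  Inverted-swap π (i≢j , inj₂ (¬lt , lt)) =
    (λ e → i≢j (sym e)) , inj₁ (connex i≢j ¬lt , <ᶠ-asym lt)

  opaque

    symmetric-even : (P : Pair → Set) → (∀ {p} → P p → P (swap p)) → (∀ {p} → P p → proj₁ p ≢ proj₂ p) → 2 ∣ # P
    symmetric-even P P-swap irrefl = free-involution-even P swap P-swap (λ _ → refl) (λ p e → irrefl p (sym (cong proj₁ e)))

    -- The product inverts a pair when exactly one of two things happens: π inverts the pair, or σ
    -- inverts its image under π. The pairs for which both happen come with their reversals, so
    -- there are 2 s of them, each counted twice on the right.
    inversions-∘ : ∀ π σ → ∃ λ s → inversions (π ∘ₚ σ) + 4 * s ≡ inversions π + inversions σ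
    inversions-∘ π σ with symmetric-even (λ p → Inverted π p × Inverted′ p) (λ (a , b) → Inverted-swap π a , Inverted-swap σ b) (λ ((i≢j , _) , _) → i≢j)
      where
      Inverted′ : Pair → Set
      Inverted′ (i , j) = Inverted σ (i · π , j · π)
    ... | divides s eq = s , (begin
      inversions (π ∘ₚ σ) + 4 * s                      ≡⟨ cong₂ _+_ (#-cong to from) (trans (four s) (cong (2 *_) (sym eq))) ⟩
      # (λ p → P p ⊕ Q p) + 2 * # (λ p → P p × Q p)    ≡⟨ #-⊕ P Q ⟩
      # P + # Q                                        ≡⟨ cong (# P +_) moved ⟩
      inversions π + inversions σ                      ∎)
      where
      open ≡-Reasoning
      four : ∀ s → 4 * s ≡ 2 * (s * 2)
      four = solve-∀
      P Q : Pair → Set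
      P = Inverted π
      Q (i , j) = Inverted σ (i · π , j · π)
      moved : # Q ≡ inversions σ
      moved = #-bijection (λ (i , j) → i · π , j · π) (λ (i , j) → i · flip π , j · flip π)
        (λ _ q → q) (λ p → subst (Inverted σ) (sym (cong₂ _,_ (flip-· π) (flip-· π))))
        (λ _ _ → cong₂ _,_ (·-flip π) (·-flip π)) (λ _ _ → cong₂ _,_ (flip-· π) (flip-· π))
      to : ∀ p → Inverted (π ∘ₚ σ) p → P p ⊕ Q p
      to (i , j) (i≢j , x) with em (i · π <ᶠ j · π) | x
      ... | yes b | inj₁ (a , ¬c) = inj₂ ((λ { (_ , inj₁ (_ , ¬b)) → ¬b b ; (_ , inj₂ (¬a , _)) → ¬a a }) , (λ e → i≢j (·-injective π e)) , inj₁ (b , ¬c))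
      ... | yes b | inj₂ (¬a , c) = inj₁ ((i≢j , inj₂ (¬a , b)) , λ { (_ , inj₁ (_ , ¬c)) → ¬c c ; (_ , inj₂ (¬b , _)) → ¬b b })
      ... | no ¬b | inj₁ (a , ¬c) = inj₁ ((i≢j , inj₁ (a , ¬b)) , λ { (_ , inj₁ (b , _)) → ¬b b ; (_ , inj₂ (_ , c)) → ¬c c })
      ... | no ¬b | inj₂ (¬a , c) = inj₂ ((λ { (_ , inj₁ (a , _)) → ¬a a ; (_ , inj₂ (_ , b)) → ¬b b }) , (λ e → i≢j (·-injective π e)) , inj₂ (¬b , c))
      from : ∀ p → P p ⊕ Q p → Inverted (π ∘ₚ σ) p
      from (i , j) (inj₁ ((i≢j , x) , ¬Q)) with em (i · π · σ <ᶠ j · π · σ) | x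
      ... | yes c | inj₁ (a , ¬b) = contradiction ((λ e → i≢j (·-injective π e)) , inj₂ (¬b , c)) ¬Q
      ... | yes c | inj₂ (¬a , b) = i≢j , inj₂ (¬a , c)
      ... | no ¬c | inj₁ (a , ¬b) = i≢j , inj₁ (a , ¬c)
      ... | no ¬c | inj₂ (¬a , b) = contradiction ((λ e → i≢j (·-injective π e)) , inj₁ (b , ¬c)) ¬Q
      from (i , j) (inj₂ (¬P , (πi≢πj , x))) with em (i <ᶠ j) | x
      ... | yes a | inj₁ (b , ¬c) = (λ e → πi≢πj (cong (_· π) e)) , inj₁ (a , ¬c)
      ... | yes a | inj₂ (¬b , c) = contradiction ((λ e → πi≢πj (cong (_· π) e)) , inj₁ (a , ¬b)) ¬P
      ... | no ¬a | inj₁ (b , ¬c) = contradiction ((λ e → πi≢πj (cong (_· π) e)) , inj₂ (¬a , b)) ¬P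
      ... | no ¬a | inj₂ (¬b , c) = (λ e → πi≢πj (cong (_· π) e)) , inj₂ (¬a , c)

    inversions-cong : ∀ {π σ} → π ≈ σ → inversions π ≡ inversions σ
    inversions-cong {π} {σ} e = #-cong (λ p → transfer {π} {σ} e p) (λ p → transfer {σ} {π} (λ i → sym (e i)) p)
      where
      transfer : ∀ {π σ : Perm v} → π ≈ σ → ∀ p → Inverted π p → Inverted σ p
      transfer e (i , j) (i≢j , x) = i≢j , subst₂ (λ a b → i <ᶠ j ⊕ a <ᶠ b) (e i) (e j) x

    inversions-flip : ∀ π → 4 ∣ inversions π + inversions (flip π)
    inversions-flip π with inversions-∘ π (flip π)
    ... | s , eq = divides s (trans (sym eq) (trans (cong (_+ 4 * s) none) (*-comm 4 s)))
      where
      none : inversions (π ∘ₚ flip π) ≡ 0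
      none = trans (inversions-cong {π ∘ₚ flip π} {id} (λ _ → ·-flip π))
        (#-empty λ { p (_ , inj₁ (a , ¬a)) → ¬a a ; p (_ , inj₂ (¬a , a)) → ¬a a })

    Even-subgroup : IsSubgroup Even
    Even-subgroup = record
      { resp = λ {π} {σ} e → subst (4 ∣_) (inversions-cong {π} {σ} e)
      ; id∈  = divides 0 (#-empty λ { p (_ , inj₁ (a , ¬a)) → ¬a a ; p (_ , inj₂ (¬a , a)) → ¬a a })
      ; ∘∈   = λ {π} {σ} eπ eσ → product π σ (∣m∣n⇒∣m+n eπ eσ)
      ; inv∈ = λ {π} eπ → ∣m+n∣m⇒∣n (inversions-flip π) eπ
      }
      where
      product : ∀ π σ → 4 ∣ inversions π + inversions σ → Even (π ∘ₚ σ)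
      product π σ d with inversions-∘ π σ
      ... | s , eq = ∣m+n∣m⇒∣n (subst (4 ∣_) (trans (sym eq) (+-comm _ (4 * s))) d) (m∣m*n s)

    -- Inverted pairs come with their reversals, so π has an even number of them, and the square has
    -- twice that number up to a multiple of 4.
    Even-square : ∀ (π : Perm v) → Even (π ∘ₚ π)
    Even-square π with inversions-∘ π π | symmetric-even (Inverted π) (Inverted-swap π) proj₁
    ... | s , eq | divides r eq′ = ∣m+n∣m⇒∣n
      (divides r (trans (+-comm (4 * s) _) (trans eq (trans (cong₂ _+_ eq′ eq′) (double r))))) (m∣m*n s)
      where
      double : ∀ r → r * 2 + r * 2 ≡ r * 4
      double = solve-∀

    Even-conjugate : ∀ {π} (h : Perm v) → Even π → Even (π ^^ h)
    Even-conjugate {π} h eπ with inversions-∘ (flip h) (π ∘ₚ h) | inversions-∘ π h | inversions-flip h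
    ... | a , eqa | b , eqb | d = ∣m+n∣m⇒∣n {4} {4 * a + 4 * b}
      (subst (4 ∣_) (sym total) (∣m∣n⇒∣m+n d eπ)) (∣m∣n⇒∣m+n (m∣m*n a) (m∣m*n b))
      where
      open ≡-Reasoning
      r₁ : ∀ a b c → a + b + c ≡ (c + a) + b
      r₁ = solve-∀
      r₂ : ∀ a b c → a + b + c ≡ a + (b + c)
      r₂ = solve-∀
      r₃ : ∀ a b c → a + (b + c) ≡ c + a + b
      r₃ = solve-∀
      total : 4 * a + 4 * b + inversions (π ^^ h) ≡ inversions h + inversions (flip h) + inversions π
      total = begin
        4 * a + 4 * b + inversions (π ^^ h)                          ≡⟨ r₁ (4 * a) (4 * b) _ ⟩
        inversions (π ^^ h) + 4 * a + 4 * b                          ≡⟨ cong (_+ 4 * b) eqa ⟩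
        inversions (flip h) + inversions (π ∘ₚ h) + 4 * b            ≡⟨ r₂ (inversions (flip h)) _ (4 * b) ⟩
        inversions (flip h) + (inversions (π ∘ₚ h) + 4 * b)          ≡⟨ cong (inversions (flip h) +_) eqb ⟩
        inversions (flip h) + (inversions π + inversions h)          ≡⟨ r₃ (inversions (flip h)) (inversions π) (inversions h) ⟩
        inversions h + inversions (flip h) + inversions π            ∎

    -- The v pairs (i, i τ) are all inverted. The other inverted pairs are halved by swapping, and
    -- those with i < j are paired off by sending (i, j) to (j τ, i τ), so their number is a
    -- multiple of 4.
    fixed-point-free-involution : ∀ τ → (∀ x → x · τ · τ ≡ x) → (∀ x → x · τ ≢ x) → Even τ → 4 ∣ v
    fixed-point-free-involution τ ττ fpf even = ∣m+n∣m⇒∣n (subst (4 ∣_) total even) rest-4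
      where
      Mate Rest Lower : Pair → Set
      Mate (i , j) = j ≡ i · τ
      Rest p = Inverted τ p × ¬ Mate p
      Lower (i , j) = i <ᶠ j

      mates : # (λ p → Inverted τ p × Mate p) ≡ v
      mates = trans (#-bijection {Q = λ (_ : Fin v) → ⊤} proj₁ (λ i → i , i · τ) (λ _ _ → tt)
        (λ i _ → ((λ e → fpf i (sym e)) , inv i) , refl) (λ { _ (_ , refl) → refl }) (λ _ _ → refl)) #-Fin
        where
        inv : ∀ i → i <ᶠ i · τ ⊕ i · τ <ᶠ i · τ · τ
        inv i with em (i <ᶠ i · τ)
        ... | yes lt = inj₁ (lt , λ gt → <ᶠ-asym lt (subst (i · τ <ᶠ_) (ττ i) gt))
        ... | no ¬lt = inj₂ (¬lt , subst (i · τ <ᶠ_) (sym (ττ i)) (connex (λ e → fpf i (sym e)) ¬lt))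

      total : inversions τ ≡ # Rest + v
      total = trans (#-split (Inverted τ) Mate) (trans (cong (_+ # Rest) mates) (+-comm v (# Rest)))

      Rest-swap : ∀ {p} → Rest p → Rest (swap p)
      Rest-swap {i , j} (inv , ¬mate) = Inverted-swap τ inv , λ e → ¬mate (trans (sym (ττ j)) (cong (_· τ) (sym e)))

      halves : # (λ p → Rest p × ¬ Lower p) ≡ # (λ p → Rest p × Lower p)
      halves = #-bijection swap swap
        (λ (i , j) (r , ¬lt) → Rest-swap r , connex (proj₁ (proj₁ r)) ¬lt)
        (λ (i , j) (r , lt) → Rest-swap r , <ᶠ-asym lt) (λ _ _ → refl) (λ _ _ → refl)

      reflect : Pair → Pair
      reflect (i , j) = j · τ , i · τ

      lower-even : 2 ∣ # (λ p → Rest p × Lower p)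
      lower-even = free-involution-even _ reflect
        (λ { {i , j} (((i≢j , inj₁ (lt , ¬lt)) , ¬mate) , _) →
             let gt = connex (λ e → i≢j (·-injective τ e)) ¬lt in
             ((((λ e → i≢j (sym (·-injective τ e))) , inj₁ (gt , λ lt′ → <ᶠ-asym lt (subst₂ _<ᶠ_ (ττ j) (ττ i) lt′))) ,
               (λ e → ¬mate (trans (sym (ττ j)) (sym e)))) , gt)
           ; (((_ , inj₂ (¬lt , _)) , _) , lt) → contradiction lt ¬lt })
        (λ {(i , j)} _ → cong₂ _,_ (ττ i) (ττ j))
        (λ { {i , j} ((_ , ¬mate) , _) e → ¬mate (sym (cong proj₂ e)) })

      rest-4 : 4 ∣ # Rest
      rest-4 with lower-even
      ... | divides q eq = divides q (trans (#-split Rest Lower) (trans (cong₂ _+_ eq (trans halves eq)) (double q)))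
        where
        double : ∀ q → q * 2 + q * 2 ≡ q * 4
        double = solve-∀

    -- Without involutions, inversion would pair off the nonidentity elements and the order would be
    -- odd.
    cauchy-2 : ∀ {A : PermSet v} → IsSubgroup A → 2 ∣ order A →
      ∃ λ τ → A τ × (∀ x → x · τ · τ ≡ x) × ¬ (τ ≈ id)
    cauchy-2 {A} A-sub 2∣A = stable λ none → contradiction
      (∣1⇒≡1 (∣m+n∣m⇒∣n (subst (2 ∣_) (trans (#-remove (id , id∈ , refl)) (+-comm 1 _)) 2∣A) (nonidentity-even none))) λ ()
      where
      open IsSubgroup A-sub
      Nonidentity : Vec (Fin v) v → Set
      Nonidentity c = Code A c × c ≢ code id

      invert : Vec (Fin v) v → Vec (Fin v) v
      invert c with em (Code A c)
      ... | yes (π , _) = code (flip π)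
      ... | no _        = c

      invert-code : ∀ {π} → A π → invert (code π) ≡ code (flip π)
      invert-code {π} Aπ with em (Code A (code π))
      ... | yes (σ , _ , e) = ≈-code {π = flip σ} {σ = flip π} (flip-cong {π = σ} {σ = π} (code-≈ {π = σ} {σ = π} e))
      ... | no ¬code        = contradiction (π , Aπ , refl) ¬code

      nonidentity-even : ¬ (∃ λ τ → A τ × (∀ x → x · τ · τ ≡ x) × ¬ (τ ≈ id)) → 2 ∣ # Nonidentity
      nonidentity-even none = free-involution-even Nonidentity invert
        (λ { ((π , Aπ , refl) , π≢) → subst Nonidentity (sym (invert-code Aπ))
          ((flip π , inv∈ Aπ , refl) , λ e → π≢ (≈-code {π = π} {σ = id} λ i →
            trans (sym (cong (_· π) (code-≈ {π = flip π} {σ = id} e i))) (flip-· π))) })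
        (λ { ((π , Aπ , refl) , _) → trans (cong invert (invert-code Aπ)) (invert-code (inv∈ Aπ)) })
        (λ { ((π , Aπ , refl) , π≢) e → none (π , Aπ ,
          (λ x → trans (cong (_· π) (sym (code-≈ {π = flip π} {σ = π} (trans (sym (invert-code Aπ)) e) x))) (flip-· π)) ,
          λ π≈ → π≢ (≈-code {π = π} {σ = id} π≈)) })

-- Normal closures and minimal normal subgroups

module _ {v : ℕ} where

  NormalisedBy : PermSet v → PermSet v → Set
  NormalisedBy P H = ∀ {h p} → H h → P p → P (p ^^ h)

  Nontrivial : PermSet v → Set
  Nontrivial N = ∃ λ n → N n × ¬ (n ≈ id)

  -- The subgroup generated by the conjugates of `a` under `H`. The constructor `cong-≈` is there
  -- because subgroups have to respect `≈`.
  data Closure (a : Perm v) (H : PermSet v) : PermSet v where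
    conj : ∀ {h} → H h → Closure a H (a ^^ h)
    one  : Closure a H id
    mul  : ∀ {π σ} → Closure a H π → Closure a H σ → Closure a H (π ∘ₚ σ)
    inv  : ∀ {π} → Closure a H π → Closure a H (flip π)
    cong-≈ : ∀ {π σ} → π ≈ σ → Closure a H π → Closure a H σ

  closure-subgroup : ∀ {a H} → IsSubgroup (Closure a H)
  closure-subgroup = record { resp = cong-≈ ; id∈ = one ; ∘∈ = mul ; inv∈ = inv }

  closure-⊆ : ∀ {a H} {S : PermSet v} → IsSubgroup S → (∀ {h} → H h → S (a ^^ h)) → ∀ {π} → Closure a H π → S π
  closure-⊆ S-sub gen (conj Hh)     = gen Hh
  closure-⊆ S-sub gen one           = IsSubgroup.id∈ S-sub
  closure-⊆ S-sub gen (mul c d)     = IsSubgroup.∘∈ S-sub (closure-⊆ S-sub gen c) (closure-⊆ S-sub gen d)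
  closure-⊆ S-sub gen (inv c)       = IsSubgroup.inv∈ S-sub (closure-⊆ S-sub gen c)
  closure-⊆ S-sub gen (cong-≈ e c)    = IsSubgroup.resp S-sub e (closure-⊆ S-sub gen c)

  closure-gen : ∀ {a H} → IsSubgroup H → Closure a H a
  closure-gen {a} H-sub = cong-≈ {π = a ^^ id} (λ _ → refl) (conj (IsSubgroup.id∈ H-sub))

  ^^-∘ : ∀ (π σ h : Perm v) → ((π ^^ h) ∘ₚ (σ ^^ h)) ≈ ((π ∘ₚ σ) ^^ h)
  ^^-∘ π σ h i = cong (λ y → y · σ · h) (·-flip h)

  ^^-cong : ∀ {π σ : Perm v} (h : Perm v) → π ≈ σ → (π ^^ h) ≈ (σ ^^ h)
  ^^-cong h e i = cong (_· h) (e (i · flip h))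

  closure-normal : ∀ {a H} → IsSubgroup H → NormalisedBy (Closure a H) H
  closure-normal {a} H-sub {h} Hh (conj {g} Hg) =
    cong-≈ {π = a ^^ (g ∘ₚ h)} (λ _ → refl) (conj (IsSubgroup.∘∈ H-sub Hg Hh))
  closure-normal H-sub {h} Hh one = cong-≈ {π = id} (λ i → sym (flip-· h)) one
  closure-normal H-sub {h} Hh (mul {π} {σ} c d) =
    cong-≈ {π = (π ^^ h) ∘ₚ (σ ^^ h)} (^^-∘ π σ h) (mul (closure-normal H-sub Hh c) (closure-normal H-sub Hh d))
  closure-normal H-sub {h} Hh (inv {π} c) = cong-≈ {π = flip (π ^^ h)} (λ _ → refl) (inv (closure-normal H-sub Hh c))
  closure-normal H-sub {h} Hh (cong-≈ {π} {σ} e c) = cong-≈ {π = π ^^ h} (^^-cong {π} {σ} h e) (closure-normal H-sub Hh c)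

  -- Minimality is stated positively, through one shared nonidentity element; this involves no
  -- decision about subgroups and passes to conjugates.
  record MinimalNormal (N H : PermSet v) : Set₁ where
    field
      sub        : IsSubgroup N
      ⊆H         : ∀ {n} → N n → H n
      normal     : NormalisedBy N H
      nontrivial : Nontrivial N
      minimal-in : ∀ {P : PermSet v} → IsSubgroup P → NormalisedBy P H →
                   ∀ {b} → N b → P b → ¬ (b ≈ id) → ∀ {n} → N n → P n

  pow-+ : ∀ (π : Perm v) m n → (π ^ₚ (m + n)) ≈ ((π ^ₚ m) ∘ₚ (π ^ₚ n))
  pow-+ π zero    n i = refl
  pow-+ π (suc m) n i = pow-+ π m n (i · π)

  pow-* : ∀ (π : Perm v) m n → (π ^ₚ (m * n)) ≈ ((π ^ₚ n) ^ₚ m)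
  pow-* π zero    n i = refl
  pow-* π (suc m) n i = trans (pow-+ π n (m * n) i) (pow-* π m n (i · (π ^ₚ n)))

  pow-id : ∀ n → (id {v} ^ₚ n) ≈ id
  pow-id zero    i = refl
  pow-id (suc n) i = pow-id n i

  pow-cong : ∀ {π σ : Perm v} n → π ≈ σ → (π ^ₚ n) ≈ (σ ^ₚ n)
  pow-cong zero    e i = refl
  pow-cong {π} {σ} (suc n) e i = trans (pow-cong {π} {σ} n e (i · π)) (cong (_· (σ ^ₚ n)) (e i))

  pow-commute : ∀ {π σ : Perm v} n → Commute π σ → Commute (π ^ₚ n) σ
  pow-commute zero    c i = refl
  pow-commute {π} {σ} (suc n) c i = trans (pow-commute {π} {σ} n c (i · π)) (cong (_· (π ^ₚ n)) (c i))

  pow-∘ : ∀ {π σ : Perm v} n → Commute π σ → ((π ∘ₚ σ) ^ₚ n) ≈ ((π ^ₚ n) ∘ₚ (σ ^ₚ n))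
  pow-∘ zero    c i = refl
  pow-∘ {π} {σ} (suc n) c i = trans (pow-∘ {π} {σ} n c (i · π · σ))
    (cong (_· (σ ^ₚ n)) (sym (pow-commute {π} {σ} n c (i · π))))

  pow-flip : ∀ (π : Perm v) n → (π ^ₚ n) ≈ id → (flip π ^ₚ n) ≈ id
  pow-flip π n e i = trans (sym (e (i · (flip π ^ₚ n))))
    (trans (sym (pow-∘ {flip π} {π} n (λ _ → trans (flip-· π) (sym (·-flip π))) i))
      (trans (pow-cong {flip π ∘ₚ π} {id} n (λ _ → flip-· π) i) (pow-id n i)))

  pow-^^ : ∀ (π h : Perm v) n → ((π ^^ h) ^ₚ n) ≈ ((π ^ₚ n) ^^ h)
  pow-^^ π h zero    i = sym (flip-· h)
  pow-^^ π h (suc n) i = trans (pow-^^ π h n (i · (π ^^ h))) (cong (λ y → y · (π ^ₚ n) · h) (·-flip h))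

  pow-∈ : ∀ {N : PermSet v} → IsSubgroup N → ∀ {π} n → N π → N (π ^ₚ n)
  pow-∈ N-sub zero    Nπ = IsSubgroup.id∈ N-sub
  pow-∈ N-sub (suc n) Nπ = IsSubgroup.∘∈ N-sub Nπ (pow-∈ N-sub n Nπ)

  -- Append (b a)² to a b, then cancel b² and a².
  exponent-2-abelian : ∀ {N : PermSet v} → IsSubgroup N → (∀ {n} → N n → (n ∘ₚ n) ≈ id) → Abelian N
  exponent-2-abelian N-sub square {a} {b} Na Nb i = begin
    i · a · b                          ≡⟨ sym (square (IsSubgroup.∘∈ N-sub Nb Na) _) ⟩
    i · a · b · b · a · b · a          ≡⟨ cong (λ y → y · a · b · a) (square Nb (i · a)) ⟩
    i · a · a · b · a                  ≡⟨ cong (λ y → y · b · a) (square Na i) ⟩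
    i · b · a                          ∎
    where open ≡-Reasoning

module Groups (em : EM) {v : ℕ} where

  open Counting em
  open Orders em

  opaque

    -- Among the closures of nonidentity elements one of least order is taken: the closure of any
    -- nonidentity element in it is contained in it and no smaller.
    minimal-normal : ∀ {H : PermSet v} → IsSubgroup H → Nontrivial H →
      Σ (PermSet v) λ N → MinimalNormal N H
    minimal-normal {H} H-sub H-nontrivial with minimal (λ a → H a × ¬ (a ≈ id)) (λ a → order (Closure a H)) H-nontrivial
    ... | a , (Ha , a≉) , least = Closure a H , record
      { sub        = closure-subgroup
      ; ⊆H         = closure⊆H Ha
      ; normal     = closure-normal H-sub
      ; nontrivial = a , closure-gen H-sub , a≉
      ; minimal-in = λ {P} P-sub P-normal {b} b∈ Pb b≉ n∈ →
          closure-⊆ P-sub (λ Hh → P-normal Hh Pb)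
            (order-⊆-eq cong-≈ (closure-⊆ closure-subgroup (λ Hh → closure-normal H-sub Hh b∈))
              (least b (closure⊆H Ha b∈ , b≉)) n∈)
      }
      where
      closure⊆H : H a → ∀ {n} → Closure a H n → H n
      closure⊆H Ha = closure-⊆ H-sub (λ Hh → ∘∈ (inv∈ Hh) (∘∈ Ha Hh))
        where open IsSubgroup H-sub

    -- Pigeonhole: there are more exponents than value tables, so two powers agree.
    finite-order : ∀ (a : Perm v) → ∃ λ j → 1 ≤ j × (a ^ₚ j) ≈ id
    finite-order a = stable λ none → 1+n≰n (subst₂ _≤_ #-Fin refl
      (#-injection {A = Fin (suc codes)} {P = λ _ → ⊤} {Q = λ _ → ⊤} (λ i c → code (a ^ₚ toℕ i) ≡ c)
        (λ i _ → _ , tt , refl)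
        (λ {i} {j} _ _ _ e e′ → injective none i j (code-≈ {π = a ^ₚ toℕ i} {σ = a ^ₚ toℕ j} (trans e (sym e′))))))
      where
      codes : ℕ
      codes = # (λ (_ : Vec (Fin v) v) → ⊤)

      cancel : ∀ {m n} → m < n → (a ^ₚ m) ≈ (a ^ₚ n) → (a ^ₚ (n ∸ m)) ≈ id
      cancel {m} {n} m<n e i = begin
        i · (a ^ₚ (n ∸ m))                                        ≡⟨ cong (_· (a ^ₚ (n ∸ m))) (sym (flip-· (a ^ₚ m))) ⟩
        i · flip (a ^ₚ m) · (a ^ₚ m) · (a ^ₚ (n ∸ m))             ≡⟨ sym (pow-+ a m (n ∸ m) (i · flip (a ^ₚ m))) ⟩
        i · flip (a ^ₚ m) · (a ^ₚ (m + (n ∸ m)))                  ≡⟨ cong (λ j → i · flip (a ^ₚ m) · (a ^ₚ j)) (m+[n∸m]≡n (<⇒≤ m<n)) ⟩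
        i · flip (a ^ₚ m) · (a ^ₚ n)                              ≡⟨ sym (e (i · flip (a ^ₚ m))) ⟩
        i · flip (a ^ₚ m) · (a ^ₚ m)                              ≡⟨ flip-· (a ^ₚ m) ⟩
        i                                                         ∎
        where open ≡-Reasoning

      injective : ¬ (∃ λ j → 1 ≤ j × (a ^ₚ j) ≈ id) → ∀ (i j : Fin (suc codes)) →
        (a ^ₚ toℕ i) ≈ (a ^ₚ toℕ j) → i ≡ j
      injective none i j e with <-cmp (toℕ i) (toℕ j)
      ... | tri< lt _ _ = contradiction (_ , m<n⇒0<n∸m lt , cancel lt e) none
      ... | tri≈ _ eq _ = toℕ-injective eq
      ... | tri> _ _ gt = contradiction (_ , m<n⇒0<n∸m gt , cancel gt (λ x → sym (e x))) none

    -- Take the least p ≥ 2 that annihilates some nonidentity element a. For a proper factorisation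
    -- p = q d, either d annihilates a or q annihilates the nonidentity element a^d, against the
    -- choice of p.
    prime-order : ∀ {N : PermSet v} → IsSubgroup N → Nontrivial N →
      ∃ λ p → Prime p × ∃ λ a → N a × ¬ (a ≈ id) × (a ^ₚ p) ≈ id
    prime-order {N} N-sub (n , Nn , n≉) with finite-order n
    ... | j , 1≤j , nj with minimal HasOrder (λ p → p) (j , 2≤ j 1≤j nj , n , Nn , n≉ , nj)
      where
      HasOrder : ℕ → Set
      HasOrder p = 2 ≤ p × ∃ λ a → N a × ¬ (a ≈ id) × (a ^ₚ p) ≈ id
      2≤ : ∀ j → 1 ≤ j → (n ^ₚ j) ≈ id → 2 ≤ j
      2≤ (suc zero)    _ e = contradiction e n≉
      2≤ (suc (suc j)) _ e = s≤s (s≤s z≤n)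
    ... | p , (2≤p , a , Na , a≉ , ap) , least = p , irreducible⇒prime ⦃ n>1⇒nonTrivial 2≤p ⦄ irreducible , a , Na , a≉ , ap
      where
      irreducible : ∀ {d} → d ∣ p → d ≡ 1 ⊎ d ≡ p
      irreducible {zero} (divides q refl) = contradiction (≤-trans 2≤p (≤-reflexive (*-comm q 0))) λ ()
      irreducible {suc zero} _ = inj₁ refl
      irreducible {suc (suc d)} (divides zero refl) = contradiction 2≤p λ ()
      irreducible {suc (suc d)} (divides (suc zero) refl) = inj₂ (sym (*-identityˡ _))
      irreducible {d′@(suc (suc d))} (divides q@(suc (suc _)) refl) with em ((a ^ₚ d′) ≈ id)
      ... | yes e = contradiction (least d′ (s≤s (s≤s z≤n) , a , Na , a≉ , e)) (<⇒≱ (subst (d′ <_) (*-comm d′ q) (m<m*n d′ q (s≤s (s≤s z≤n)))))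
      ... | no ¬e = contradiction (least q (s≤s (s≤s z≤n) , a ^ₚ d′ , pow-∈ N-sub d′ Na , ¬e , λ i → trans (sym (pow-* a q d′ i)) (ap i)))
                      (<⇒≱ (m<m*n q d′ (s≤s (s≤s z≤n))))

  -- The elements annihilated by p form a subgroup of the abelian group N normalised by G and
  -- containing a nonidentity element, hence all of N. A transitive abelian group is regular.
  abelian-minimal-affine : ∀ {N G : PermSet v} → MinimalNormal N G → Abelian N → Transitive N → AffineType G
  abelian-minimal-affine {N} {G} min abelian N-trans with prime-order (MinimalNormal.sub min) (MinimalNormal.nontrivial min)
  ... | p , p-prime , a , Na , a≉ , ap = N , ((sub , ⊆H) , normal) , (abelian , p , p-prime , λ Nn → proj₂ (all Nn)) , N-trans , semiregular
    where
    open MinimalNormal min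
    module N = IsSubgroup sub
    P : PermSet v
    P n = N n × (n ^ₚ p) ≈ id

    P-sub : IsSubgroup P
    P-sub = record
      { resp = λ {π} {σ} e (Nπ , πp) → N.resp e Nπ , λ i → trans (sym (pow-cong {π = π} {σ = σ} p e i)) (πp i)
      ; id∈  = N.id∈ , pow-id p
      ; ∘∈   = λ {π} {σ} (Nπ , πp) (Nσ , σp) → N.∘∈ Nπ Nσ , λ i →
                 trans (pow-∘ {π = π} {σ = σ} p (abelian Nπ Nσ) i) (trans (σp _) (πp i))
      ; inv∈ = λ {π} (Nπ , πp) → N.inv∈ Nπ , pow-flip π p πp
      }

    P-normal : NormalisedBy P G
    P-normal {h} {n} Gh (Nn , np) = normal Gh Nn , λ i →
      trans (pow-^^ n h p i) (trans (cong (_· h) (np (i · flip h))) (flip-· h))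

    all : ∀ {n} → N n → P n
    all = minimal-in P-sub P-normal Na (Na , ap) a≉

    semiregular : ∀ {n} x → N n → x · n ≡ x → n ≈ id
    semiregular {n} x Nn e y with N-trans x y
    ... | m , Nm , refl = trans (abelian Nm Nn x) (cong (_· m) e)

-- Commuting elements, centralisers and products of subgroups

module _ {v : ℕ} where

  commute-sym : ∀ {a b : Perm v} → Commute a b → Commute b a
  commute-sym c i = sym (c i)

  commute-∘ : ∀ {a b c : Perm v} → Commute a b → Commute a c → Commute a (b ∘ₚ c)
  commute-∘ {a} {b} {c} ab ac i = trans (cong (_· c) (ab i)) (ac (i · b))

  commute-flipʳ : ∀ {a b : Perm v} → Commute a b → Commute a (flip b)
  commute-flipʳ {a} {b} ab = commute-sym {flip b} {a} (commute-flip {g = b} {h = a} (commute-sym {a} {b} ab))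

  commute-cong : ∀ {a b c : Perm v} → b ≈ c → Commute a b → Commute a c
  commute-cong {a} {b} {c} e ab i = trans (sym (e (i · a))) (trans (ab i) (cong (_· a) (e i)))

  commute-^^ : ∀ {a b : Perm v} (h : Perm v) → Commute a b → Commute (a ^^ h) (b ^^ h)
  commute-^^ {a} {b} h ab i = trans (^^-∘ a b h i) (trans (cong (_· h) (ab (i · flip h))) (sym (^^-∘ b a h i)))

  ^^-flip : ∀ (a h : Perm v) → ((a ^^ flip h) ^^ h) ≈ a
  ^^-flip a h i = trans (flip-· h) (cong (_· a) (flip-· h))

  flip-^^ : ∀ (a h : Perm v) → ((a ^^ h) ^^ flip h) ≈ a
  flip-^^ a h i = trans (·-flip h) (cong (_· a) (·-flip h))

  ^^-id : ∀ (h : Perm v) → (id ^^ h) ≈ id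
  ^^-id h i = flip-· h

  ^^-≈-commute : ∀ {a b : Perm v} → (a ^^ b) ≈ a → Commute a b
  ^^-≈-commute {a} {b} e i = trans (sym (^^-action a b i)) (e (i · b))

  Centraliser : PermSet v → PermSet v → PermSet v
  Centraliser H N c = H c × (∀ {n} → N n → Commute n c)

  centraliser-subgroup : ∀ {H N} → IsSubgroup H → IsSubgroup (Centraliser H N)
  centraliser-subgroup {H} {N} H-sub = record
    { resp = λ {π} {σ} e (Hπ , c) → resp e Hπ , λ {n} Nn → commute-cong {n} {π} {σ} e (c Nn)
    ; id∈  = id∈ , λ _ _ → refl
    ; ∘∈   = λ {π} {σ} (Hπ , c) (Hσ , d) → ∘∈ Hπ Hσ , λ {n} Nn → commute-∘ {n} {π} {σ} (c Nn) (d Nn)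
    ; inv∈ = λ {π} (Hπ , c) → inv∈ Hπ , λ {n} Nn → commute-flipʳ {n} {π} (c Nn)
    }
    where open IsSubgroup H-sub

  centraliser-normal : ∀ {H N} → IsSubgroup H → NormalisedBy N H → NormalisedBy (Centraliser H N) H
  centraliser-normal {H} {N} H-sub N-normal {h} {c} Hh (Hc , comm) =
    ∘∈ (inv∈ Hh) (∘∈ Hc Hh) , λ {n} Nn → commute-sym {c ^^ h} {n}
      (commute-cong {c ^^ h} {(n ^^ flip h) ^^ h} {n} (^^-flip n h)
        (commute-^^ {c} {n ^^ flip h} h (commute-sym {n ^^ flip h} {c} (comm (N-normal (inv∈ Hh) Nn)))))
    where open IsSubgroup H-sub

  -- [a , b] lies in both subgroups.
  normal-commute : ∀ {H X Y : PermSet v} → IsSubgroup X → IsSubgroup Y →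
    (∀ {x} → X x → H x) → (∀ {y} → Y y → H y) → NormalisedBy X H → NormalisedBy Y H →
    (∀ {z} → X z → Y z → z ≈ id) → ∀ {a b} → X a → Y b → Commute a b
  normal-commute {H} {X} {Y} X-sub Y-sub X⊆H Y⊆H X-normal Y-normal disjoint {a} {b} Xa Yb =
    ^^-≈-commute {a} {b} λ i → trans (cong (_· (a ^^ b)) (sym (·-flip a))) (commutator (i · a))
    where
    commutator : (flip a ∘ₚ (a ^^ b)) ≈ id
    commutator = disjoint (IsSubgroup.∘∈ X-sub (IsSubgroup.inv∈ X-sub Xa) (X-normal (Y⊆H Yb) Xa))
      (IsSubgroup.∘∈ Y-sub (Y-normal (X⊆H Xa) (IsSubgroup.inv∈ Y-sub Yb)) Yb)

module Products (em : EM) {v : ℕ} where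

  open Orders em

  ∙-subgroup : ∀ {X Y : PermSet v} → IsSubgroup X → IsSubgroup Y → NormalisedBy Y X → IsSubgroup (X ∙ Y)
  ∙-subgroup {X} {Y} X-sub Y-sub Y-normal = record
    { resp = λ e (a , p , Xa , Yp , π≈) → a , p , Xa , Yp , λ i → trans (sym (e i)) (π≈ i)
    ; id∈  = id , id , X.id∈ , Y.id∈ , λ _ → refl
    ; ∘∈   = λ (a , p , Xa , Yp , π≈) (b , q , Xb , Yq , σ≈) →
        a ∘ₚ b , (p ^^ b) ∘ₚ q , X.∘∈ Xa Xb , Y.∘∈ (Y-normal Xb Yp) Yq , λ i →
          trans (σ≈ _) (cong (_· q) (trans (cong (_· b) (π≈ i)) (sym (^^-action p b (i · a)))))
    ; inv∈ = λ {π} (a , p , Xa , Yp , π≈) →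
        flip a , flip p ^^ flip a , X.inv∈ Xa , Y-normal (X.inv∈ Xa) (Y.inv∈ Yp) , λ i →
          trans (flip-cong {π = π} {σ = a ∘ₚ p} π≈ i) (cong (λ y → y · flip p · flip a) (sym (flip-· a)))
    }
    where
    module X = IsSubgroup X-sub
    module Y = IsSubgroup Y-sub

  ∙-normal : ∀ {H X Y : PermSet v} → NormalisedBy X H → NormalisedBy Y H → NormalisedBy (X ∙ Y) H
  ∙-normal X-normal Y-normal {h} {n} Hh (a , p , Xa , Yp , n≈) =
    a ^^ h , p ^^ h , X-normal Hh Xa , Y-normal Hh Yp , λ i →
      trans (cong (_· h) (n≈ (i · flip h))) (sym (^^-∘ a p h i))

-- Point-primitive groups

module PointPrimitiveGroup (em : EM) {v k u t : ℕ} (D : Steiner3Design v k)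
  (v≡ : v ≡ suc (suc u)) (k≡ : k ≡ suc (suc t)) (2≤t : 2 ≤ t) (t<u : t < u)
  (G : PermSet v) (G-aut : SubgroupOfAut D G) (G-trans : BlockTransitive D G) (G-prim : Primitive G) where

  open Counting em
  open Orders em
  open Parity em {v}
  open Groups em {v}
  open Products em {v}
  open Steiner3Design D
  open Design em D v≡ k≡ 2≤t t<u
  open BlockTransitiveGroup em D v≡ k≡ 2≤t t<u G G-aut G-trans

  origin : Point
  origin = proj₁ three-points

  -- The orbits of a subgroup normalised by G are the classes of a G-invariant equivalence relation.
  normal-transitive : ∀ {M : PermSet v} → IsSubgroup M → NormalisedBy M G → Nontrivial M → Transitive M
  normal-transitive {M} M-sub M-normal (m , Mm , m≉) with proj₂ G-prim R R-equiv R-inv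
    where
    module M = IsSubgroup M-sub
    R : Point → Point → Set
    R x y = ∃ λ m → M m × x · m ≡ y
    R-equiv : IsEquivalence R
    R-equiv = record
      { refl  = id , M.id∈ , refl
      ; sym   = λ { (m , Mm , refl) → flip m , M.inv∈ Mm , ·-flip m }
      ; trans = λ { (m , Mm , refl) (n , Mn , refl) → m ∘ₚ n , M.∘∈ Mm Mn , refl } }
    R-inv : ∀ {g x y} → G g → R x y → R (x · g) (y · g)
    R-inv {g} {x} Gg (m , Mm , refl) = m ^^ g , M-normal Gg Mm , ^^-action m g x
  ... | inj₁ trivial   = contradiction (λ x → sym (trivial (m , Mm , refl))) m≉
  ... | inj₂ universal = universal

  module _ {A : PermSet v} (A-sub : IsSubgroup A) (semiregular : ∀ {a} x → A a → x · a ≡ x → a ≈ id) where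

    private
      module A = IsSubgroup A-sub

    opaque

      semiregular-orbit : ∀ x → # (λ y → ∃ λ a → A a × x · a ≡ y) ≡ order A
      semiregular-orbit x = ≤-antisym
        (#-injection (λ y c → ∃ λ a → A a × x · a ≡ y × code a ≡ c)
          (λ y (a , Aa , e) → code a , (a , Aa , refl) , a , Aa , e , refl)
          (λ { _ _ _ (a , _ , refl , e) (b , _ , refl , e′) → code-≈ {π = a} {σ = b} (trans e (sym e′)) x }))
        (#-injection (λ c y → ∃ λ a → A a × x · a ≡ y × code a ≡ c)
          (λ c (a , Aa , e) → x · a , (a , Aa , refl) , a , Aa , refl , e)
          (λ { _ _ _ (a , Aa , e , refl) (b , Ab , e′ , refl) → ≈-code {π = a} {σ = b} (λ i → sym (trans
            (cong (_· b) (sym (·-flip a)))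
            (semiregular {flip a ∘ₚ b} (x · a) (A.∘∈ (A.inv∈ Aa) Ab)
              (trans (cong (_· b) (·-flip a)) (trans e′ (sym e))) (i · a)))) }))

      semiregular-divides : order A ∣ v
      semiregular-divides = subst (order A ∣_) #-Fin (classes-divide (λ _ → ⊤) (λ x y → ∃ λ a → A a × x · a ≡ y) (order A)
        (λ _ → id , A.id∈ , refl)
        (λ { (a , Aa , refl) → flip a , A.inv∈ Aa , ·-flip a })
        (λ { (a , Aa , refl) (b , Ab , refl) → a ∘ₚ b , A.∘∈ Aa Ab , refl })
        (λ x _ → trans (#-cong (λ _ → proj₂) (λ _ e → tt , e)) (semiregular-orbit x)))

      -- `cauchy-2` supplies an involution; it is even, and semiregularity rules out fixed points.
      even-semiregular : (∀ {a} → A a → Even a) → 2 ∣ order A → 4 ∣ v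
      even-semiregular A-even 2∣A with cauchy-2 A-sub 2∣A
      ... | τ , Aτ , ττ , τ≉ = fixed-point-free-involution τ ττ (λ x e → τ≉ (semiregular x Aτ e)) (A-even Aτ)

  -- An element fixing x and commuting with κ also fixes x κ.
  centralised-semiregular : ∀ {A K : PermSet v} → Transitive K → (∀ {a κ} → A a → K κ → Commute a κ) →
    ∀ {a} x → A a → x · a ≡ x → a ≈ id
  centralised-semiregular K-trans commute {a} x Aa e y with K-trans x y
  ... | κ , Kκ , refl = trans (sym (commute Aa Kκ x)) (cong (_· κ) e)

  opaque

    -- For κ in K with g κ fixing a point, commuting-square gives (g κ)² = 1.
    diagonal : ∀ {M A K : PermSet v} j → M ⊴ G → IsSubgroup A → (∀ {a} → A a → M a) → (∀ {κ} → K κ → M κ) →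
      Transitive K → (∀ {a κ} → A a → K κ → Commute a κ) → (∀ {a} → A a → Even a) →
      order M ∣ order A ^ j → ∀ {g} → A g → ¬ ((g ∘ₚ g) ≈ id) →
      ∃ λ κ → K κ × (g ∘ₚ g) ≈ flip (κ ∘ₚ κ)
    diagonal {M} {A} {K} j M⊴G@((M-sub , M⊆G) , _) A-sub A⊆M K⊆M K-trans commute A-even M∣ {g} Ag gg≉
      -- This κ makes g κ fix the origin, and (g κ)² = 1 then reads g² = κ⁻², so that g² lies in
      -- both A and K.
      with K-trans (origin · g) origin
    ... | κ , Kκ , back = κ , Kκ , λ i → ·-flip-≡ (κ ∘ₚ κ) (trans (cong (_· κ) (commute Ag Kκ (i · g)))
        (commuting-square M-sub M⊆G small K⊆M K-trans g (M⊆G (A⊆M Ag)) (commute Ag) (g ∘ₚ κ)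
          (IsSubgroup.∘∈ M-sub (A⊆M Ag) (K⊆M Kκ)) (λ i → commute Ag Kκ (i · g)) back
          (λ e → gg≉ (λ i → trans (cong (_· g) (semi origin Ag e i)) (semi origin Ag e i)))
          (λ e → gg≉ (semi origin (IsSubgroup.∘∈ A-sub Ag Ag) e)) i))
      where
      semi : ∀ {a} x → A a → x · a ≡ x → a ≈ id
      semi {a} = centralised-semiregular {A} {K} K-trans (λ {b} {κ} → commute {b} {κ}) {a}
      small : ∀ {B} → Block B → # (Orbit M B) ≤ v
      small = block-orbit-≤ j M⊴G M∣ (semiregular-divides A-sub semi) (even-semiregular A-sub semi A-even)

  non-involution : ∀ {N : PermSet v} → IsSubgroup N → ¬ Abelian N → ∃ λ n → N n × ¬ ((n ∘ₚ n) ≈ id)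
  non-involution N-sub ¬abelian = stable λ none → ¬abelian
    (exponent-2-abelian N-sub (λ {n} Nn → stable λ nn≉ → none (n , Nn , nn≉)))

  -- A nonabelian N contains a nonidentity square, which is even, and the even permutations are
  -- normalised by G.
  minimal-even : ∀ {N : PermSet v} → MinimalNormal N G → ¬ Abelian N → ∀ {n} → N n → Even n
  minimal-even min ¬abelian with non-involution (MinimalNormal.sub min) ¬abelian
  ... | n , Nn , nn≉ = minimal-in Even-subgroup (λ {h} {π} _ e → Even-conjugate {π} h e)
      (IsSubgroup.∘∈ sub Nn Nn) (Even-square n) nn≉
    where open MinimalNormal min

  opaque

    -- A nontrivial centraliser C is transitive, so N and C centralise each other regularly and both
    -- have order v. The order of N C then divides the square of that of N, and `diagonal` places a
    -- nonidentity square of N in C. By minimality N lies in C and is abelian.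
    centraliser-trivial : ∀ {N : PermSet v} → MinimalNormal N G → ¬ Abelian N → ¬ Nontrivial (Centraliser G N)
    centraliser-trivial {N} min ¬abelian C-nontrivial with non-involution (MinimalNormal.sub min) ¬abelian
    ... | g , Ng , gg≉ with diagonal {M = N ∙ C} {A = N} {K = C} 2
        ((∙-subgroup sub C-sub C-by-N , λ (a , c , Na , (Gc , _) , e) → G.resp (λ i → sym (e i)) (G.∘∈ (⊆H Na) Gc)) ,
          λ {h} {p} → ∙-normal {G} {N} {C} (λ {h} {p} → normal {h} {p}) (λ {h} {p} → C-normal {h} {p}) {h} {p})
        sub (λ {a} Na → a , id , Na , IsSubgroup.id∈ C-sub , λ _ → refl) (λ {c} Cc → id , c , IsSubgroup.id∈ sub , Cc , λ _ → refl)
        C-trans (λ Na (_ , comm) → comm Na) (minimal-even min ¬abelian) M∣ Ng gg≉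
      where
      open MinimalNormal min
      C : PermSet v
      C = Centraliser G N
      C-sub : IsSubgroup C
      C-sub = centraliser-subgroup (proj₁ G-aut)
      C-normal : NormalisedBy C G
      C-normal = centraliser-normal (proj₁ G-aut) normal
      C-by-N : NormalisedBy C N
      C-by-N Nn = C-normal (⊆H Nn)
      C-trans : Transitive C
      C-trans = normal-transitive C-sub C-normal C-nontrivial
      N-trans : Transitive N
      N-trans = normal-transitive sub normal nontrivial
      regular-order : ∀ {X : PermSet v} → IsSubgroup X → Transitive X → (∀ {a} x → X a → x · a ≡ x → a ≈ id) → order X ≡ v
      regular-order X-sub X-trans semi = trans (sym (semiregular-orbit X-sub semi origin))
        (trans (#-cong (λ _ _ → tt) (λ y _ → X-trans origin y)) #-Fin)
      M∣ : order (N ∙ C) ∣ order N ^ 2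
      M∣ = ∣-trans (order-∙ sub C-sub) (∣-reflexive (cong (order N *_) (trans
        (regular-order {C} C-sub C-trans (λ {a} → centralised-semiregular {C} {N} N-trans (λ {c} {n} (_ , comm) Nn → commute-sym {a = n} {b = c} (comm Nn)) {a}))
        (sym (trans (*-identityʳ (order N)) (regular-order {N} sub N-trans (λ {a} → centralised-semiregular {N} {C} C-trans (λ {n} {c} Nn (_ , comm) → comm {n} Nn) {a})))))))
    ... | κ , Cκ , gg≈ = ¬abelian (λ {a} {b} Na Nb → proj₂ (N⊆C Nb) Na)
      where
      open MinimalNormal min
      C-sub : IsSubgroup (Centraliser G N)
      C-sub = centraliser-subgroup (proj₁ G-aut)
      N⊆C : ∀ {n} → N n → Centraliser G N n
      N⊆C = minimal-in C-sub (centraliser-normal (proj₁ G-aut) normal) (IsSubgroup.∘∈ sub Ng Ng)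
        (IsSubgroup.resp C-sub (λ i → sym (gg≈ i)) (IsSubgroup.inv∈ C-sub (IsSubgroup.∘∈ C-sub Cκ Cκ))) gg≉

  -- `generates` is simplicity in terms of normal closures of elements: a nontrivial normal subgroup
  -- of N contains such a closure.
  simple-almost-simple : ∀ {N : PermSet v} → MinimalNormal N G → ¬ Abelian N →
    (∀ {a} → N a → ¬ (a ≈ id) → ∀ {b} → N b → Closure a N b) → AlmostSimpleType G
  simple-almost-simple {N} min ¬abelian generates = N , ((sub , ⊆H) , normal) ,
    ((λ trivial → proj₂ (proj₂ nontrivial) (trivial (proj₁ (proj₂ nontrivial)))) , dichotomy) , ¬abelian ,
    λ {g} Gg comm → stable λ g≉ → centraliser-trivial min ¬abelian
      (g , (Gg , λ {n} Nn → commute-sym {a = g} {b = n} (comm Nn)) , g≉)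
    where
    open MinimalNormal min
    dichotomy : ∀ (P : PermSet v) → P ⊴ N → IsTrivial P ⊎ (∀ {t} → N t → P t)
    dichotomy P ((P-sub , P⊆N) , P-normal) with em (Nontrivial P)
    ... | yes (b , Pb , b≉) = inj₂ λ Nn → closure-⊆ P-sub (λ Nh → P-normal Nh Pb) (generates (P⊆N Pb) b≉ Nn)
    ... | no ¬nontrivial = inj₁ λ {n} Pn → stable λ n≉ → ¬nontrivial (n , Pn , n≉)

-- Components of a non-simple minimal normal subgroup

-- These hypotheses are refuted by `impossible`; hence no minimal normal subgroup of N is proper.
module Components (em : EM) {v k u t : ℕ} (D : Steiner3Design v k)
  (v≡ : v ≡ suc (suc u)) (k≡ : k ≡ suc (suc t)) (2≤t : 2 ≤ t) (t<u : t < u)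
  (G : PermSet v) (G-aut : SubgroupOfAut D G) (G-trans : BlockTransitive D G) (G-prim : Primitive G)
  {N A : PermSet v} (N-min : MinimalNormal N G) (N-nonabelian : ¬ Abelian N)
  (A-min : MinimalNormal A N) (A-proper : ∃ λ b → N b × ¬ A b) where

  open Counting em
  open Orders em
  open Parity em {v}
  open Groups em {v}
  open Products em {v}
  open Steiner3Design D
  open Design em D v≡ k≡ 2≤t t<u
  open BlockTransitiveGroup em D v≡ k≡ 2≤t t<u G G-aut G-trans
  open PointPrimitiveGroup em D v≡ k≡ 2≤t t<u G G-aut G-trans G-prim

  module N where
    open MinimalNormal N-min public
    open IsSubgroup sub public

  module A where
    open MinimalNormal A-min public
    open IsSubgroup sub public

  opaque

    N-trans : Transitive N
    N-trans = normal-transitive N.sub (λ {h} {p} → N.normal {h} {p}) N.nontrivial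

  -- For g in G these conjugates of `A` are the components of N; different g may give the same one.
  record Comp (g a : Perm v) : Set where
    constructor comp
    field in-A : A (a ^^ flip g)

  comp-conj : ∀ g h {a} → Comp g a → Comp (g ∘ₚ h) (a ^^ h)
  comp-conj g h {a} (comp Aa) = comp (A.resp {a ^^ flip g} {(a ^^ h) ^^ flip (g ∘ₚ h)} (λ i → sym (trans
    (cong (_· flip g) (·-flip h)) (cong (λ y → y · a · flip g) (·-flip h)))) Aa)

  comp-gen : ∀ g {a} → A a → Comp g (a ^^ g)
  comp-gen g {a} Aa = comp (A.resp {a} {(a ^^ g) ^^ flip g} (λ i → sym (flip-^^ a g i)) Aa)

  comp-A : ∀ g {a} → Comp g (a ^^ g) → A a
  comp-A g {a} (comp Aa) = A.resp {(a ^^ g) ^^ flip g} {a} (flip-^^ a g) Aa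

  -- Conjugation by g maps N to itself and `A` to `Comp g`, carrying normality and minimality along.
  comp-min : ∀ {g} → G g → MinimalNormal (Comp g) N
  comp-min {g} Gg = record
    { sub = record
        { resp = λ {π} {σ} e (comp Aπ) → comp (A.resp (^^-cong {π = π} {σ = σ} (flip g) e) Aπ)
        ; id∈  = comp (A.resp {id} (λ i → sym (^^-id (flip g) i)) A.id∈)
        ; ∘∈   = λ {π} {σ} (comp Aπ) (comp Aσ) → comp (A.resp {(π ^^ flip g) ∘ₚ (σ ^^ flip g)} (^^-∘ π σ (flip g)) (A.∘∈ Aπ Aσ))
        ; inv∈ = λ {π} (comp Aπ) → comp (A.resp {flip (π ^^ flip g)} (λ _ → refl) (A.inv∈ Aπ)) }
    ; ⊆H = comp⊆N
    ; normal = λ {n} {a} Nn (comp Ca) → comp (A.resp {(a ^^ flip g) ^^ (n ^^ flip g)}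
        (λ i → trans (cong (λ y → y · n · flip g) (flip-· g))
          (cong (λ y → y · a · n · flip g) (flip-· g)))
        (A.normal (N.normal (G.inv∈ Gg) Nn) Ca))
    ; nontrivial = proj₁ A.nontrivial ^^ g , comp-gen g (proj₁ (proj₂ A.nontrivial)) ,
        λ e → proj₂ (proj₂ A.nontrivial) λ i →
          trans (sym (flip-^^ (proj₁ A.nontrivial) g i)) (trans (^^-cong {π = proj₁ A.nontrivial ^^ g} {σ = id} (flip g) e i) (^^-id (flip g) i))
    ; minimal-in = λ {P} P-sub P-normal {b} (comp Cb) Pb b≉ {n} (comp Cn) →
        IsSubgroup.resp P-sub (^^-flip n g)
          (A.minimal-in {λ a → P (a ^^ g)} (pulled P-sub)
            (λ {h} {p} Nh Pp → IsSubgroup.resp P-sub {(p ^^ g) ^^ (h ^^ g)}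
              (λ i → trans (cong (λ y → y · h · g) (·-flip g)) (cong (λ y → y · p · h · g) (·-flip g)))
              (P-normal (N.normal Gg Nh) Pp))
            Cb (IsSubgroup.resp P-sub (λ i → sym (^^-flip b g i)) Pb)
            (λ e → b≉ λ i → trans (sym (^^-flip b g i)) (trans (^^-cong {π = b ^^ flip g} {σ = id} g e i) (^^-id g i)))
            Cn)
    }
    where
    comp⊆N : ∀ {a} → Comp g a → N a
    comp⊆N {a} (comp Ca) = N.resp {(a ^^ flip g) ^^ g} (^^-flip a g) (N.normal Gg (A.⊆H Ca))
    pulled : ∀ {P : PermSet v} → IsSubgroup P → IsSubgroup (λ a → P (a ^^ g))
    pulled P-sub = record
      { resp = λ {π} {σ} e → IsSubgroup.resp P-sub (^^-cong {π = π} {σ = σ} g e)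
      ; id∈  = IsSubgroup.resp P-sub {id} (λ i → sym (^^-id g i)) (IsSubgroup.id∈ P-sub)
      ; ∘∈   = λ {π} {σ} Pπ Pσ → IsSubgroup.resp P-sub {(π ^^ g) ∘ₚ (σ ^^ g)} (^^-∘ π σ g) (IsSubgroup.∘∈ P-sub Pπ Pσ)
      ; inv∈ = λ {π} Pπ → IsSubgroup.resp P-sub {flip (π ^^ g)} (λ _ → refl) (IsSubgroup.inv∈ P-sub Pπ) }

  module Component {g : Perm v} (Gg : G g) where
    open MinimalNormal (comp-min Gg) public
    open IsSubgroup sub public

  _⊑_ : Perm v → Perm v → Set
  g ⊑ h = ∀ {a} → Comp g a → Comp h a

  Commuting : Perm v → Perm v → Set
  Commuting g h = ∀ {a b} → Comp g a → Comp h b → Commute a b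

  opaque

    -- By minimality, components sharing a nonidentity element contain each other; normal subgroups
    -- of N with trivial intersection commute.
    same-or-commute : ∀ {g h} → G g → G h → (g ⊑ h × h ⊑ g) ⊎ Commuting g h
    same-or-commute {g} {h} Gg Gh with em (∃ λ b → Comp g b × Comp h b × ¬ (b ≈ id))
    ... | yes (b , Cg , Ch , b≉) = inj₁
      ( Component.minimal-in Gg (Component.sub Gh) (λ {n} {p} → Component.normal Gh {n} {p}) Cg Ch b≉
      , Component.minimal-in Gh (Component.sub Gg) (λ {n} {p} → Component.normal Gg {n} {p}) Ch Cg b≉ )
    ... | no disjoint = inj₂ λ {a} {b} Ca Cb → normal-commute {H = N} (Component.sub Gg) (Component.sub Gh) (Component.⊆H Gg) (Component.⊆H Gh)
        (λ {n} {p} → Component.normal Gg {n} {p}) (λ {n} {p} → Component.normal Gh {n} {p})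
        (λ {z} Cz C′z → stable λ z≉ → disjoint (z , Cz , C′z , z≉)) {a} {b} Ca Cb

  opaque

    -- All G-conjugates of a nonidentity element of `A` lie in components, and by minimality their
    -- closure contains N. So it suffices to check `S` on components.
    N-ind : ∀ {S : PermSet v} → IsSubgroup S → (∀ {h} → G h → ∀ {a} → Comp h a → S a) → ∀ {n} → N n → S n
    N-ind {S} S-sub gen {n} Nn with A.nontrivial
    ... | a , Aa , a≉ = closure-⊆ S-sub (λ {h} Gh → gen Gh (comp-gen h Aa))
        (N.minimal-in closure-subgroup (λ {h} {p} → closure-normal (proj₁ G-aut) {h} {p}) (A.⊆H Aa) (closure-gen (proj₁ G-aut)) a≉ Nn)

    -- If one component were abelian, so would be all its conjugates; any two components would then
    -- commute, and with them all of N.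
    comp-nonabelian : ∀ {g} → G g → ¬ Abelian (Comp g)
    comp-nonabelian {g} Gg abelian = N-nonabelian λ {a} {b} Na Nb →
      proj₂ (N-ind {Centraliser N N} (centraliser-subgroup N.sub)
        (λ {h} Gh {c} Cc → Component.⊆H Gh Cc , λ {n} Nn → commute-sym {a = c} {b = n}
          (proj₂ (N-ind {Centraliser N (Comp h)} (centraliser-subgroup N.sub)
            (λ {h′} Gh′ {d} Cd → Component.⊆H Gh′ Cd , λ {e} Ce → all-commute Gh Gh′ {e} {d} Ce Cd) {n} Nn) {c} Cc)) {b} Nb) {a} Na
      where
      abelian-A : Abelian A
      abelian-A {a} {b} Aa Ab i = trans (sym (flip-^^ (a ∘ₚ b) g i)) (trans (cong (λ y → y · flip g)
        (trans (sym (^^-∘ a b g (i · g))) (trans (abelian (comp-gen g Aa) (comp-gen g Ab) (i · g)) (^^-∘ b a g (i · g)))))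
        (flip-^^ (b ∘ₚ a) g i))
      abelian-comp : ∀ h → Abelian (Comp h)
      abelian-comp h {a} {b} (comp Ca) (comp Cb) i = trans (sym (^^-flip (a ∘ₚ b) h i)) (trans (cong (λ y → y · h)
        (trans (sym (^^-∘ a b (flip h) (i · flip h))) (trans (abelian-A Ca Cb (i · flip h)) (^^-∘ b a (flip h) (i · flip h)))))
        (^^-flip (b ∘ₚ a) h i))
      all-commute : ∀ {h h′} → G h → G h′ → Commuting h h′
      all-commute {h} {h′} Gh Gh′ {a} {b} Ca Cb with same-or-commute Gh Gh′
      ... | inj₁ (_ , h′⊑h) = abelian-comp h Ca (h′⊑h Cb)
      ... | inj₂ c          = c {a} {b} Ca Cb

  -- By `factor` and `centreless` this is a direct complement of `Comp g` in N.
  K : Perm v → PermSet v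
  K g = Centraliser N (Comp g)

  K-sub : ∀ g → IsSubgroup (K g)
  K-sub g = centraliser-subgroup N.sub

  K-normal : ∀ {g} → G g → NormalisedBy (K g) N
  K-normal Gg {n} {κ} = centraliser-normal N.sub (λ {h} {p} → Component.normal Gg {h} {p}) {n} {κ}

  commuting-⊆K : ∀ {g h} → G h → Commuting g h → ∀ {b} → Comp h b → K g b
  commuting-⊆K Gh c {b} Cb = Component.⊆H Gh Cb , λ {a} Ca → c {a} {b} Ca Cb

  -- A common nonidentity element would, by minimality, put `Comp g` inside its own centraliser.
  centreless : ∀ {g} → G g → ∀ {z} → Comp g z → K g z → z ≈ id
  centreless {g} Gg {z} Cz Kz = stable λ z≉ → comp-nonabelian Gg λ {a} {b} Ca Cb →
    proj₂ (Component.minimal-in Gg (K-sub g) (λ {n} {p} → K-normal Gg {n} {p}) Cz Kz z≉ Cb) Ca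

  opaque

    -- Each component either equals `Comp g` or commutes with it and so lies in `K g`.
    factor : ∀ {g} → G g → ∀ {n} → N n → (Comp g ∙ K g) n
    factor {g} Gg = N-ind (∙-subgroup (Component.sub Gg) (K-sub g) (λ {a} {κ} Ca → K-normal Gg {a} {κ} (Component.⊆H Gg Ca)))
      λ {h} Gh {a} Ca → [ (λ (_ , h⊑g) → a , id , h⊑g Ca , IsSubgroup.id∈ (K-sub g) , λ _ → refl)
                        , (λ c → id , a , Component.id∈ Gg , commuting-⊆K Gh (λ {x} {y} → c {x} {y}) Ca , λ _ → refl) ]′ (same-or-commute Gg Gh)

  Prod : List (Perm v) → PermSet v
  Prod []      n = n ≈ id
  Prod (g ∷ L)   = Comp g ∙ Prod L

  data Independent : List (Perm v) → Set where
    []   : Independent []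
    cons : ∀ {g L} → G g → (∀ {a} → Comp g a → Prod L a → a ≈ id) → Independent L → Independent (g ∷ L)

  prod-normal : ∀ {L} → Independent L → NormalisedBy (Prod L) N
  prod-normal [] {h} {p} Nh e i = trans (^^-cong {π = p} {σ = id} h e i) (^^-id h i)
  prod-normal {g ∷ L} (cons Gg _ ind) {h} {p} Nh =
    ∙-normal {N} {Comp g} {Prod L} (λ {h} {p} → Component.normal Gg {h} {p}) (λ {h} {p} → prod-normal ind {h} {p}) {h} {p} Nh

  prod⊆N : ∀ {L} → Independent L → ∀ {n} → Prod L n → N n
  prod⊆N [] e = N.resp {id} (λ i → sym (e i)) N.id∈
  prod⊆N (cons Gg _ ind) (a , p , Ca , Pp , e) = N.resp {a ∘ₚ p} (λ i → sym (e i)) (N.∘∈ (Component.⊆H Gg Ca) (prod⊆N ind Pp))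

  prod-sub : ∀ {L} → Independent L → IsSubgroup (Prod L)
  prod-sub [] = record
    { resp = λ e e′ i → trans (sym (e i)) (e′ i)
    ; id∈  = λ _ → refl
    ; ∘∈   = λ {π} {σ} e e′ i → trans (e′ (i · π)) (e i)
    ; inv∈ = λ {π} e i → flip-cong {π = π} {σ = id} e i }
  prod-sub (cons Gg _ ind) = ∙-subgroup (Component.sub Gg) (prod-sub ind)
    (λ {h} {p} Ch → prod-normal ind {h} {p} (Component.⊆H Gg Ch))

  prod⊆K : ∀ {g L} → G g → (∀ {a} → Comp g a → Prod L a → a ≈ id) → Independent L → ∀ {p} → Prod L p → K g p
  prod⊆K {g} {L} Gg disjoint ind {p} Pp = prod⊆N ind Pp , λ {a} Ca →
    normal-commute {H = N} (Component.sub Gg) (prod-sub ind) (Component.⊆H Gg) (prod⊆N ind)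
      (λ {n} {p} → Component.normal Gg {n} {p}) (λ {n} {p} → prod-normal ind {n} {p}) disjoint {a} {p} Ca Pp

  opaque

    order-comp : ∀ {g} → order (Comp g) ≡ order A
    order-comp {g} = ≤-antisym
      (order-injection (_^^ flip g) (λ (comp Ca) → Ca) (λ {π} {σ} e → conj-injective (flip g) {π} {σ} e))
      (order-injection (_^^ g) (λ Aa → comp-gen g Aa) (λ {π} {σ} e → conj-injective g {π} {σ} e))
      where
      conj-injective : ∀ h {π σ : Perm v} → (π ^^ h) ≈ (σ ^^ h) → π ≈ σ
      conj-injective h {π} {σ} e i = ·-injective h (trans (sym (^^-action π h i)) (trans (e (i · h)) (^^-action σ h i)))

    -- Once the product is all of N, this is the divisibility that `diagonal` asks for.
    order-prod : ∀ {L} → Independent L → order (Prod L) ∣ order (Comp id) ^ length L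
    order-prod [] = ∣-reflexive (#≡1 {a = code id} (id , (λ _ → refl) , refl)
      (λ { (π , e , refl) (σ , e′ , refl) → ≈-code {π = π} {σ = σ} (λ i → trans (e i) (sym (e′ i))) }))
    order-prod {g ∷ L} (cons Gg _ ind) = ∣-trans (order-∙ (Component.sub Gg) (prod-sub ind))
      (subst (λ n → n * order (Prod L) ∣ order (Comp id) ^ length (g ∷ L)) (trans (order-comp {id}) (sym (order-comp {g})))
        (*-monoʳ-∣ (order (Comp id)) (order-prod ind)))

    -- Take an independent list whose product has the largest order. A component meeting this
    -- product trivially could be added to the list; any other lies in it by minimality.
    independent-generators : ∃ λ L → Independent L × (∀ {n} → N n → Prod L n)
    independent-generators with minimal Independent (λ L → order N ∸ order (Prod L)) ([] , [])
    ... | L , ind , least = L , ind , N-ind (prod-sub ind) contains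
      where
      contains : ∀ {h} → G h → ∀ {a} → Comp h a → Prod L a
      contains {h} Gh {a} Ca with em (∃ λ b → Comp h b × Prod L b × ¬ (b ≈ id))
      ... | yes (b , Cb , Pb , b≉) = Component.minimal-in Gh (prod-sub ind) (λ {n} {p} → prod-normal ind {n} {p}) Cb Pb b≉ Ca
      ... | no disjoint = contradiction (least (h ∷ L) ind′) (<⇒≱ (∸-monoʳ-< larger bounded))
        where
        trivial : ∀ {b} → Comp h b → Prod L b → b ≈ id
        trivial {b} Cb Pb = stable λ b≉ → disjoint (b , Cb , Pb , b≉)
        ind′ : Independent (h ∷ L)
        ind′ = cons Gh trivial ind
        bounded : order (Prod (h ∷ L)) ≤ order N
        bounded = order-injection (λ π → π) (prod⊆N ind′) (λ e → e)
        larger : order (Prod L) < order (Prod (h ∷ L))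
        larger = ≰⇒> λ le → proj₂ (proj₂ (Component.nontrivial Gh)) (trivial (proj₁ (proj₂ (Component.nontrivial Gh)))
          (order-⊆-eq {M = Prod L} {N = Prod (h ∷ L)} (IsSubgroup.resp (prod-sub ind))
            (λ {p} Pp → id , p , Component.id∈ Gh , Pp , λ _ → refl) le
            (proj₁ (Component.nontrivial Gh) , id , proj₁ (proj₂ (Component.nontrivial Gh)) , IsSubgroup.id∈ (prod-sub ind) , λ _ → refl)))

    -- Otherwise `diagonal` would put a nonidentity square of the component into `K id`, against
    -- `centreless`.
    K-not-transitive : ¬ Transitive (K id)
    K-not-transitive K-trans with independent-generators | non-involution (Component.sub G.id∈) (comp-nonabelian G.id∈)
    ... | L , ind , generates | g , Cg , gg≉
      with diagonal {M = N} {A = Comp id} {K = K id} (length L) ((N.sub , N.⊆H) , N.normal) (Component.sub G.id∈) (Component.⊆H G.id∈) proj₁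
        K-trans (λ Ca (_ , comm) → comm Ca) (λ Ca → minimal-even N-min N-nonabelian (Component.⊆H G.id∈ Ca))
        (∣-trans (∣-reflexive (≤-antisym (order-injection (λ π → π) generates (λ e → e)) (order-injection (λ π → π) (prod⊆N ind) (λ e → e)))) (order-prod ind))
        Cg gg≉
    ... | κ , Kκ , gg≈ = gg≉ (centreless G.id∈ (Component.∘∈ G.id∈ Cg Cg)
      (IsSubgroup.resp (K-sub id) (λ i → sym (gg≈ i)) (IsSubgroup.inv∈ (K-sub id) (IsSubgroup.∘∈ (K-sub id) Kκ Kκ))))

  -- Point stabilisers and the lines of the grid

  Stab : Point → PermSet v
  Stab x n = N n × x · n ≡ x

  stab-sub : ∀ x → IsSubgroup (Stab x)
  stab-sub x = record
    { resp = λ e (Nπ , fix) → N.resp e Nπ , trans (sym (e x)) fix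
    ; id∈  = N.id∈ , refl
    ; ∘∈   = λ {π} {σ} (Nπ , fix) (Nσ , fix′) → N.∘∈ Nπ Nσ , trans (cong (_· σ) fix) fix′
    ; inv∈ = λ {π} (Nπ , fix) → N.inv∈ Nπ , ·-flip-fixed π fix }

  -- The elements of N all of whose component projections agree with projections of the stabiliser of x.
  R : Point → PermSet v
  R x n = N n × (∀ {g} → G g → (Stab x ∙ K g) n)

  R-sub : ∀ x → IsSubgroup (R x)
  R-sub x = record
    { resp = λ {π} {σ} e (Nπ , r) → N.resp e Nπ , λ {g} Gg → IsSubgroup.resp (sub {g} Gg) {π} {σ} e (r Gg)
    ; id∈  = N.id∈ , λ {g} Gg → IsSubgroup.id∈ (sub {g} Gg)
    ; ∘∈   = λ {π} {σ} (Nπ , r) (Nσ , s) → N.∘∈ Nπ Nσ , λ {g} Gg → IsSubgroup.∘∈ (sub {g} Gg) {π} {σ} (r Gg) (s Gg)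
    ; inv∈ = λ {π} (Nπ , r) → N.inv∈ Nπ , λ {g} Gg → IsSubgroup.inv∈ (sub {g} Gg) {π} (r Gg) }
    where
    sub : ∀ {g} → G g → IsSubgroup (Stab x ∙ K g)
    sub {g} Gg = ∙-subgroup (stab-sub x) (K-sub g) (λ {n} {κ} (Nn , _) → K-normal Gg {n} {κ} Nn)

  R-conj : ∀ {m} → G m → ∀ x {n} → R x n → R (x · m) (n ^^ m)
  R-conj {m} Gm x {n} (Nn , r) = N.normal Gm Nn , λ {g} Gg → factors {g} (r (G.∘∈ Gg (G.inv∈ Gm)))
    where
    factors : ∀ {g} → (Stab x ∙ K (g ∘ₚ flip m)) n → (Stab (x · m) ∙ K g) (n ^^ m)
    factors {g} (a , κ , (Na , fix) , (Nκ , comm) , e) = a ^^ m , κ ^^ m ,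
      (N.normal Gm Na , trans (^^-action a m x) (cong (_· m) fix)) ,
      (N.normal Gm Nκ , λ {b} Cb → commute-sym {a = κ ^^ m} {b = b}
        (commute-cong {a = κ ^^ m} {b = (b ^^ flip m) ^^ m} {c = b} (^^-flip b m)
          (commute-sym {a = (b ^^ flip m) ^^ m} {b = κ ^^ m} (commute-^^ {a = b ^^ flip m} {b = κ} m (comm (comp-conj g (flip m) Cb)))))) ,
      λ i → trans (cong (_· m) (e (i · flip m))) (sym (^^-∘ a κ m i))

  opaque

    -- Being reached from x by `R x` is a G-invariant equivalence relation, since conjugation
    -- carries `R` along. Were it universal, writing n = m κ with m fixing x and κ in `K id` would
    -- give x n = x κ and make `K id` transitive. So it is equality.
    rigid : ∀ x {n} → R x n → x · n ≡ x
    rigid x {n} r with proj₂ G-prim _~_ ~-equiv ~-inv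
      where
      _~_ : Point → Point → Set
      x ~ y = ∃ λ n → R x n × x · n ≡ y
      ~-equiv : IsEquivalence _~_
      ~-equiv = record
        { refl  = λ {x} → id , IsSubgroup.id∈ (R-sub x) , refl
        ; sym   = λ { {x} (n , r , refl) → flip n ,
            IsSubgroup.resp (R-sub (x · n)) {flip n ^^ n} (λ i → flip-· n)
              (R-conj (N.⊆H (proj₁ r)) x (IsSubgroup.inv∈ (R-sub x) r)) , ·-flip n }
        ; trans = λ { {x} (n , r , refl) (m , s , refl) → (m ^^ flip n) ∘ₚ n ,
            IsSubgroup.∘∈ (R-sub x)
              (subst (λ y → R y (m ^^ flip n)) (·-flip n) (R-conj (G.inv∈ (N.⊆H (proj₁ r))) (x · n) s)) r ,
            flip-· n } }
      ~-inv : ∀ {g x y} → G g → x ~ y → (x · g) ~ (y · g)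
      ~-inv {g} {x} Gg (n , r , refl) = n ^^ g , R-conj Gg x r , ^^-action n g x
    ... | inj₁ trivial   = sym (trivial (n , r , refl))
    ... | inj₂ universal = ⊥-elim (K-not-transitive λ x y → K-moves x y (universal x y))
      where
      K-moves : ∀ x y → (∃ λ n → R x n × x · n ≡ y) → ∃ λ κ → K id κ × x · κ ≡ y
      K-moves x y (n , (_ , r) , e) with r G.id∈
      ... | m , κ , (_ , fix) , Kκ , n≈ = κ , Kκ , trans (cong (_· κ) (sym fix)) (trans (sym (n≈ x)) e)

    -- Modulo `K h`, the element a agrees with a κ if h and g give the same component, and with the
    -- identity otherwise. Both fix x, so a lies in `R x`.
    split : ∀ {g} → G g → ∀ {a κ} → Comp g a → K g κ → ∀ {x} → x · a · κ ≡ x → x · a ≡ x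
    split {g} Gg {a} {κ} Ca Kκ {x} fix = rigid x (Component.⊆H Gg Ca , λ {h} Gh → factors Gh (same-or-commute Gh Gg))
      where
      factors : ∀ {h} → G h → (h ⊑ g × g ⊑ h) ⊎ Commuting h g → (Stab x ∙ K h) a
      factors Gh (inj₁ (h⊑g , _)) = a ∘ₚ κ , flip κ , (N.∘∈ (Component.⊆H Gg Ca) (proj₁ Kκ) , fix) ,
        (N.inv∈ (proj₁ Kκ) , λ {b} Cb → proj₂ (IsSubgroup.inv∈ (K-sub g) Kκ) (h⊑g Cb)) , λ i → sym (·-flip κ)
      factors Gh (inj₂ c) = id , a , (N.id∈ , refl) , commuting-⊆K Gg (λ {x} {y} → c {x} {y}) Ca , λ _ → refl

    split′ : ∀ {g} → G g → ∀ {a κ} → Comp g a → K g κ → ∀ {x} → x · a · κ ≡ x → x · κ ≡ x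
    split′ Gg {a} {κ} Ca Kκ fix = trans (cong (_· κ) (sym (split Gg Ca Kκ fix))) fix

  Line : Perm v → Point → Point → Set
  Line g x y = ∃ λ a → Comp g a × x · a ≡ y

  line-refl : ∀ {g} → G g → ∀ x → Line g x x
  line-refl Gg x = id , Component.id∈ Gg , refl

  line-join : ∀ {g} → G g → ∀ {x y z} → Line g x y → Line g x z → Line g y z
  line-join Gg (a , Ca , refl) (b , Cb , refl) =
    flip a ∘ₚ b , Component.∘∈ Gg (Component.inv∈ Gg Ca) Cb , cong (_· b) (·-flip a)

  line-move : ∀ {g} w {x y} → Line g x y → Line (g ∘ₚ w) (x · w) (y · w)
  line-move {g} w {x} (a , Ca , refl) = a ^^ w , comp-conj g w Ca , ^^-action a w x

  line-⊑ : ∀ {g h} → g ⊑ h → ∀ {x y} → Line g x y → Line h x y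
  line-⊑ g⊑h (a , Ca , e) = a , g⊑h Ca , e

  -- If the components commuted, a b⁻¹ would fix x and then, by `split`, so would a.
  line-meet : ∀ {g h} → G g → G h → ∀ {x y} → x ≢ y → Line g x y → Line h x y → g ⊑ h × h ⊑ g
  line-meet {g} {h} Gg Gh {x} x≢y (a , Ca , refl) (b , Cb , e) with same-or-commute Gg Gh
  ... | inj₁ same = same
  ... | inj₂ c    = contradiction (sym (split Gg Ca (IsSubgroup.inv∈ (K-sub g) (commuting-⊆K Gh (λ {x} {y} → c {x} {y}) Cb))
                      (sym (·-flip-≡ b e)))) x≢y

  opaque

    line-≤ : ∀ {g h} → G g → G h → ∀ x y → # (Line g x) ≤ # (Line h y)
    line-≤ {g} {h} Gg Gh x y with N-trans (x · (flip g ∘ₚ h)) y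
    ... | n , Nn , refl = #-injection (λ p q → p · (flip g ∘ₚ h) · n ≡ q)
      (λ { p (a , Ca , refl) → _ , ((a ^^ (flip g ∘ₚ h)) ^^ n , Component.normal Gh Nn (shift Ca) ,
        trans (^^-action (a ^^ (flip g ∘ₚ h)) n (x · (flip g ∘ₚ h))) (cong (_· n) (^^-action a (flip g ∘ₚ h) x))) , refl })
      (λ _ _ _ e e′ → ·-injective (flip g ∘ₚ h) (·-injective n (trans e (sym e′))))
      where
      shift : ∀ {a} → Comp g a → Comp h (a ^^ (flip g ∘ₚ h))
      shift {a} (comp Aa) = comp (A.resp {a ^^ flip g} {(a ^^ (flip g ∘ₚ h)) ^^ flip h}
        (λ i → sym (trans (·-flip h) (cong (λ y → y · g · a · flip g) (·-flip h)))) Aa)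

    -- Lines have e + 1 points.
    e : ℕ
    e = # (λ y → Line id origin y × y ≢ origin)

    line-size : ∀ {g} → G g → ∀ x → # (Line g x) ≡ suc e
    line-size Gg x = trans (≤-antisym (line-≤ Gg G.id∈ x origin) (line-≤ G.id∈ Gg origin x)) (#-remove (line-refl G.id∈ origin))

    line-rest : ∀ {g} → G g → ∀ x → # (λ y → Line g x y × y ≢ x) ≡ e
    line-rest Gg x = suc-injective (trans (sym (#-remove (line-refl Gg x))) (line-size Gg x))

    -- If x, x a and x a a were never three points, all squares in the component would be trivial
    -- and it would be abelian.
    2≤e : 2 ≤ e
    2≤e = stable λ small → comp-nonabelian G.id∈ (exponent-2-abelian (Component.sub G.id∈)
      (λ {a} Ca x → stable λ xaa≢x → small (≤-pred (subst (3 ≤_) (line-size G.id∈ x)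
        (#≥3 (line-refl G.id∈ x) (a , Ca , refl) (a ∘ₚ a , Component.∘∈ G.id∈ Ca Ca , refl)
          (λ eq → xaa≢x (trans (cong (_· a) eq) eq)) xaa≢x
          (λ eq → xaa≢x (trans eq (·-injective a eq))))))))

  prod-split : ∀ {g L} → G g → (∀ {a} → Comp g a → Prod L a → a ≈ id) → Independent L →
    ∀ {x a b p q} → Comp g a → Comp g b → Prod L p → Prod L q → x · a · p ≡ x · b · q → x · a ≡ x · b × x · p ≡ x · q
  prod-split {g} {L} Gg disjoint ind {x} {a} {b} {p} {q} Ca Cb Pp Pq eq =
    trans (sym (flip-· b)) (cong (_· b) (split Gg {a ∘ₚ flip b} {p ∘ₚ flip q} Cab Kpq fix)) ,
    trans (sym (flip-· q)) (cong (_· q) (split′ Gg {a ∘ₚ flip b} {p ∘ₚ flip q} Cab Kpq fix))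
    where
    Cab : Comp g (a ∘ₚ flip b)
    Cab = Component.∘∈ Gg Ca (Component.inv∈ Gg Cb)
    Kp : K g p
    Kp = prod⊆K Gg disjoint ind Pp
    Kpq : K g (p ∘ₚ flip q)
    Kpq = IsSubgroup.∘∈ (K-sub g) Kp (IsSubgroup.inv∈ (K-sub g) (prod⊆K Gg disjoint ind Pq))
    fix : x · a · flip b · p · flip q ≡ x
    fix = begin
      x · a · flip b · p · flip q    ≡⟨ proj₂ Kpq (Component.inv∈ Gg Cb) (x · a) ⟩
      x · a · p · flip q · flip b    ≡⟨ cong (λ y → y · flip q · flip b) eq ⟩
      x · b · q · flip q · flip b    ≡⟨ cong (_· flip b) (·-flip q) ⟩
      x · b · flip b                 ≡⟨ ·-flip b ⟩
      x                              ∎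
      where open ≡-Reasoning

  opaque

    -- By `prod-split` distinct pairs (x a, x p) give distinct points x a p, so an independent list
    -- spans a grid with e + 1 points in each direction.
    prod-orbit : ∀ {L} → Independent L → ∀ x → suc e ^ length L ≤ # (λ y → ∃ λ p → Prod L p × x · p ≡ y)
    prod-orbit [] x = #≥1 (id , (λ _ → refl) , refl)
    prod-orbit {g ∷ L} (cons Gg disjoint ind) x = begin
      suc e * suc e ^ length L    ≤⟨ *-monoʳ-≤ (suc e) (prod-orbit ind x) ⟩
      suc e * # O                 ≡⟨ *-comm (suc e) (# O) ⟩
      # O * suc e                 ≡⟨ cong (# O *_) (sym (line-size Gg x)) ⟩
      # O * # (Line g x)          ≡⟨ sym (#-fibre {P = Line g x} {Q = λ _ → O} (λ _ _ → refl)) ⟩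
      # (λ (yz : Point × Point) → Line g x (proj₁ yz) × O (proj₂ yz))
        ≤⟨ #-injection (λ (y , z) w → ∃ λ a → ∃ λ p → (Comp g a × Prod L p) × (x · a ≡ y × x · p ≡ z) × x · a · p ≡ w)
             (λ (y , z) ((a , Ca , ea) , (p , Pp , ep)) → x · a · p , (a ∘ₚ p , (a , p , Ca , Pp , λ _ → refl) , refl) ,
               a , p , (Ca , Pp) , (ea , ep) , refl)
             (λ { _ _ _ (a , p , (Ca , Pp) , (refl , refl) , eq) (b , q , (Cb , Pq) , (refl , refl) , eq′) →
               let both = prod-split Gg disjoint ind {x} {a} {b} {p} {q} Ca Cb Pp Pq (trans eq (sym eq′)) in
               cong₂ _,_ (proj₁ both) (proj₂ both) }) ⟩
      # (λ y → ∃ λ p → Prod (g ∷ L) p × x · p ≡ y)    ∎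
      where
      open ≤-Reasoning
      O : Point → Set
      O z = ∃ λ p → Prod L p × x · p ≡ z

  gens : List (Perm v)
  gens = proj₁ independent-generators

  gens-independent : Independent gens
  gens-independent = proj₁ (proj₂ independent-generators)

  gens-generate : ∀ {n} → N n → Prod gens n
  gens-generate = proj₂ (proj₂ independent-generators)

  m d : ℕ
  m = length gens
  d = m * e

  -- Otherwise `Comp h` would commute with every generating component and so centralise N.
  same-as-generator : ∀ {h} → G h → ∃ λ g → g List.∈ gens × h ⊑ g × g ⊑ h
  same-as-generator {h} Gh = stable λ none → not-central (commutes gens-independent λ g∈ same → none (_ , g∈ , same))
    where
    commutes : ∀ {L} → Independent L → (∀ {g} → g List.∈ L → ¬ (h ⊑ g × g ⊑ h)) →
      ∀ {a p} → Comp h a → Prod L p → Commute a p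
    commutes [] none {a} {p} Ca e = commute-cong {a = a} {b = id} {c = p} (λ i → sym (e i)) (λ _ → refl)
    commutes (cons Gg _ ind) none {a} {p} Ca (b , q , Cb , Pq , e) with same-or-commute Gh Gg
    ... | inj₁ same = contradiction same (none (here refl))
    ... | inj₂ c    = commute-cong {a = a} {b = b ∘ₚ q} {c = p} (λ i → sym (e i))
        (commute-∘ {a = a} {b = b} {c = q} (c {a} {b} Ca Cb) (commutes ind (λ g∈ → none (there g∈)) {a} {q} Ca Pq))
    not-central : ¬ (∀ {a p} → Comp h a → Prod gens p → Commute a p)
    not-central comm with Component.nontrivial Gh
    ... | a , Ca , a≉ = centraliser-trivial N-min N-nonabelian
      (a , (N.⊆H (Component.⊆H Gh Ca) , λ {n} Nn → commute-sym {a = a} {b = n} (comm {a} {n} Ca (gens-generate Nn))) , a≉)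

  -- Collinear points and symmetric families

  Γ : Point → Point → Set
  Γ x y = x ≢ y × ∃ λ g → G g × Line g x y

  opaque

    Γ-count : ∀ x → # (Γ x) ≤ d
    Γ-count x = ≤-trans (#-mono covered) (lines gens-independent)
      where
      On : List (Perm v) → Point → Set
      On L y = ∃ λ g → g List.∈ L × Line g x y × y ≢ x
      covered : ∀ y → Γ x y → On gens y
      covered y (x≢y , h , Gh , l) with same-as-generator Gh
      ... | g , g∈ , h⊑g , _ = g , g∈ , line-⊑ {h} {g} h⊑g l , λ e → x≢y (sym e)
      lines : ∀ {L} → Independent L → # (On L) ≤ length L * e
      lines [] = ≤-reflexive (#-empty λ { y (_ , () , _) })
      lines {g ∷ L} (cons Gg _ ind) = ≤-trans
        (#-mono (λ { y (h , here refl , l) → inj₁ l ; y (h , there h∈ , l) → inj₂ (h , h∈ , l) }))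
        (≤-trans (#-∪ (λ y → Line g x y × y ≢ x) (On L)) (+-mono-≤ (≤-reflexive (line-rest Gg x)) (lines ind)))

    -- An empty list would make N trivial; a single component would exhaust N and force N = A.
    2≤m : 2 ≤ m
    2≤m = go gens-independent gens-generate
      where
      not-single : ∀ {g} → G g → (∀ {n} → N n → Prod (g ∷ []) n) → ¬ (∃ λ b → N b × ¬ A b)
      not-single {g} Gg generate (b , Nb , ¬Ab) with generate (N.normal Gg Nb)
      ... | a , p , Ca , p≈ , eq = ¬Ab (comp-A g (Component.resp Gg {a} {b ^^ g} (λ i → sym (trans (eq i) (p≈ (i · a)))) Ca))
      go : ∀ {L} → Independent L → (∀ {n} → N n → Prod L n) → 2 ≤ length L
      go [] generate = contradiction (generate (proj₁ (proj₂ N.nontrivial))) (proj₂ (proj₂ N.nontrivial))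
      go {g ∷ []} (cons Gg _ []) generate = ⊥-elim (not-single Gg generate A-proper)
      go {_ ∷ _ ∷ _} _ _ = s≤s (s≤s z≤n)

    -- The grid gives v ≥ (e + 1)^m, whereas d is only m e.
    root : ∃ λ q → d + 2 ≤ 2 * q × q * q ≤ 2 + u
    root with square-root-bound 2≤e m 2≤m
    ... | q , dq , qq = q , dq , ≤-trans qq (≤-trans (prod-orbit gens-independent origin)
      (≤-trans (#-mono (λ _ _ → tt)) (≤-reflexive #-point)))

    no-symmetric-family : ∀ {F} → Family F →
      (∀ {x y z} → F (y , x , z) → F (y , z , x)) → (∀ {x y z} → F (y , x , z) → Γ y x) →
      (∀ {x y z z′} → F (y , x , z) → F (y , x , z′) → z ≡ z′) → ¬ ∃ F
    no-symmetric-family fam F-sym F⊆Γ functional F-inhabited =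
      family-bound {q = proj₁ root} 2≤t fisher (proj₁ (proj₂ root)) (proj₂ (proj₂ root))
        (symmetric-family {Γ = Γ} fam F-sym F⊆Γ functional Γ-count F-inhabited)

    -- The family of the triples (y , y t⁻¹ , y t) with t in a component and t² ≠ 1.
    not-semiregular : ¬ (∀ {a} x → Comp id a → x · a ≡ x → a ≈ id)
    not-semiregular semi₁ = no-symmetric-family fam
      (λ { (g , t , Gg , Ct , tt≉ , refl , refl) → g , flip t , Gg , Component.inv∈ Gg Ct ,
        (λ eq → tt≉ λ i → sym (trans (sym (flip-· (t ∘ₚ t))) (cong (λ j → j · t · t) (eq i)))) , refl , refl })
      (λ { f@(g , t , Gg , Ct , _ , refl , _) → proj₁ (Family.distinct fam f) , g , Gg , flip t , Component.inv∈ Gg Ct , refl })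
      (λ { {y = y} f@(g , t , Gg , Ct , _ , refl , refl) (h , s , Gh , Cs , _ , eq , refl) →
        functional Gg Gh Ct Cs (proj₁ (Family.distinct fam f)) eq })
      (exists (non-involution (Component.sub G.id∈) (comp-nonabelian G.id∈)))
      where
      F : Triple → Set
      F (y , x , z) = ∃ λ g → ∃ λ t → G g × Comp g t × ¬ ((t ∘ₚ t) ≈ id) × x ≡ y · flip t × z ≡ y · t
      semi : ∀ {g} → G g → ∀ {a} x → Comp g a → x · a ≡ x → a ≈ id
      semi {g} Gg {a} x Ca fix i = ·-injective (flip g) (trans (sym (^^-action a (flip g) i))
        (semi₁ {a ^^ flip g} (x · flip g) (comp (A.resp {a ^^ flip g} (λ _ → refl) (Comp.in-A Ca))) (trans (^^-action a (flip g) x) (cong (_· flip g) fix)) (i · flip g)))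
      fam : Family F
      fam = record
        { distinct = λ { {y , _ , _} (g , t , Gg , Ct , tt≉ , refl , refl) →
            (λ eq → tt≉ (let t≈ = semi Gg y Ct (trans (cong (_· t) eq) (flip-· t)) in λ i → trans (t≈ (i · t)) (t≈ i))) ,
            (λ eq → tt≉ (let t≈ = semi Gg y Ct (sym eq) in λ i → trans (t≈ (i · t)) (t≈ i))) ,
            (λ eq → tt≉ (semi Gg y (Component.∘∈ Gg Ct Ct) (trans (cong (_· t) (sym eq)) (flip-· t)))) }
        ; invariant = λ { {y , _ , _} {w} Gw (g , t , Gg , Ct , tt≉ , refl , refl) →
            g ∘ₚ w , t ^^ w , G.∘∈ Gg Gw , comp-conj g w Ct ,
            (λ eq → tt≉ λ i → ·-injective w (trans (sym (^^-action (t ∘ₚ t) w i)) (trans (sym (^^-∘ t t w (i · w))) (eq (i · w))))) ,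
            sym (^^-action (flip t) w y) , sym (^^-action t w y) } }
      -- Two points determine the component, so t and s lie in the same one; t⁻¹ s fixes y and is
      -- therefore the identity.
      functional : ∀ {g h t s} → G g → G h → Comp g t → Comp h s → ∀ {y} → y ≢ y · flip t → y · flip t ≡ y · flip s → y · t ≡ y · s
      functional {g} {h} {t} {s} Gg Gh Ct Cs {y} y≢ eq =
        trans (sym (semi Gg y Cts (trans (cong (_· s) eq) (flip-· s)) (y · t))) (cong (_· s) (·-flip t))
        where
        same : g ⊑ h × h ⊑ g
        same = line-meet Gg Gh y≢ (flip t , Component.inv∈ Gg Ct , refl) (flip s , Component.inv∈ Gh Cs , sym eq)
        Cts : Comp g (flip t ∘ₚ s)
        Cts = Component.∘∈ Gg (Component.inv∈ Gg Ct) (proj₂ same Cs)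
      exists : (∃ λ t → Comp id t × ¬ ((t ∘ₚ t) ≈ id)) → ∃ F
      exists (t , Ct , tt≉) = (origin , origin · flip t , origin · t) , id , t , G.id∈ , Ct , tt≉ , refl , refl

  _≼_ : Point → Point → Set
  x ≼ y = ∀ {n} → N n → x · n ≡ x → y · n ≡ y

  opaque

    -- The preorder `≼` is symmetric by counting: if x ≼ y, the points above y are among those above
    -- x, and all these sets are equally large. By primitivity it is equality or universal; in the
    -- latter case a component element fixing one point fixes all, against `not-semiregular`.
    stabiliser-determines : ∀ {x y} → x ≼ y → x ≡ y
    stabiliser-determines {x} {y} x≼y with proj₂ G-prim _≼_ ≼-equiv (λ {g} Gg → ≼-move {g} Gg)
      where
      ≼-trans : ∀ {x y z} → x ≼ y → y ≼ z → x ≼ z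
      ≼-trans xy yz Nn fix = yz Nn (xy Nn fix)
      ≼-move : ∀ {w} → G w → ∀ {x y} → x ≼ y → (x · w) ≼ (y · w)
      ≼-move {w} Gw {x} {y} xy {n} Nn fix = trans (sym (flip-· w))
        (cong (_· w) (xy {n ^^ flip w} (N.normal (G.inv∈ Gw) Nn) (trans (cong (_· flip w) fix) (·-flip w))))
      ≼-count : ∀ x y → # (x ≼_) ≤ # (y ≼_)
      ≼-count x y with N-trans x y
      ... | n , Nn , refl = #-injection (λ z z′ → z · n ≡ z′) (λ z xz → z · n , (λ {m} → ≼-move (N.⊆H Nn) {x} {z} xz {m}) , refl)
        (λ _ _ _ e e′ → ·-injective n (trans e (sym e′)))
      ≼-equiv : IsEquivalence _≼_
      ≼-equiv = record
        { refl  = λ _ fix → fix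
        ; sym   = λ {x} {y} xy {n} → #-⊆-eq {P = y ≼_} {Q = x ≼_} (λ z yz {n} → ≼-trans {x} {y} {z} xy yz {n}) (≼-count x y) {x} (λ _ fix → fix) {n}
        ; trans = λ {x} {y} {z} xy yz {n} → ≼-trans {x} {y} {z} xy yz {n} }
    ... | inj₁ trivial   = trivial (λ {n} → x≼y {n})
    ... | inj₂ universal = ⊥-elim (not-semiregular λ {a} x Ca fix y → universal x y {a} (Component.⊆H G.id∈ Ca) fix)

    -- Otherwise every a κ in N fixing x fixes y = x b: by `split` both factors fix x, so a fixes y
    -- by assumption, and κ does because it commutes with b. This contradicts
    -- `stabiliser-determines`.
    moved : ∀ {g} → G g → ∀ {x y} → Line g x y → x ≢ y → ∃ λ w → Comp g w × x · w ≡ x × y · w ≢ y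
    moved {g} Gg {x} {y} (b , Cb , refl) x≢y = stable λ none → x≢y (stabiliser-determines λ {n} Nn fix → fixes none {n} fix (factor Gg Nn))
      where
      fixes : ¬ (∃ λ w → Comp g w × x · w ≡ x × y · w ≢ y) → ∀ {n} → x · n ≡ x → (Comp g ∙ K g) n → y · n ≡ y
      fixes none {n} fix (a , κ , Ca , Kκ , n≈) = trans (n≈ y) (trans (cong (_· κ) ya) yκ)
        where
        xaκ : x · a · κ ≡ x
        xaκ = trans (sym (n≈ x)) fix
        ya : y · a ≡ y
        ya = stable λ ya≢y → none (a , Ca , split Gg Ca Kκ xaκ , ya≢y)
        yκ : x · b · κ ≡ x · b
        yκ = trans (proj₂ Kκ Cb x) (cong (_· b) (split′ Gg Ca Kκ xaκ))

  opaque

    -- The family of the triples (y , x , z) with {x , z} an orbit of a component's stabiliser of y is ruled out.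
    orbit-≥3 : ∀ {g} → G g → ∀ {x y} → Line g y x → x ≢ y →
      ∃ λ w₁ → ∃ λ w₂ → (Comp g w₁ × y · w₁ ≡ y) × (Comp g w₂ × y · w₂ ≡ y) × (x · w₁ ≢ x × x · w₂ ≢ x × x · w₂ ≢ x · w₁)
    orbit-≥3 {g₀} Gg₀ {x₀} {y₀} l₀ x₀≢y₀ with moved Gg₀ l₀ (λ e → x₀≢y₀ (sym e))
    -- Without a suitable w₂, every element of the component fixing y₀ sends x₀ to itself or to x₀
    -- w₁, which puts (y₀, x₀, x₀ w₁) into the family.
    ... | w₁ , Cw₁ , fix₁ , move₁ = stable λ none → no-symmetric-family fam F-sym
        (λ (x≢y , _ , g , Gg , l , _) → (λ e → x≢y (sym e)) , g , Gg , l) functional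
        ((y₀ , x₀ , x₀ · w₁) , x₀≢y₀ , (λ e → move₁ (sym e)) , g₀ , Gg₀ , l₀ , (w₁ , Cw₁ , fix₁ , refl) ,
          λ {w} Cw fix → dichotomy none Cw fix)
      where
      F : Triple → Set
      F (y , x , z) = x ≢ y × x ≢ z × ∃ λ g → G g × Line g y x × (∃ λ w → Comp g w × y · w ≡ y × x · w ≡ z) ×
        (∀ {w} → Comp g w → y · w ≡ y → x · w ≡ x ⊎ x · w ≡ z)
      dichotomy : ¬ (∃ λ w₁ → ∃ λ w₂ → (Comp g₀ w₁ × y₀ · w₁ ≡ y₀) × (Comp g₀ w₂ × y₀ · w₂ ≡ y₀) × (x₀ · w₁ ≢ x₀ × x₀ · w₂ ≢ x₀ × x₀ · w₂ ≢ x₀ · w₁)) →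
        ∀ {w} → Comp g₀ w → y₀ · w ≡ y₀ → x₀ · w ≡ x₀ ⊎ x₀ · w ≡ x₀ · w₁
      dichotomy none {w} Cw fix with em (x₀ · w ≡ x₀) | em (x₀ · w ≡ x₀ · w₁)
      ... | yes e | _     = inj₁ e
      ... | no _  | yes e = inj₂ e
      ... | no ¬e | no ¬f = contradiction (w₁ , w , (Cw₁ , fix₁) , (Cw , fix) , (move₁ , ¬e , ¬f)) none
      F-sym : ∀ {x y z} → F (y , x , z) → F (y , z , x)
      F-sym {x} {y} (x≢y , x≢z , g , Gg , (a , Ca , refl) , (w , Cw , fix , refl) , both) =
        (λ e → x≢y (·-injective w (trans e (sym fix)))) , (λ e → x≢z (sym e)) , g , Gg ,
        (a ∘ₚ w , Component.∘∈ Gg Ca Cw , refl) , (flip w , Component.inv∈ Gg Cw , ·-flip-fixed w fix , ·-flip w) ,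
        λ {w′} Cw′ fix′ → [ inj₂ , inj₁ ]′ (both (Component.∘∈ Gg Cw Cw′) (trans (cong (_· w′) fix) fix′))
      functional : ∀ {x y z z′} → F (y , x , z) → F (y , x , z′) → z ≡ z′
      functional (x≢y , x≢z , g , Gg , l , _ , both) (_ , x≢z′ , h , Gh , l′ , (w′ , Cw′ , fix′ , refl) , _)
        with both (proj₂ (line-meet Gg Gh (λ e → x≢y (sym e)) l l′) Cw′) fix′
      ... | inj₁ e = contradiction (sym e) x≢z′
      ... | inj₂ e = sym e
      back : ∀ g w {c} → Comp (g ∘ₚ w) c → Comp g (c ^^ flip w)
      back g w {c} (comp Ac) = comp (A.resp {c ^^ flip (g ∘ₚ w)} (λ _ → refl) Ac)
      fam : Family F
      fam = record
        { distinct = λ { (x≢y , x≢z , g , Gg , l , (w , Cw , fix , refl) , _) →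
            (λ e → x≢y (sym e)) , (λ e → x≢y (·-injective w (trans (sym e) (sym fix)))) , x≢z }
        ; invariant = λ { {y , x , z} {c} Gc (x≢y , x≢z , g , Gg , l , (w , Cw , fix , refl) , both) →
            (λ e → x≢y (·-injective c e)) , (λ e → x≢z (·-injective c e)) , g ∘ₚ c , G.∘∈ Gg Gc , line-move {g} c l ,
            (w ^^ c , comp-conj g c Cw , trans (^^-action w c y) (cong (_· c) fix) , ^^-action w c x) ,
            λ {s} Cs sfix → [ (λ e → inj₁ (trans (sym (flip-· c)) (cong (_· c) e)))
                            , (λ e → inj₂ (trans (sym (flip-· c)) (cong (_· c) e))) ]′
              (both {s ^^ flip c} (back g c Cs) (trans (cong (_· flip c) sfix) (·-flip c))) } }

    -- The block B on three points p, q, r of a line contains, for each of its points w, two further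
    -- points collinear with w, against `collinear-bound`. If w is on the line, these are among p,
    -- q, r; if not, they are images of w under elements of another component that fix the line
    -- pointwise and hence fix B.
    impossible : ⊥
    impossible with #-pick₃ (subst (3 ≤_) (sym (line-size G.id∈ origin)) (s≤s 2≤e))
    ... | p , q , r , (lp , lq , lr) , p≢q , p≢r , q≢r with block-through p≢q p≢r q≢r
    ... | B , bB , p∈B , q∈B , r∈B = collinear-bound {q = proj₁ root} 2≤t fisher (proj₁ (proj₂ root)) (proj₂ (proj₂ root))
        (collinear-pairs {Γ = Γ} proj₁
          (λ {x} {y} {g} Gg (x≢y , h , Gh , l) → (λ e → x≢y (·-injective g e)) , h ∘ₚ g , G.∘∈ Gh Gg , line-move {h} g l)
          Γ-count bB two)
      where
      x : Point
      x = origin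

      on-line : ∀ w → Line id x w → 2 ≤ # (λ y → y ∈ B × Γ w y)
      on-line w lw with em (w ≡ p) | em (w ≡ q)
      ... | yes refl | _        = #≥2 (q∈B , p≢q , id , G.id∈ , line-join G.id∈ lw lq) (r∈B , p≢r , id , G.id∈ , line-join G.id∈ lw lr) (λ e → q≢r (sym e))
      ... | no w≢p   | yes refl = #≥2 (p∈B , w≢p , id , G.id∈ , line-join G.id∈ lw lp) (r∈B , q≢r , id , G.id∈ , line-join G.id∈ lw lr) (λ e → p≢r (sym e))
      ... | no w≢p   | no w≢q   = #≥2 (p∈B , w≢p , id , G.id∈ , line-join G.id∈ lw lp) (q∈B , w≢q , id , G.id∈ , line-join G.id∈ lw lq) (λ e → p≢q (sym e))

      Mover : Point → Perm v → Perm v → Set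
      Mover w h s = G h × Commuting id h × Comp h s × x · s ≡ x × w · s ≢ w

      -- If no such element exists then w = y · a with a in the component and y having the same stabiliser as x.
      mover : ∀ w → ¬ Line id x w → ∃ λ h → ∃ λ s → Mover w h s
      mover w off = stable λ none → off (back none)
        where
        back : ¬ (∃ λ h → ∃ λ s → Mover w h s) → Line id x w
        back none with N-trans x w
        ... | n , Nn , xn with factor G.id∈ Nn
        ... | a , κ , Ca , Kκ , n≈ = a , Ca , trans (cong (_· a) x≡y) (sym w≡)
          where
          y : Point
          y = x · κ
          w≡ : w ≡ y · a
          w≡ = trans (sym xn) (trans (n≈ x) (proj₂ Kκ Ca x))
          y-fixed : ∀ {h b} → G h → Comp h b → x · b ≡ x → y · b ≡ y
          y-fixed {h} {b} Gh Cb fix with same-or-commute G.id∈ Gh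
          ... | inj₁ (_ , h⊑) = trans (sym (proj₂ Kκ (h⊑ Cb) x)) (cong (_· κ) fix)
          ... | inj₂ c = ·-injective a (trans (sym (c {a} {b} Ca Cb y)) (trans (cong (_· b) (sym w≡))
                (trans (stable λ moves → none (h , b , Gh , (λ {i} {j} → c {i} {j}) , Cb , fix , moves)) w≡)))
          prod-fixed : ∀ {L} → Independent L → ∀ {n} → Prod L n → x · n ≡ x → y · n ≡ y
          prod-fixed [] e fix = e y
          prod-fixed {g ∷ L} (cons Gg disjoint ind) (b , c , Cb , Pc , e) fix = trans (e y)
            (trans (cong (_· c) (y-fixed Gg Cb (split Gg Cb Kc xbc))) (prod-fixed ind Pc (split′ Gg Cb Kc xbc)))
            where
            Kc : K g c
            Kc = prod⊆K Gg disjoint ind Pc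
            xbc : x · b · c ≡ x
            xbc = trans (sym (e x)) fix
          x≡y : x ≡ y
          x≡y = stabiliser-determines λ Nn fix → prod-fixed gens-independent (gens-generate Nn) fix

      off-line : ∀ w → w ∈ B → ∃ (λ h → ∃ λ s → Mover w h s) → 2 ≤ # (λ y → y ∈ B × Γ w y)
      off-line w w∈B (h , s , Gh , comm , Cs , xs , ws≢w) with N-trans x w
      ... | n , Nn , xn with factor Gh Nn
      -- With w = x a κ, s moves x a, so x a differs from x. The stabiliser of x in the component of
      -- h takes x a to two further points, and κ, which commutes with that component, carries this
      -- over to w.
      ... | a , κ , Ca , Kκ , n≈ with orbit-≥3 Gh {x · a} {x} (a , Ca , refl) (λ e → zs≢z (trans (cong (_· s) e) (trans xs (sym e))))
        where
        zs≢z : x · a · s ≢ x · a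
        zs≢z e = ws≢w (trans (cong (_· s) w≡) (trans (sym (proj₂ Kκ Cs (x · a))) (trans (cong (_· κ) e) (sym w≡))))
          where
          w≡ : w ≡ x · a · κ
          w≡ = trans (sym xn) (n≈ x)
      ... | w₁ , w₂ , (C₁ , fix₁) , (C₂ , fix₂) , move₁ , move₂ , differ =
        #≥2 (inB C₁ fix₁ , (λ e → move₁ (cancel C₁ e)) , h , Gh , w₁ , C₁ , refl)
            (inB C₂ fix₂ , (λ e → move₂ (cancel C₂ e)) , h , Gh , w₂ , C₂ , refl)
            (λ e → differ (·-injective κ (trans (proj₂ Kκ C₂ (x · a)) (trans (cong (_· w₂) (sym w≡)) (trans e (trans (cong (_· w₁) w≡) (sym (proj₂ Kκ C₁ (x · a)))))))))
        where
        w≡ : w ≡ x · a · κ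
        w≡ = trans (sym xn) (n≈ x)
        cancel : ∀ {c} → Comp h c → w ≡ w · c → x · a · c ≡ x · a
        cancel {c} Cc e = ·-injective κ (trans (proj₂ Kκ Cc (x · a)) (trans (cong (_· c) (sym w≡)) (trans (sym e) w≡)))
        line-fixed : ∀ {c} → Comp h c → x · c ≡ x → ∀ {y} → Line id x y → y · c ≡ y
        line-fixed {c} Cc fix (b , Cb , refl) = trans (comm {b} {c} Cb Cc x) (cong (_· b) fix)
        inB : ∀ {c} → Comp h c → x · c ≡ x → w · c ∈ B
        inB {c} Cc fix = subst (w · c ∈_) (aut-fixes′ c (aut (N.⊆H (Component.⊆H Gh Cc))) bB p≢q p≢r q≢r p∈B q∈B r∈B
          (line-fixed Cc fix lp) (line-fixed Cc fix lq) (line-fixed Cc fix lr)) (∈-image c w∈B)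

      two : ∀ w → w ∈ B → 2 ≤ # (λ y → y ∈ B × Γ w y)
      two w w∈B with em (Line id x w)
      ... | yes lw = on-line w lw
      ... | no off = off-line w w∈B (mover w off)

-- Excluded middle from primitivity, and the conclusion

excluded-middle : ∀ {v} {G : PermSet v} → Primitive G → ∀ {x y : Fin v} → x ≢ y → EM
excluded-middle {v} {G} (_ , primitive-on) {x} {y} x≢y P = decide (primitive-on R R-equiv R-inv)
  where
  R : Fin v → Fin v → Set
  R x y = x ≡ y ⊎ P
  R-equiv : IsEquivalence R
  R-equiv = record
    { refl  = inj₁ refl
    ; sym   = [ (λ e → inj₁ (sym e)) , inj₂ ]′
    ; trans = λ { (inj₂ p) _ → inj₂ p ; (inj₁ refl) r → r } }
  R-inv : ∀ {g x y} → G g → R x y → R (x · g) (y · g)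
  R-inv {g} _ = [ (λ e → inj₁ (cong (_· g) e)) , inj₂ ]′
  decide : (∀ {x y} → R x y → x ≡ y) ⊎ (∀ x y → R x y) → Dec P
  decide (inj₁ trivial) = no λ p → x≢y (trivial (inj₂ p))
  decide (inj₂ universal) with universal x y
  ... | inj₁ e = contradiction e x≢y
  ... | inj₂ p = yes p

module Classification (em : EM) {v k u t : ℕ} (D : Steiner3Design v k)
  (v≡ : v ≡ suc (suc u)) (k≡ : k ≡ suc (suc t)) (2≤t : 2 ≤ t) (t<u : t < u)
  (G : PermSet v) (G-aut : SubgroupOfAut D G) (G-trans : BlockTransitive D G) (G-prim : Primitive G) where

  open Counting em using (stable)
  open Groups em {v}
  open Design em D v≡ k≡ 2≤t t<u using (three-points)
  open PointPrimitiveGroup em D v≡ k≡ 2≤t t<u G G-aut G-trans G-prim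

  G-nontrivial : Nontrivial G
  G-nontrivial with three-points
  ... | x , y , _ , x≢y , _ with proj₁ G-prim x y
  ... | g , Gg , xg = g , Gg , λ g≈ → x≢y (trans (sym (g≈ x)) xg)

  -- If b were outside the closure of a, a minimal normal subgroup A of N would be proper: either a
  -- is not in A, or A lies in that closure and misses b.
  minimal-normal-simple : ∀ {N : PermSet v} → MinimalNormal N G → ¬ Abelian N →
    ∀ {a} → N a → ¬ (a ≈ id) → ∀ {b} → N b → Closure a N b
  minimal-normal-simple {N} N-min N-nonabelian {a} Na a≉ {b} Nb = stable λ b∉ → contra b∉ (minimal-normal N-sub N-nontrivial)
    where
    open MinimalNormal N-min renaming (sub to N-sub; nontrivial to N-nontrivial)
    contra : ¬ Closure a N b → (Σ (PermSet v) λ A → MinimalNormal A N) → ⊥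
    contra b∉ (A , A-min) = Components.impossible em D v≡ k≡ 2≤t t<u G G-aut G-trans G-prim N-min N-nonabelian A-min proper
      where
      proper : ∃ λ b → N b × ¬ A b
      proper with em (A a)
      ... | no ¬Aa = a , Na , ¬Aa
      ... | yes Aa = b , Nb , λ Ab → b∉ (MinimalNormal.minimal-in A-min closure-subgroup
        (λ {h} {p} → closure-normal N-sub {h} {p}) Aa (closure-gen N-sub) a≉ Ab)

  affine-or-almost-simple : AffineType G ⊎ AlmostSimpleType G
  affine-or-almost-simple with minimal-normal (proj₁ G-aut) G-nontrivial
  ... | N , N-min with em (Abelian N)
  ... | yes abelian = inj₁ (abelian-minimal-affine N-min abelian
    (normal-transitive (MinimalNormal.sub N-min) (λ {h} {p} → MinimalNormal.normal N-min {h} {p}) (MinimalNormal.nontrivial N-min)))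
  ... | no ¬abelian = inj₂ (simple-almost-simple N-min ¬abelian
    (λ {a} Na a≉ {b} Nb → minimal-normal-simple N-min ¬abelian {a} Na a≉ {b} Nb))

theorem1p2 : (v k : ℕ) (D : Steiner3Design v k) →
    3 < k → k + 3 < v →
    (G : PermSet v) → SubgroupOfAut D G → BlockTransitive D G → Primitive G →
    AffineType G ⊎ AlmostSimpleType G
theorem1p2 v k D 3<k k+3<v G G-aut G-trans G-prim =
  -- Here u = v - 2 and t = k - 2; 3 < k gives t ≥ 2, and k < v gives t < u.
  Classification.affine-or-almost-simple (excluded-middle G-prim 0≢1) D
    (sym (m+[n∸m]≡n (<⇒≤ 2<v))) (sym (m+[n∸m]≡n 2≤k)) (∸-monoˡ-≤ 2 3<k) (∸-monoˡ-< k<v 2≤k) G G-aut G-trans G-prim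
  where
  2≤k : 2 ≤ k
  2≤k = ≤-trans (s≤s (s≤s z≤n)) 3<k
  k<v : k < v
  k<v = ≤-trans (s≤s (m≤m+n k 3)) k+3<v
  2<v : 2 < v
  2<v = ≤-trans (s≤s 2≤k) k<v
  0≢1 : fromℕ< (≤-trans (s≤s z≤n) 2<v) ≢ fromℕ< (≤-trans (s≤s (s≤s z≤n)) 2<v)
  0≢1 e = contradiction (trans (sym (toℕ-fromℕ< _)) (trans (cong toℕ e) (toℕ-fromℕ< _))) λ ()
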